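{- Let $n \geq 5000$ and let $G$ and $H$ be graphs on $n$ vertices such that $G$ is a tree and $G$ and $H$ have at least $\lfloor n/2\rfloor + 2$ common cards. Then $H$ is a tree. (Equivalently: for $n\ge 5000$, whether a graph on $n$ vertices is a tree can be determined from any $\lfloor n/2\rfloor+2$ of its cards.)
   Context: All graphs are finite and simple. For a graph $X$ and a vertex $v$, the card $X-v$ is the unlabeled graph obtained by deleting $v$ and its incident edges; the deck of $X$ is the multiset $\{X-v : v\in V(X)\}$. The number of common cards of two graphs $X,Y$ on the same number of vertices is the size of the multiset intersection of their decks, i.e. the largest $m$ such that there are distinct vertices $x_1,\dots,x_m$ of $X$ and distinct vertices $y_1,\dots,y_m$ of $Y$ with $X-x_i\cong Y-y_i$ for all $i$. -}

module Defs where

open import Data.Nat using (ℕ; zero; suc)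
open import Data.Bool using (Bool; true; false)
open import Data.Fin using (Fin; zero; suc; punchIn; inject₁; fromℕ)
open import Data.Product using (Σ; _×_; _,_)
open import Relation.Nullary using (¬_)
open import Relation.Binary.PropositionalEquality using (_≡_)
open import Function.Bundles using (_↔_; Inverse)
open import Function.Definitions using (Injective)

record Graph (n : ℕ) : Set where
  field
    adj    : Fin n → Fin n → Bool
    sym    : ∀ i j → adj i j ≡ adj j i
    irrefl : ∀ i → adj i i ≡ false
open Graph public

Edge : ∀ {n} → Graph n → Fin n → Fin n → Set
Edge G i j = adj G i j ≡ true

_≅_ : ∀ {n} → Graph n → Graph n → Set
_≅_ {n} X Y = Σ (Fin n ↔ Fin n) λ f →
  ∀ i j → adj X i j ≡ adj Y (Inverse.to f i) (Inverse.to f j)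

card : ∀ {m} → Graph (suc m) → Fin (suc m) → Graph m
card X v = record
  { adj    = λ i j → adj X (punchIn v i) (punchIn v j)
  ; sym    = λ i j → sym X (punchIn v i) (punchIn v j)
  ; irrefl = λ i → irrefl X (punchIn v i)
  }

AtLeastCommonCards : ∀ {m} → ℕ → Graph (suc m) → Graph (suc m) → Set
AtLeastCommonCards {m} k X Y =
  Σ (Fin k → Fin (suc m)) λ xs →
  Σ (Fin k → Fin (suc m)) λ ys →
    Injective _≡_ _≡_ xs × Injective _≡_ _≡_ ys ×
    (∀ i → card X (xs i) ≅ card Y (ys i))

data Walk {n} (G : Graph n) : Fin n → Fin n → Set where
  here : ∀ {u} → Walk G u u
  step : ∀ {u w v} → Edge G u w → Walk G w v → Walk G u v

Connected : ∀ {n} → Graph n → Set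
Connected {n} G = ∀ (u v : Fin n) → Walk G u v

Cycle : ∀ {n} → Graph n → ℕ → Set
Cycle {n} G k =
  Σ (Fin (suc (suc (suc k))) → Fin n) λ c →
    Injective _≡_ _≡_ c ×
    (∀ (i : Fin (suc (suc k))) → Edge G (c (inject₁ i)) (c (suc i))) ×
    Edge G (c (fromℕ (suc (suc k)))) (c zero)

Acyclic : ∀ {n} → Graph n → Set
Acyclic G = ∀ k → ¬ Cycle G k

IsTree : ∀ {n} → Graph n → Set
IsTree G = Connected G × Acyclic G

{-# OPTIONS --safe #-}
module Submission where

-- If H were disconnected, let a union of components with b ≤ n/2 vertices be given. A card of H
-- at a vertex y outside it shows that deleting the matched vertex x from G separates b vertices
-- from the rest. As G is connected, these sets, each together with its x, are pairwise disjoint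
-- when 2b < n and pairwise complementary when 2b = n, which leaves room for too few cards.
--
-- If H is connected with a cycle, then all matched vertices lie on it because the cards are
-- acyclic, and comparing degrees shows that H has n edges: it is a cycle of length L with trees
-- hanging at its vertices. Deleting a matched y opens the cycle. The result fits into G − x, so
-- the reaches l and r of the trees on the two sides of y satisfy l + r ≤ e, where L + e is the
-- diameter of G plus 2, and equality holds unless x lies on a longest path of G. Few x do, since
-- deleting one cuts off a large piece of G, which must come from the tree at y. Deleting a vertex
-- of low degree hardly changes the number of leaves and the number of leaves whose neighbour has
-- degree 2, so these numbers nearly agree for G and H. Discharging along the cycle, separately
-- for e = 0, 1, 2 and e ≥ 3, shows that this is impossible.

open import Defs hiding (sym)
open import Data.Nat
open import Data.Nat.Properties
open import Data.Nat.DivMod using (_%_; m%n<n; m<n⇒m%n≡m; %-distribˡ-+; m%n%n≡m%n; [m+n]%n≡m%n; [m+kn]%n≡m%n; n%n≡0; m≡m%n+[m/n]*n)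
open import Data.Bool using (Bool; true; false; T; _∧_; _∨_; not)
import Data.Bool as B
open import Data.Fin using (Fin; zero; suc; toℕ; fromℕ; fromℕ<; inject₁; punchIn; punchOut)
open import Data.Fin.Properties
  using (any?; pigeonhole; punchIn-punchOut; punchIn-injective; punchOut-injective; toℕ-injective; toℕ<n;
         toℕ-fromℕ<; toℕ-fromℕ; toℕ-inject₁)
  renaming (_≟_ to _≟F_; suc-injective to sucF-injective)
open import Data.Fin.Permutation using (_⟨$⟩ʳ_; _⟨$⟩ˡ_; insert; insert-punchIn; inverseˡ; inverseʳ)
open import Data.Fin.Relation.Unary.Top using (view; ‵fromℕ; ‵inject₁)
open import Data.List using (List; []; _∷_)
open import Data.Vec using (Vec; []; _∷_; zipWith; replicate; lookup; map; tabulate)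
open import Data.Vec.N-ary using (N-ary; ∀ⁿ; curryⁿ; _$ⁿ_)
open import Data.Product using (∃; _×_; _,_; proj₁; proj₂)
open import Data.Sum using (_⊎_; inj₁; inj₂)
open import Data.Empty using (⊥; ⊥-elim)
open import Data.Unit using (tt)
open import Function using (_∘_; id)
open import Function.Bundles using (Inverse)
open import Relation.Nullary using (¬_; Dec; yes; no; does; contradiction)
open import Relation.Nullary.Decidable using (_×-dec_; ¬?; dec-true; dec-false)
open import Relation.Binary.Definitions using (Tri; tri<; tri≈; tri>)
open import Relation.Binary.PropositionalEquality hiding ([_])
open import Algebra.Properties.CommutativeMonoid.Sum +-0-commutativeMonoid
  using (sum; sum-remove; ∑-distrib-+; ∑-comm; sum-permute; sum-cong-≗)
open import Algebra.Properties.CommutativeSemigroup +-commutativeSemigroup using (interchange; x∙yz≈y∙xz; xy∙z≈xz∙y)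

-- A linear inequality over ℕ follows from others when, after adding the
-- hypotheses crosswise to the goal, it holds coefficient by coefficient.

-- The cyclic case has one error term: the number `m` of cards whose vertex of G lies on the fixed
-- longest path. Twice the number `k` of cards is at least n + 3, so counting the vertices of G
-- bounds by `m` the sum of e, the number of cycle vertices without a card and the number of
-- vertices of G off the path without a card. At most 2i of the `m` vertices carry trees of at most
-- i vertices, so `m` is at most about `k`/50; here n ≥ 5000 enters through `k` ≥ 2502, whose square
-- root is about 50. Up to such errors all cycle vertices are matched off the path and l + r = e. A
-- matched vertex either carries no tree, and then comes from a leaf of G, or its tree has a leaf.
-- So about half of the `k` vertices or more carry no tree, and the contradiction lies in the trees
-- that provide their reach. For e = 1 and e = 2 such a tree may have a single leaf; the leaves
-- whose neighbour has degree 2 make up for that. The case e = 2 comes closest to the bound on n.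
-- For e ≥ 3 tall trees use too many vertices, so the heights in excess of 1 add up to at most a
-- constant.

data Lin (n : ℕ) : Set where
  var  : Fin n → Lin n
  con  : ℕ → Lin n
  _⊕_  : Lin n → Lin n → Lin n
  _⊛_  : ℕ → Lin n → Lin n

infixl 6 _⊕_
infixr 7 _⊛_
infix 5.5 _⊑_
infix 3 _⊢_

record Ineq (n : ℕ) : Set where
  constructor _⊑_
  field lhs rhs : Lin n
open Ineq

record Sequent (n : ℕ) : Set where
  constructor _⊢_
  field
    hyps : List (Ineq n)
    goal : Ineq n
open Sequent

⟦_⟧ : ∀ {n} → Lin n → Vec ℕ n → ℕ
⟦ var i ⟧ ρ = lookup ρ i
⟦ con k ⟧ ρ = k
⟦ e ⊕ f ⟧ ρ = ⟦ e ⟧ ρ + ⟦ f ⟧ ρ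
⟦ k ⊛ e ⟧ ρ = k * ⟦ e ⟧ ρ

unit : ∀ {n} → Fin n → Vec ℕ n
unit zero    = 1 ∷ replicate _ 0
unit (suc i) = 0 ∷ unit i

coeffs : ∀ {n} → Lin n → Vec ℕ n
coeffs (var i) = unit i
coeffs (con k) = replicate _ 0
coeffs (e ⊕ f) = zipWith _+_ (coeffs e) (coeffs f)
coeffs (k ⊛ e) = map (k *_) (coeffs e)

constant : ∀ {n} → Lin n → ℕ
constant (var i) = 0
constant (con k) = k
constant (e ⊕ f) = constant e + constant f
constant (k ⊛ e) = k * constant e

dot : ∀ {n} → Vec ℕ n → Vec ℕ n → ℕ
dot []       []       = 0
dot (c ∷ cs) (x ∷ xs) = c * x + dot cs xs

dot-0 : ∀ {n} (ρ : Vec ℕ n) → dot (replicate _ 0) ρ ≡ 0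
dot-0 []      = refl
dot-0 (x ∷ ρ) = dot-0 ρ

dot-unit : ∀ {n} (i : Fin n) (ρ : Vec ℕ n) → dot (unit i) ρ ≡ lookup ρ i
dot-unit zero    (x ∷ ρ) rewrite dot-0 ρ | +-identityʳ x | +-identityʳ x = refl
dot-unit (suc i) (x ∷ ρ) = dot-unit i ρ

dot-+ : ∀ {n} (c d ρ : Vec ℕ n) → dot (zipWith _+_ c d) ρ ≡ dot c ρ + dot d ρ
dot-+ []      []      []      = refl
dot-+ (c ∷ cs) (d ∷ ds) (x ∷ ρ)
  rewrite dot-+ cs ds ρ | *-distribʳ-+ x c d = interchange (c * x) (d * x) (dot cs ρ) (dot ds ρ)

dot-* : ∀ {n} k (c ρ : Vec ℕ n) → dot (map (k *_) c) ρ ≡ k * dot c ρ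
dot-* k []       []      = sym (*-zeroʳ k)
dot-* k (c ∷ cs) (x ∷ ρ)
  rewrite dot-* k cs ρ | *-distribˡ-+ k (c * x) (dot cs ρ) | *-assoc k c x = refl

eval : ∀ {n} (e : Lin n) ρ → ⟦ e ⟧ ρ ≡ dot (coeffs e) ρ + constant e
eval (var i) ρ = sym (trans (+-identityʳ _) (dot-unit i ρ))
eval (con k) ρ = sym (cong (_+ k) (dot-0 ρ))
eval (e ⊕ f) ρ rewrite eval e ρ | eval f ρ | dot-+ (coeffs e) (coeffs f) ρ =
  interchange (dot (coeffs e) ρ) (constant e) (dot (coeffs f) ρ) (constant f)
eval (k ⊛ e) ρ rewrite eval e ρ | dot-* k (coeffs e) ρ = *-distribˡ-+ k _ _

_≤ᵛ_ : ∀ {n} → Vec ℕ n → Vec ℕ n → Bool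
[]       ≤ᵛ []       = true
(c ∷ cs) ≤ᵛ (d ∷ ds) = (c ≤ᵇ d) ∧ (cs ≤ᵛ ds)

T-∧ : ∀ {a b} → T (a ∧ b) → T a × T b
T-∧ {true} {true} _ = tt , tt

dot-mono : ∀ {n} (c d ρ : Vec ℕ n) → T (c ≤ᵛ d) → dot c ρ ≤ dot d ρ
dot-mono []       []       []      _ = z≤n
dot-mono (c ∷ cs) (d ∷ ds) (x ∷ ρ) p with T-∧ {c ≤ᵇ d} p
... | q , r = +-mono-≤ (*-monoˡ-≤ x (≤ᵇ⇒≤ c d q)) (dot-mono cs ds ρ r)

_≤ˡ_ : ∀ {n} → Lin n → Lin n → Bool
e ≤ˡ f = (coeffs e ≤ᵛ coeffs f) ∧ (constant e ≤ᵇ constant f)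

≤ˡ-sound : ∀ {n} (e f : Lin n) ρ → T (e ≤ˡ f) → ⟦ e ⟧ ρ ≤ ⟦ f ⟧ ρ
≤ˡ-sound e f ρ p with T-∧ {coeffs e ≤ᵛ coeffs f} p
... | q , r rewrite eval e ρ | eval f ρ =
  +-mono-≤ (dot-mono (coeffs e) (coeffs f) ρ q) (≤ᵇ⇒≤ _ _ r)

total : ∀ {n} → List (Ineq n) → Ineq n → Ineq n
total []       (l ⊑ r) = l ⊑ r
total (h ∷ hs) (l ⊑ r) = total hs (l ⊕ rhs h ⊑ r ⊕ lhs h)

Holds : ∀ {n} → Ineq n → Vec ℕ n → Set
Holds (l ⊑ r) ρ = ⟦ l ⟧ ρ ≤ ⟦ r ⟧ ρ

Follows : ∀ {n} → List (Ineq n) → Ineq n → Vec ℕ n → Set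
Follows []       g ρ = Holds g ρ
Follows (h ∷ hs) g ρ = Holds h ρ → Follows hs g ρ

Check : ∀ {n} → Sequent n → Set
Check (hs ⊢ g) = let t = total hs g in T (lhs t ≤ˡ rhs t)

follows : ∀ {n} (hs : List (Ineq n)) (g g′ : Ineq n) ρ →
          (Holds g′ ρ → Holds g ρ) → Check (hs ⊢ g′) → Follows hs g ρ
follows []       g g′ ρ k p = k (≤ˡ-sound (lhs g′) (rhs g′) ρ p)
follows (h ∷ hs) g g′ ρ k p x = follows hs g _ ρ
  (λ q → k (+-cancelʳ-≤ _ _ _ (≤-trans (+-monoʳ-≤ (⟦ lhs g′ ⟧ ρ) x) q))) p

all-envs : ∀ n (P : Vec ℕ n → Set) → ((ρ : Vec ℕ n) → P ρ) → ∀ⁿ n (curryⁿ P)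
all-envs zero    P p = p []
all-envs (suc n) P p = λ x → all-envs n (λ ρ → P (x ∷ ρ)) (λ ρ → p (x ∷ ρ))

vars : ∀ {n} → Vec (Lin n) n
vars = tabulate var

-- For a true inequality `Check` evaluates to the unit type, so the implicit argument is inferred.
-- Every hypothesis is used exactly once; multipliers are supplied by the callers, who scale or
-- repeat hypotheses.
lin : ∀ n (f : N-ary n (Lin n) (Sequent n)) → {_ : Check (f $ⁿ vars)} →
      ∀ⁿ n (curryⁿ (λ ρ → Follows (hyps (f $ⁿ vars)) (goal (f $ⁿ vars)) ρ))
lin n f {p} = all-envs n _ (λ ρ → follows (hyps s) (goal s) (goal s) ρ id p)
  where s = f $ⁿ vars

-- Finite sums

𝟙 : Bool → ℕ
𝟙 true  = 1
𝟙 false = 0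

⟪_⟫ : ∀ {p} {P : Set p} → Dec P → ℕ
⟪ d ⟫ = 𝟙 (does d)

⟪⟫-yes : ∀ {p} {P : Set p} (d : Dec P) → P → ⟪ d ⟫ ≡ 1
⟪⟫-yes d p rewrite dec-true d p = refl

⟪⟫-no : ∀ {p} {P : Set p} (d : Dec P) → ¬ P → ⟪ d ⟫ ≡ 0
⟪⟫-no d ¬p rewrite dec-false d ¬p = refl

⟪⟫-elim : ∀ {p} {P : Set p} (d : Dec P) → 1 ≤ ⟪ d ⟫ → P
⟪⟫-elim (yes p) _ = p

⟪⟫-case : ∀ {p} {P : Set p} (d : Dec P) (Q : ℕ → Set) → (P → Q 1) → (¬ P → Q 0) → Q ⟪ d ⟫
⟪⟫-case (yes p) Q y n = y p
⟪⟫-case (no ¬p) Q y n = n ¬p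

𝟙≤1 : ∀ b → 𝟙 b ≤ 1
𝟙≤1 true  = ≤-refl
𝟙≤1 false = z≤n

∑-cong : ∀ {n} {f g : Fin n → ℕ} → (∀ i → f i ≡ g i) → sum f ≡ sum g
∑-cong = sum-cong-≗

∑-mono : ∀ {n} {f g : Fin n → ℕ} → (∀ i → f i ≤ g i) → sum f ≤ sum g
∑-mono {zero}  le = z≤n
∑-mono {suc n} le = +-mono-≤ (le zero) (∑-mono (le ∘ suc))

∑-const : ∀ n c → sum {n} (λ _ → c) ≡ n * c
∑-const zero    c = refl
∑-const (suc n) c = cong (c +_) (∑-const n c)

∑-1 : ∀ n → sum {n} (λ _ → 1) ≡ n
∑-1 n = trans (∑-const n 1) (*-identityʳ n)

∑-* : ∀ {n} c (f : Fin n → ℕ) → sum (λ i → c * f i) ≡ c * sum f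
∑-* {zero}  c f = sym (*-zeroʳ c)
∑-* {suc n} c f rewrite ∑-* c (f ∘ suc) = sym (*-distribˡ-+ c (f zero) _)

∑-*ʳ : ∀ {n} c (f : Fin n → ℕ) → sum (λ i → f i * c) ≡ sum f * c
∑-*ʳ c f = trans (∑-cong (λ i → *-comm (f i) c)) (trans (∑-* c f) (*-comm c (sum f)))

term≤∑ : ∀ {n} (f : Fin n → ℕ) i → f i ≤ sum f
term≤∑ f zero    = m≤m+n _ _
term≤∑ f (suc i) = ≤-trans (term≤∑ (f ∘ suc) i) (m≤n+m _ _)

∑-pos : ∀ {n} (f : Fin n → ℕ) → 1 ≤ sum f → ∃ λ i → 1 ≤ f i
∑-pos {suc n} f p with f zero in eq
... | suc _ = zero , subst (1 ≤_) (sym eq) (s≤s z≤n)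
... | zero  with ∑-pos (f ∘ suc) p
...   | i , q = suc i , q

-- Equal totals leave no slack in any summand. This is what turns a count of edges into a
-- description of all edges.
∑-tight : ∀ {n} {f g : Fin n → ℕ} → (∀ i → f i ≤ g i) → sum g ≤ sum f → ∀ i → f i ≡ g i
∑-tight {suc n} {f} {g} le ge i = ≤-antisym (le i) (case i)
  where
  rest : sum (f ∘ suc) ≤ sum (g ∘ suc)
  rest = ∑-mono (le ∘ suc)
  case : ∀ i → g i ≤ f i
  case zero    = lin 4 (λ f₀ g₀ F G → (F ⊑ G) ∷ (g₀ ⊕ G ⊑ f₀ ⊕ F) ∷ [] ⊢ g₀ ⊑ f₀)
                   (f zero) (g zero) (sum (f ∘ suc)) (sum (g ∘ suc)) rest ge
  case (suc j) = ≤-reflexive (sym (∑-tight (le ∘ suc)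
                   (lin 4 (λ f₀ g₀ F G → (f₀ ⊑ g₀) ∷ (g₀ ⊕ G ⊑ f₀ ⊕ F) ∷ [] ⊢ G ⊑ F)
                     (f zero) (g zero) (sum (f ∘ suc)) (sum (g ∘ suc)) (le zero) ge) j))

∑-zero : ∀ {n} {f : Fin n → ℕ} → (∀ i → f i ≡ 0) → sum f ≡ 0
∑-zero {n} z = trans (∑-cong z) (trans (∑-const n 0) (*-zeroʳ n))

δ : ∀ {n} → Fin n → Fin n → ℕ
δ i j = ⟪ i ≟F j ⟫

δ-refl : ∀ {n} (i : Fin n) → δ i i ≡ 1
δ-refl i = ⟪⟫-yes (i ≟F i) refl

δ-≢ : ∀ {n} {i j : Fin n} → i ≢ j → δ i j ≡ 0
δ-≢ {i = i} {j} p = ⟪⟫-no (i ≟F j) p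

δ-elim : ∀ {n} {i j : Fin n} → 1 ≤ δ i j → i ≡ j
δ-elim {i = i} {j} p = ⟪⟫-elim (i ≟F j) p

δ-suc : ∀ {n} (i j : Fin n) → δ (suc i) (suc j) ≡ δ i j
δ-suc i j with i ≟F j
... | yes refl = refl
... | no _     = refl

∑-δ : ∀ {n} (i : Fin n) (f : Fin n → ℕ) → sum (λ j → δ i j * f j) ≡ f i
∑-δ zero f = begin-equality
  f zero + 0 + sum (λ j → δ zero (suc j) * f (suc j)) ≡⟨ cong (f zero + 0 +_) (∑-zero {f = λ j → δ zero (suc j) * f (suc j)} (λ j → refl)) ⟩
  f zero + 0 + 0                                      ≡⟨ cong (_+ 0) (+-identityʳ _) ⟩
  f zero + 0                                          ≡⟨ +-identityʳ _ ⟩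
  f zero                                              ∎
  where open ≤-Reasoning
∑-δ (suc i) f = trans (∑-cong (λ j → cong (_* f (suc j)) (δ-suc i j))) (∑-δ i (f ∘ suc))

∑-δ₁ : ∀ {n} (i : Fin n) → sum (δ i) ≡ 1
∑-δ₁ i = trans (∑-cong (λ j → sym (*-identityʳ (δ i j)))) (∑-δ i (λ _ → 1))

∑-≤1 : ∀ {n} {f : Fin n → ℕ} → (∀ i → f i ≤ 1) → (∀ i j → 1 ≤ f i → 1 ≤ f j → i ≡ j) → sum f ≤ 1
∑-≤1 {zero} le uq = z≤n
∑-≤1 {suc n} {f} le uq with f zero in eq
... | zero = ∑-≤1 (le ∘ suc) (λ i j p q → sucF-injective (uq (suc i) (suc j) p q))
... | suc k = ≤-trans (≤-reflexive (cong (suc k +_) rest)) (≤-trans (≤-reflexive (+-identityʳ _))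
                (≤-trans (≤-reflexive (sym eq)) (le zero)))
  where
  off : ∀ j → f (suc j) ≡ 0
  off j with f (suc j) in eq′
  ... | zero  = refl
  ... | suc _ = contradiction (uq zero (suc j) (subst (1 ≤_) (sym eq) (s≤s z≤n)) (subst (1 ≤_) (sym eq′) (s≤s z≤n))) (λ ())
  rest : sum (f ∘ suc) ≡ 0
  rest = ∑-zero off

-- Double counting of the pairs `(i , φ i)`, with injectivity demanded only on the support of `f`.
∑-inj : ∀ {m n} (φ : Fin m → Fin n) (f : Fin m → ℕ) (g : Fin n → ℕ) →
        (∀ i → f i ≤ 1) → (∀ i j → 1 ≤ f i → 1 ≤ f j → φ i ≡ φ j → i ≡ j) →
        (∀ i → 1 ≤ f i → 1 ≤ g (φ i)) → sum f ≤ sum g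
∑-inj φ f g f≤1 inj hit = begin
  sum f                                     ≡⟨ ∑-cong (λ i → sym (trans (∑-*ʳ (f i) (δ (φ i))) (trans (cong (_* f i) (∑-δ₁ (φ i))) (*-identityˡ (f i))))) ⟩
  sum (λ i → sum (λ j → δ (φ i) j * f i))   ≡⟨ ∑-comm (λ i j → δ (φ i) j * f i) ⟩
  sum (λ j → sum (λ i → δ (φ i) j * f i))   ≤⟨ ∑-mono bound ⟩
  sum g                                     ∎
  where
  open ≤-Reasoning
  hits : ∀ {i j} → 1 ≤ δ (φ i) j * f i → φ i ≡ j × 1 ≤ f i
  hits {i} {j} p with φ i ≟F j
  ... | yes e = e , ≤-trans p (≤-reflexive (+-identityʳ _))
  hits {i} {j} () | no _
  term≤1 : ∀ i j → δ (φ i) j * f i ≤ 1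
  term≤1 i j = *-mono-≤ (𝟙≤1 (does (φ i ≟F j))) (f≤1 i)
  bound : ∀ j → sum (λ i → δ (φ i) j * f i) ≤ g j
  bound j with sum (λ i → δ (φ i) j * f i) in eq
  ... | zero  = z≤n
  ... | suc s with ∑-pos (λ i → δ (φ i) j * f i) (subst (1 ≤_) (sym eq) (s≤s z≤n))
  ...   | i , p with hits {i} {j} p
  ...     | e , q = ≤-trans (subst (_≤ 1) eq (∑-≤1 (λ i → term≤1 i j) uq)) (subst (λ j → 1 ≤ g j) e (hit i q))
    where
    uq : ∀ i i′ → 1 ≤ δ (φ i) j * f i → 1 ≤ δ (φ i′) j * f i′ → i ≡ i′
    uq i i′ p p′ with hits {i} {j} p | hits {i′} {j} p′
    ... | e , q | e′ , q′ = inj i i′ q q′ (trans e (sym e′))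

∑-+ : ∀ {n} (f g : Fin n → ℕ) → sum (λ i → f i + g i) ≡ sum f + sum g
∑-+ = ∑-distrib-+

Σ< : ℕ → (ℕ → ℕ) → ℕ
Σ< zero    f = 0
Σ< (suc n) f = f n + Σ< n f

Σ<-mono : ∀ n {f g : ℕ → ℕ} → (∀ i → f i ≤ g i) → Σ< n f ≤ Σ< n g
Σ<-mono zero    le = z≤n
Σ<-mono (suc n) le = +-mono-≤ (le n) (Σ<-mono n le)

Σ<-cong : ∀ n {f g : ℕ → ℕ} → (∀ i → f i ≡ g i) → Σ< n f ≡ Σ< n g
Σ<-cong zero    e = refl
Σ<-cong (suc n) e = cong₂ _+_ (e n) (Σ<-cong n e)

Σ<-+ : ∀ n (f g : ℕ → ℕ) → Σ< n (λ i → f i + g i) ≡ Σ< n f + Σ< n g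
Σ<-+ zero    f g = refl
Σ<-+ (suc n) f g rewrite Σ<-+ n f g = interchange (f n) (g n) _ _

Σ<-* : ∀ n c (f : ℕ → ℕ) → Σ< n (λ i → c * f i) ≡ c * Σ< n f
Σ<-* zero    c f = sym (*-zeroʳ c)
Σ<-* (suc n) c f rewrite Σ<-* n c f = sym (*-distribˡ-+ c (f n) _)

Σ<-const : ∀ n c → Σ< n (λ _ → c) ≡ n * c
Σ<-const zero    c = refl
Σ<-const (suc n) c = cong (c +_) (Σ<-const n c)

Σ<-front : ∀ n (f : ℕ → ℕ) → Σ< (suc n) f ≡ f 0 + Σ< n (f ∘ suc)
Σ<-front zero    f = refl
Σ<-front (suc n) f = begin-equality
  f (suc n) + Σ< (suc n) f              ≡⟨ cong (f (suc n) +_) (Σ<-front n f) ⟩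
  f (suc n) + (f 0 + Σ< n (f ∘ suc))    ≡⟨ x∙yz≈y∙xz (f (suc n)) (f 0) _ ⟩
  f 0 + (f (suc n) + Σ< n (f ∘ suc))    ∎
  where
  open ≤-Reasoning

Σ<-shift : ∀ n (f : ℕ → ℕ) → f n ≡ f 0 → Σ< n (f ∘ suc) ≡ Σ< n f
Σ<-shift n f per = +-cancelˡ-≡ (f 0) _ _ (trans (sym (Σ<-front n f)) (cong (_+ Σ< n f) per))

Σ<-Fin : ∀ n (f : ℕ → ℕ) → Σ< n f ≡ sum {n} (f ∘ toℕ)
Σ<-Fin zero    f = refl
Σ<-Fin (suc n) f = trans (Σ<-front n f) (cong (f 0 +_) (Σ<-Fin n (f ∘ suc)))

Σ<-≤term : ∀ n (f : ℕ → ℕ) i → i < n → f i ≤ Σ< n f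
Σ<-≤term (suc n) f i (s≤s p) with i ≟ n
... | yes refl = m≤m+n _ _
... | no  i≢n  = ≤-trans (Σ<-≤term n f i (≤∧≢⇒< p i≢n)) (m≤n+m _ _)

Σ<-tight : ∀ n {f g : ℕ → ℕ} → (∀ i → f i ≤ g i) → Σ< n g ≤ Σ< n f → ∀ i → i < n → f i ≡ g i
Σ<-tight (suc n) {f} {g} le ge i (s≤s p) with i ≟ n
... | yes refl = ≤-antisym (le n) (lin 4 (λ f₀ g₀ F G → (F ⊑ G) ∷ (g₀ ⊕ G ⊑ f₀ ⊕ F) ∷ [] ⊢ g₀ ⊑ f₀)
                   (f n) (g n) (Σ< n f) (Σ< n g) (Σ<-mono n le) ge)
... | no i≢n = Σ<-tight n le (lin 4 (λ f₀ g₀ F G → (f₀ ⊑ g₀) ∷ (g₀ ⊕ G ⊑ f₀ ⊕ F) ∷ [] ⊢ G ⊑ F)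
                   (f n) (g n) (Σ< n f) (Σ< n g) (le n) ge) i (≤∧≢⇒< p i≢n)

is0 is1 is2 pos : ℕ → ℕ
is0 0 = 1
is0 _ = 0
is1 1 = 1
is1 _ = 0
is2 2 = 1
is2 _ = 0
pos 0 = 0
pos _ = 1

-- size, leaves, leaves whose neighbour has degree 2, height, non-leaves off the cycle
data Shape : (t q z h o : ℕ) → Set where
  bare : Shape 1 0 0 0 0
  star : ∀ q → Shape (2 + q) (suc q) 0 1 0
  tall : ∀ q z h o → suc h ≤ o → z ≤ suc q → 1 ≤ q + z → Shape (2 + q + o) (suc q) z (2 + h) o

is2≤1 : ∀ n → is2 n ≤ 1
is2≤1 0 = z≤n
is2≤1 1 = z≤n
is2≤1 2 = ≤-refl
is2≤1 (suc (suc (suc n))) = z≤n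

-- Degrees and matched vertices

A : ∀ {n} → Graph n → Fin n → Fin n → ℕ
A X u w = 𝟙 (adj X u w)

deg : ∀ {n} → Graph n → Fin n → ℕ
deg X u = sum (A X u)

degrees : ∀ {n} → Graph n → ℕ
degrees X = sum (deg X)

module _ {n} (X : Graph n) where

  edge? : ∀ u w → Dec (Edge X u w)
  edge? u w with adj X u w
  ... | true  = yes refl
  ... | false = no λ ()

  edge-sym : ∀ {u w} → Edge X u w → Edge X w u
  edge-sym {u} {w} e = trans (Graph.sym X w u) e

  edge-irrefl : ∀ {u w} → Edge X u w → u ≢ w
  edge-irrefl {u} e refl with trans (sym e) (irrefl X u)
  ... | ()

  A-sym : ∀ u w → A X u w ≡ A X w u
  A-sym u w = cong 𝟙 (Graph.sym X u w)

  A-edge : ∀ {u w} → Edge X u w → A X u w ≡ 1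
  A-edge e = cong 𝟙 e

  edge-A : ∀ {u w} → 1 ≤ A X u w → Edge X u w
  edge-A {u} {w} p with adj X u w
  edge-A {u} {w} () | false
  ... | true = refl

degrees-card : ∀ {m} (X : Graph (suc m)) v → degrees X ≡ degrees (card X v) + 2 * deg X v
degrees-card X v = begin-equality
  sum (deg X)                                                         ≡⟨ sum-remove (deg X) ⟩
  deg X v + sum (λ i → deg X (punchIn v i))                           ≡⟨ cong (deg X v +_) (∑-cong (λ i → sum-remove {i = v} (A X (punchIn v i)))) ⟩
  deg X v + sum (λ i → A X (punchIn v i) v + deg (card X v) i)        ≡⟨ cong (deg X v +_) (∑-+ (λ i → A X (punchIn v i) v) (deg (card X v))) ⟩
  deg X v + (sum (λ i → A X (punchIn v i) v) + degrees (card X v))    ≡⟨ cong (λ s → deg X v + (s + degrees (card X v))) others ⟩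
  deg X v + (deg X v + degrees (card X v))                            ≡⟨ twice (deg X v) (degrees (card X v)) ⟩
  degrees (card X v) + 2 * deg X v                                    ∎
  where
  open ≤-Reasoning
  others : sum (λ i → A X (punchIn v i) v) ≡ deg X v
  others = begin-equality
    sum (λ i → A X (punchIn v i) v)             ≡⟨ ∑-cong (λ i → A-sym X (punchIn v i) v) ⟩
    sum (λ i → A X v (punchIn v i))             ≡⟨ cong (_+ sum (λ i → A X v (punchIn v i))) (sym (cong 𝟙 (irrefl X v))) ⟩
    A X v v + sum (λ i → A X v (punchIn v i))   ≡⟨ sym (sum-remove (A X v)) ⟩
    deg X v                                     ∎
  twice : ∀ d e → d + (d + e) ≡ e + 2 * d
  twice d e = ≤-antisym (lin 2 (λ d e → [] ⊢ d ⊕ (d ⊕ e) ⊑ e ⊕ 2 ⊛ d) d e) (lin 2 (λ d e → [] ⊢ e ⊕ 2 ⊛ d ⊑ d ⊕ (d ⊕ e)) d e)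

degrees-iso : ∀ {n} {X Y : Graph n} → X ≅ Y → degrees X ≡ degrees Y
degrees-iso {X = X} {Y} (π , iso) = begin-equality
  sum (deg X)                                            ≡⟨ ∑-cong (λ i → ∑-cong (λ j → cong 𝟙 (iso i j))) ⟩
  sum (λ i → sum (λ j → A Y (π ⟨$⟩ʳ i) (π ⟨$⟩ʳ j)))      ≡⟨ ∑-cong (λ i → sym (sum-permute (A Y (π ⟨$⟩ʳ i)) π)) ⟩
  sum (λ i → deg Y (π ⟨$⟩ʳ i))                           ≡⟨ sym (sum-permute (deg Y) π) ⟩
  sum (deg Y)                                            ∎
  where open ≤-Reasoning

-- An isomorphism of the cards X − x and Y − y, extended by x ↦ y.
record Match {n} (X Y : Graph n) (x y : Fin n) : Set where
  field
    to from : Fin n → Fin n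
    from-to : ∀ u → from (to u) ≡ u
    to-from : ∀ u → to (from u) ≡ u
    to-x : to x ≡ y
    adj-to : ∀ u w → u ≢ x → w ≢ x → adj X u w ≡ adj Y (to u) (to w)

  to-injective : ∀ {u w} → to u ≡ to w → u ≡ w
  to-injective {u} {w} p = trans (sym (from-to u)) (trans (cong from p) (from-to w))

  to-≢ : ∀ {u} → u ≢ x → to u ≢ y
  to-≢ u≢x p = u≢x (to-injective (trans p (sym to-x)))

  from-y : from y ≡ x
  from-y = trans (cong from (sym to-x)) (from-to x)

  from-≢ : ∀ {u} → u ≢ y → from u ≢ x
  from-≢ {u} u≢y p = u≢y (trans (sym (to-from u)) (trans (cong to p) to-x))

  edge-to : ∀ {u w} → u ≢ x → w ≢ x → Edge X u w → Edge Y (to u) (to w)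
  edge-to u≢ w≢ e = trans (sym (adj-to _ _ u≢ w≢)) e

  edge-from : ∀ {u w} → u ≢ y → w ≢ y → Edge Y u w → Edge X (from u) (from w)
  edge-from {u} {w} u≢ w≢ e = trans (adj-to _ _ (from-≢ u≢) (from-≢ w≢)) (trans (cong₂ (adj Y) (to-from u) (to-from w)) e)

  ∑-to : ∀ (f : Fin n → ℕ) → sum (f ∘ to) ≡ sum f
  ∑-to f = ≤-antisym (half to from from-to to-from f)
             (≤-trans (≤-reflexive (∑-cong (λ u → cong f (sym (to-from u))))) (half from to to-from from-to (f ∘ to)))
    where
    half : ∀ (g g′ : Fin n → Fin n) → (∀ u → g′ (g u) ≡ u) → (∀ u → g (g′ u) ≡ u) → ∀ f → sum (f ∘ g) ≤ sum f
    half g g′ p p′ f = begin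
      sum (f ∘ g)                                 ≡⟨ ∑-cong (λ u → sym (∑-δ (g u) f)) ⟩
      sum (λ u → sum (λ w → δ (g u) w * f w))     ≡⟨ ∑-comm (λ u w → δ (g u) w * f w) ⟩
      sum (λ w → sum (λ u → δ (g u) w * f w))     ≡⟨ ∑-cong (λ w → ∑-*ʳ (f w) (λ u → δ (g u) w)) ⟩
      sum (λ w → sum (λ u → δ (g u) w) * f w)     ≤⟨ ∑-mono (λ w → *-monoˡ-≤ (f w) (∑-≤1 (λ u → 𝟙≤1 _)
                                                      (λ i j a b → trans (sym (p i)) (trans (cong g′ (trans (δ-elim {i = g i} a) (sym (δ-elim {i = g j} b)))) (p j))))) ⟩
      sum (λ w → 1 * f w)                         ≡⟨ ∑-cong (λ w → *-identityˡ (f w)) ⟩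
      sum f                                       ∎
      where open ≤-Reasoning

match-sym : ∀ {n} {X Y : Graph n} {x y} → Match X Y x y → Match Y X y x
match-sym {X = X} {Y} M = record
  { to = from ; from = to ; from-to = to-from ; to-from = from-to ; to-x = from-y
  ; adj-to = λ u w u≢ w≢ → trans (cong₂ (adj Y) (sym (to-from u)) (sym (to-from w))) (sym (adj-to _ _ (from-≢ u≢) (from-≢ w≢))) }
  where open Match M

card-match : ∀ {m} {X Y : Graph (suc m)} {x y} → card X x ≅ card Y y → Match X Y x y
card-match {X = X} {Y} {x} {y} (π , iso) = record
  { to = ρ ⟨$⟩ʳ_ ; from = ρ ⟨$⟩ˡ_ ; from-to = λ u → inverseˡ ρ ; to-from = λ u → inverseʳ ρ
  ; to-x = fixed ; adj-to = pres }
  where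
  ρ = insert x y π
  fixed : ρ ⟨$⟩ʳ x ≡ y
  fixed with x ≟F x
  ... | yes _ = refl
  ... | no ¬p = contradiction refl ¬p
  pres : ∀ u w → u ≢ x → w ≢ x → adj X u w ≡ adj Y (ρ ⟨$⟩ʳ u) (ρ ⟨$⟩ʳ w)
  pres u w u≢ w≢ = begin
    adj X u w                                               ≡⟨ cong₂ (adj X) (sym pu) (sym pw) ⟩
    adj X (punchIn x u′) (punchIn x w′)                     ≡⟨ iso u′ w′ ⟩
    adj Y (punchIn y (π ⟨$⟩ʳ u′)) (punchIn y (π ⟨$⟩ʳ w′))   ≡⟨ cong₂ (adj Y) (sym (insert-punchIn x y π u′)) (sym (insert-punchIn x y π w′)) ⟩
    adj Y (ρ ⟨$⟩ʳ punchIn x u′) (ρ ⟨$⟩ʳ punchIn x w′)       ≡⟨ cong₂ (λ a b → adj Y (ρ ⟨$⟩ʳ a) (ρ ⟨$⟩ʳ b)) pu pw ⟩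
    adj Y (ρ ⟨$⟩ʳ u) (ρ ⟨$⟩ʳ w)                             ∎
    where
    open ≡-Reasoning
    u′ = punchOut (u≢ ∘ sym)
    w′ = punchOut (w≢ ∘ sym)
    pu = punchIn-punchOut (u≢ ∘ sym)
    pw = punchIn-punchOut (w≢ ∘ sym)

least : (P : ℕ → Set) → (∀ d → Dec (P d)) → ∀ N → P N → ∃ λ d → P d × (∀ d′ → d′ < d → ¬ P d′)
least P P? zero    p = zero , p , λ _ ()
least P P? (suc N) p with P? 0
... | yes q = zero , q , λ _ ()
... | no ¬q with least (P ∘ suc) (P? ∘ suc) N p
...   | d , q , min = suc d , q , λ { zero _ → ¬q ; (suc d′) (s≤s lt) → min d′ lt }

other-neighbour : ∀ {n} (X : Graph n) → (∀ u → 2 ≤ deg X u) → ∀ p c → ∃ λ w → Edge X c w × w ≢ p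
other-neighbour X 2≤deg p c with any? (λ w → edge? X c w ×-dec ¬? (w ≟F p))
... | yes found = found
... | no none = contradiction (≤-trans (2≤deg c) (≤-trans (∑-mono only) (≤-reflexive (∑-δ₁ p)))) 1+n≰n
  where
  only : ∀ w → A X c w ≤ δ p w
  only w with adj X c w in e
  ... | false = z≤n
  ... | true with w ≟F p
  ...   | yes refl = ≤-reflexive (sym (δ-refl w))
  ...   | no w≢p = contradiction (w , e , w≢p) none

-- A walk that never turns back closes up at its first repetition.
cycle-from : ∀ {n} (X : Graph n) → Fin n → (∀ u → 2 ≤ deg X u) → ∃ λ k → Cycle X k
cycle-from {n} X v₀ 2≤deg = build rep
  where
  run : ℕ → Fin n × Fin n
  run zero    = v₀ , v₀
  run (suc i) = proj₂ (run i) , proj₁ (other-neighbour X 2≤deg (proj₁ (run i)) (proj₂ (run i)))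
  s : ℕ → Fin n
  s i = proj₂ (run i)
  s-edge : ∀ i → Edge X (s i) (s (suc i))
  s-edge i = proj₁ (proj₂ (other-neighbour X 2≤deg (proj₁ (run i)) (proj₂ (run i))))
  s-turn : ∀ i → s (suc (suc i)) ≢ s i
  s-turn i = proj₂ (proj₂ (other-neighbour X 2≤deg (proj₁ (run (suc i))) (proj₂ (run (suc i)))))
  Rep : ℕ → Set
  Rep j = ∃ λ (i : Fin j) → s (toℕ i) ≡ s j
  someRep : ∃ Rep
  someRep with pigeonhole (n<1+n n) (s ∘ toℕ)
  ... | i , j , i<j , eq = toℕ j , fromℕ< i<j , trans (cong s (toℕ-fromℕ< i<j)) eq
  rep : ∃ λ j → Rep j × (∀ j′ → j′ < j → ¬ Rep j′)
  rep = least Rep (λ j → any? (λ i → s (toℕ i) ≟F s j)) (proj₁ someRep) (proj₂ someRep)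
  build : (∃ λ j → Rep j × (∀ j′ → j′ < j → ¬ Rep j′)) → ∃ λ k → Cycle X k
  build (j , (i , eq) , min) = close (j ∸ toℕ i) (m∸n+n≡m (<⇒≤ (toℕ<n i)))
    where
    i₀ = toℕ i
    distinct : ∀ a b → a < b → b < j → s a ≢ s b
    distinct a b a<b b<j p = min b b<j (fromℕ< a<b , trans (cong s (toℕ-fromℕ< a<b)) p)
    close : ∀ d → d + i₀ ≡ j → ∃ λ k → Cycle X k
    -- Closing up after one step would be a loop, after two steps a turn back.
    close 0 p = contradiction p (<⇒≢ (toℕ<n i))
    close 1 p = contradiction (trans eq (cong s (sym p))) (edge-irrefl X (s-edge i₀))
    close 2 p = contradiction (trans (cong s p) (sym eq)) (s-turn i₀)
    close (suc (suc (suc k))) p = k , c , inj , edges , last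
      where
      c : Fin (suc (suc (suc k))) → Fin n
      c t = s (toℕ t + i₀)
      below : ∀ (t : Fin (suc (suc (suc k)))) → toℕ t + i₀ < j
      below t = ≤-trans (+-monoˡ-< i₀ (toℕ<n t)) (≤-reflexive p)
      inj : ∀ {t t′} → c t ≡ c t′ → t ≡ t′
      inj {t} {t′} q with <-cmp (toℕ t + i₀) (toℕ t′ + i₀)
      ... | tri< lt _ _ = contradiction q (distinct _ _ lt (below t′))
      ... | tri≈ _ e _ = toℕ-injective (+-cancelʳ-≡ i₀ _ _ e)
      ... | tri> _ _ gt = contradiction (sym q) (distinct _ _ gt (below t))
      edges : ∀ t → Edge X (c (inject₁ t)) (c (suc t))
      edges t = subst (λ a → Edge X (s (a + i₀)) (c (suc t))) (sym (toℕ-inject₁ t)) (s-edge (toℕ t + i₀))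
      last : Edge X (c (fromℕ (suc (suc k)))) (c zero)
      last = subst₂ (Edge X) (cong (λ x → s (x + i₀)) (sym (toℕ-fromℕ (2 + k))))
        (trans (cong s p) (sym eq)) (s-edge (2 + k + i₀))

cycle-card : ∀ {m} (X : Graph (suc m)) v {k} → Cycle (card X v) k → Cycle X k
cycle-card X v (c , inj , edges , last) = punchIn v ∘ c , inj ∘ punchIn-injective v _ _ , edges , last

-- By `cycle-from` some vertex has degree at most 1; deleting it removes at most one edge.
acyclic-degrees : ∀ {m} (X : Graph (suc m)) → Acyclic X → degrees X ≤ 2 * m
acyclic-degrees {zero} X ac = ≤-reflexive (∑-zero {f = deg X} λ { zero → ∑-zero {f = A X zero} λ { zero → cong 𝟙 (irrefl X zero) } })
acyclic-degrees {suc m} X ac with any? (λ v → deg X v ≤? 1)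
... | no none = contradiction (proj₂ found) (ac (proj₁ found))
  where
  found = cycle-from X zero (λ u → ≰⇒> (λ le → none (u , le)))
... | yes (v , d≤1) = begin
  degrees X                         ≡⟨ degrees-card X v ⟩
  degrees (card X v) + 2 * deg X v  ≤⟨ +-mono-≤ (acyclic-degrees (card X v) (λ k c → ac k (cycle-card X v c))) (*-monoʳ-≤ 2 d≤1) ⟩
  2 * m + 2                         ≡⟨ trans (+-comm (2 * m) 2) (sym (*-suc 2 m)) ⟩
  2 * suc m                         ∎
  where open ≤-Reasoning

cycle-hits : ∀ {m} (X : Graph (suc m)) v → Acyclic (card X v) → ∀ {k} (C : Cycle X k) → ∃ λ t → proj₁ C t ≡ v
cycle-hits X v ac {k} (c , inj , edges , last) with any? (λ t → c t ≟F v)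
... | yes hit = hit
... | no miss = contradiction (c′ , (λ {t} {t′} → inj′ {t} {t′}) , (λ t → down (edges t)) , down last) (ac k)
  where
  ne : ∀ t → v ≢ c t
  ne t p = miss (t , sym p)
  c′ = λ t → punchOut (ne t)
  inj′ : ∀ {t t′} → c′ t ≡ c′ t′ → t ≡ t′
  inj′ {t} {t′} p = inj (punchOut-injective (ne t) (ne t′) p)
  down : ∀ {t t′} → Edge X (c t) (c t′) → Edge (card X v) (c′ t) (c′ t′)
  down {t} {t′} e = trans (cong₂ (adj X) (punchIn-punchOut (ne t)) (punchIn-punchOut (ne t′))) e

acyclic-iso : ∀ {n} {X Y : Graph n} → X ≅ Y → Acyclic X → Acyclic Y
acyclic-iso {X = X} {Y} (π , iso) ac k (c , inj , edges , last) = ac k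
  ( from ∘ c , (λ {t} {t′} p → inj (trans (sym (right (c t))) (trans (cong to p) (right (c t′))))) , (λ t → back (edges t)) , back last )
  where
  to = Inverse.to π
  from = Inverse.from π
  right : ∀ u → to (from u) ≡ u
  right u = Inverse.inverseˡ π refl
  back : ∀ {u w} → Edge Y u w → Edge X (from u) (from w)
  back {u} {w} e = trans (iso _ _) (trans (cong₂ (adj Y) (right u) (right w)) e)

-- Distance layers

-- The set `S` of roots will be a single vertex of a tree or the cycle of a unicyclic graph.
record Layering {n} (X : Graph n) (S : Fin n → Bool) : Set where
  field
    dep : Fin n → ℕ
    par : Fin n → Fin n
    root-dep : ∀ u → S u ≡ true → dep u ≡ 0
    dep-root : ∀ u → dep u ≡ 0 → S u ≡ true
    par-edge : ∀ u → 1 ≤ dep u → Edge X u (par u)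
    par-dep : ∀ u → 1 ≤ dep u → suc (dep (par u)) ≡ dep u
    dep-edge : ∀ {u w} → Edge X u w → dep u ≤ suc (dep w)

module _ {n} (X : Graph n) (S : Fin n → Bool) where

  Within : ℕ → Fin n → Set
  Within zero    u = S u ≡ true
  Within (suc d) u = ∃ λ w → Edge X u w × Within d w

  within? : ∀ d u → Dec (Within d u)
  within? zero    u = S u B.≟ true
  within? (suc d) u = any? (λ w → edge? X u w ×-dec within? d w)

  walk-within : ∀ {u w} → S w ≡ true → Walk X u w → ∃ λ d → Within d u
  walk-within s here = 0 , s
  walk-within s (step e p) = suc (proj₁ (walk-within s p)) , _ , e , proj₂ (walk-within s p)

  abstract
    layering : Connected X → (∃ λ s → S s ≡ true) → Layering X S
    layering conn (s , Ss) = record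
      { dep = dep ; par = par ; root-dep = root-dep ; dep-root = dep-root ; par-edge = par-edge
      ; par-dep = par-dep ; dep-edge = dep-edge }
      where
      nearest : ∀ u → ∃ λ d → Within d u × (∀ d′ → d′ < d → ¬ Within d′ u)
      nearest u = least (λ d → Within d u) (λ d → within? d u) _ (proj₂ (walk-within Ss (conn u s)))
      dep : Fin n → ℕ
      dep u = proj₁ (nearest u)
      dep-≤ : ∀ {u d} → Within d u → dep u ≤ d
      dep-≤ {u} {d} p = ≮⇒≥ (λ lt → proj₂ (proj₂ (nearest u)) d lt p)
      parent : ∀ u d → Within d u → Fin n
      parent u zero    p = u
      parent u (suc d) p = proj₁ p
      parent-ok : ∀ u d (p : Within d u) → 1 ≤ d → Edge X u (parent u d p) × ∃ λ d′ → suc d′ ≡ d × Within d′ (parent u d p)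
      parent-ok u (suc d) (w , e , p) _ = e , d , refl , p
      par : Fin n → Fin n
      par u = parent u (dep u) (proj₁ (proj₂ (nearest u)))
      par-ok : ∀ u → 1 ≤ dep u → Edge X u (par u) × ∃ λ d′ → suc d′ ≡ dep u × Within d′ (par u)
      par-ok u = parent-ok u (dep u) (proj₁ (proj₂ (nearest u)))
      root-dep : ∀ u → S u ≡ true → dep u ≡ 0
      root-dep u p = n≤0⇒n≡0 (dep-≤ p)
      dep-root : ∀ u → dep u ≡ 0 → S u ≡ true
      dep-root u p = subst (λ d → Within d u) p (proj₁ (proj₂ (nearest u)))
      par-edge : ∀ u → 1 ≤ dep u → Edge X u (par u)
      par-edge u p = proj₁ (par-ok u p)
      dep-edge : ∀ {u w} → Edge X u w → dep u ≤ suc (dep w)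
      dep-edge {u} {w} e = dep-≤ (w , e , proj₁ (proj₂ (nearest w)))
      par-dep : ∀ u → 1 ≤ dep u → suc (dep (par u)) ≡ dep u
      par-dep u p with par-ok u p
      ... | e , d′ , eq , q = ≤-antisym (≤-trans (s≤s (dep-≤ q)) (≤-reflexive eq)) (dep-edge e)

module LayeringProps {n} {X : Graph n} {S : Fin n → Bool} (R : Layering X S) where
  open Layering R

  Child : Fin n → Fin n → Set
  Child u w = 1 ≤ dep w × par w ≡ u

  child-edge : ∀ {u w} → Child u w → Edge X u w
  child-edge {u} {w} (p , refl) = edge-sym X (par-edge w p)

  child-dep : ∀ {u w} → Child u w → dep w ≡ suc (dep u)
  child-dep {u} {w} (p , refl) = sym (par-dep w p)

  -- The factor `pos (dep w)` is there because `par` also has a value at the roots, which have no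
  -- parent.
  ch : Fin n → Fin n → ℕ
  ch u w = pos (dep w) * δ (par w) u

  ch-elim : ∀ {u w} → 1 ≤ ch u w → Child u w
  ch-elim {u} {w} p with dep w in eq
  ... | suc d = s≤s z≤n , δ-elim {i = par w} (≤-trans p (≤-reflexive (+-identityʳ _)))

  ch-intro : ∀ {u w} → Child u w → ch u w ≡ 1
  ch-intro {u} {w} (p , refl) with dep w
  ... | suc d = trans (+-identityʳ _) (δ-refl (par w))

  ch≤1 : ∀ u w → ch u w ≤ 1
  ch≤1 u w with dep w
  ... | zero  = z≤n
  ... | suc d = ≤-trans (≤-reflexive (+-identityʳ _)) (𝟙≤1 _)

  ∑-ch : ∀ w → sum (λ u → ch u w) ≡ pos (dep w)
  ∑-ch w = trans (∑-* (pos (dep w)) (δ (par w))) (trans (cong (pos (dep w) *_) (∑-δ₁ (par w))) (*-identityʳ _))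

  inner-outer : ∀ u → pos (dep u) + 𝟙 (S u) ≡ 1
  inner-outer u with dep u in eq | S u in eqS
  ... | zero  | true  = refl
  ... | zero  | false = contradiction (trans (sym eqS) (dep-root u eq)) λ ()
  ... | suc d | false = refl
  ... | suc d | true  = contradiction (trans (sym eq) (root-dep u eqS)) λ ()

  ∑-outer : sum (λ u → pos (dep u)) + sum (λ u → 𝟙 (S u)) ≡ n
  ∑-outer = trans (sym (∑-+ (λ u → pos (dep u)) (λ u → 𝟙 (S u))))
    (trans (∑-cong inner-outer) (∑-1 n))

  -- If there are no more edges than the core edges and one for every vertex
  -- outside S, then every edge is a core edge or joins a vertex to its parent.
  module Sparse (core : Fin n → Fin n → ℕ)
                (core≤ : ∀ u w → core u w ≤ A X u w)
                (core-dep : ∀ u w → 1 ≤ core u w → dep u ≡ 0 × dep w ≡ 0) where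

    g : Fin n → Fin n → ℕ
    g u w = core u w + (ch u w + ch w u)

    core-outer : ∀ u w → core u w + ch u w ≤ 1 × (1 ≤ core u w → ch u w ≡ 0 × ch w u ≡ 0)
    core-outer u w with core u w in eq
    ... | zero = ch≤1 u w , λ ()
    ... | suc c with core-dep u w (≤-trans (s≤s z≤n) (≤-reflexive (sym eq)))
    ...   | du , dw rewrite du | dw = ≤-trans (≤-reflexive (trans (+-identityʳ _) (sym eq))) (≤-trans (core≤ u w) (𝟙≤1 _)) , λ _ → refl , refl

    g≤A : ∀ u w → g u w ≤ A X u w
    g≤A u w with core u w in ec | ch u w in e₁ | ch w u in e₂
    ... | suc c | x | y with proj₂ (core-outer u w) (≤-trans (s≤s z≤n) (≤-reflexive (sym ec)))
    ...   | p , q = ≤-trans (≤-reflexive (trans (cong₂ (λ a b → suc c + (a + b)) (trans (sym e₁) p) (trans (sym e₂) q)) (trans (+-identityʳ _) (sym ec)))) (core≤ u w)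
    g≤A u w | zero | zero | zero = z≤n
    g≤A u w | zero | suc x | zero = ≤-trans (≤-reflexive (trans (+-identityʳ _) (sym e₁))) (≤-trans (ch≤1 u w)
      (≤-reflexive (sym (A-edge X (child-edge (ch-elim (≤-trans (s≤s z≤n) (≤-reflexive (sym e₁)))))))))
    g≤A u w | zero | zero | suc y = ≤-trans (≤-reflexive (sym e₂)) (≤-trans (ch≤1 w u)
      (≤-reflexive (sym (A-edge X (edge-sym X (child-edge (ch-elim (≤-trans (s≤s z≤n) (≤-reflexive (sym e₂))))))))))
    g≤A u w | zero | suc x | suc y = contradiction
      (trans (child-dep (ch-elim {u} {w} (≤-trans (s≤s z≤n) (≤-reflexive (sym e₁)))))
        (cong suc (child-dep (ch-elim {w} {u} (≤-trans (s≤s z≤n) (≤-reflexive (sym e₂)))))))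
      (d≢2+d (dep w))
      where
      d≢2+d : ∀ d → d ≢ suc (suc d)
      d≢2+d zero ()
      d≢2+d (suc d) p = d≢2+d d (suc-injective p)

    -- Every vertex outside `S` has exactly one parent, and `g` sees the edge between them from both
    -- ends.
    ∑g : sum (λ u → sum (g u)) ≡ sum (λ u → sum (core u)) + 2 * sum (λ u → pos (dep u))
    ∑g = begin-equality
      sum (λ u → sum (g u))
        ≡⟨ ∑-cong (λ u → trans (∑-+ (core u) (λ w → ch u w + ch w u)) (cong (sum (core u) +_) (∑-+ (ch u) (λ w → ch w u)))) ⟩
      sum (λ u → sum (core u) + (sum (ch u) + sum (λ w → ch w u)))
        ≡⟨ trans (∑-+ (sum ∘ core) (λ u → sum (ch u) + sum (λ w → ch w u))) (cong (sum (sum ∘ core) +_) (∑-+ (sum ∘ ch) (λ u → sum (λ w → ch w u)))) ⟩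
      sum (sum ∘ core) + (sum (sum ∘ ch) + sum (λ u → sum (λ w → ch w u)))
        ≡⟨ cong (sum (sum ∘ core) +_) (cong₂ _+_ (trans (∑-comm ch) (∑-cong ∑-ch)) (∑-cong ∑-ch)) ⟩
      sum (sum ∘ core) + (sum (λ u → pos (dep u)) + sum (λ u → pos (dep u)))
        ≡⟨ cong (λ x → sum (sum ∘ core) + (sum (λ u → pos (dep u)) + x)) (sym (+-identityʳ _)) ⟩
      sum (sum ∘ core) + 2 * sum (λ u → pos (dep u)) ∎
      where open ≤-Reasoning

    enough : sum (sum ∘ core) + 2 * sum (λ u → pos (dep u)) ≤ degrees X
    enough = ≤-trans (≤-reflexive (sym ∑g)) (∑-mono (λ u → ∑-mono (g≤A u)))

    exact : degrees X ≤ sum (sum ∘ core) + 2 * sum (λ u → pos (dep u)) → ∀ u w → g u w ≡ A X u w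
    exact few u = ∑-tight (g≤A u) (≤-reflexive (sym (row u)))
      where
      row : ∀ u → sum (g u) ≡ sum (A X u)
      row = ∑-tight (λ u → ∑-mono (g≤A u)) (≤-trans few (≤-reflexive (sym ∑g)))

    edges : degrees X ≤ sum (sum ∘ core) + 2 * sum (λ u → pos (dep u)) →
            ∀ {u w} → Edge X u w → 1 ≤ core u w ⊎ Child u w ⊎ Child w u
    edges few {u} {w} e = split (core u w) (ch u w) (ch w u) refl refl refl (≤-reflexive (sym (trans (exact few u w) (A-edge X e))))
      where
      split : ∀ a b c → a ≡ core u w → b ≡ ch u w → c ≡ ch w u → 1 ≤ a + (b + c) → 1 ≤ core u w ⊎ Child u w ⊎ Child w u
      split (suc a) b c p _ _ _ = inj₁ (≤-trans (s≤s z≤n) (≤-reflexive p))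
      split zero (suc b) c _ p _ _ = inj₂ (inj₁ (ch-elim (≤-trans (s≤s z≤n) (≤-reflexive p))))
      split zero zero (suc c) _ _ p _ = inj₂ (inj₂ (ch-elim (≤-trans (s≤s z≤n) (≤-reflexive p))))

-- Cyclic indices

module Cyclic (L′ : ℕ) where

  L : ℕ
  L = suc L′

  abstract
    idx : ℕ → Fin L
    idx v = fromℕ< (m%n<n v L)

    toℕ-idx : ∀ v → toℕ (idx v) ≡ v % L
    toℕ-idx v = toℕ-fromℕ< (m%n<n v L)

  idx-cong : ∀ {v w} → v % L ≡ w % L → idx v ≡ idx w
  idx-cong {v} {w} p = toℕ-injective (trans (toℕ-idx v) (trans p (sym (toℕ-idx w))))

  toℕ-idx-< : ∀ {v} → v < L → toℕ (idx v) ≡ v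
  toℕ-idx-< {v} lt = trans (toℕ-idx v) (m<n⇒m%n≡m lt)

  idx-toℕ : ∀ t → idx (toℕ t) ≡ t
  idx-toℕ t = toℕ-injective (toℕ-idx-< (toℕ<n t))

  idx-+ : ∀ w k → idx (toℕ (idx w) + k) ≡ idx (w + k)
  idx-+ w k = idx-cong (begin-equality
    (toℕ (idx w) + k) % L           ≡⟨ cong (λ x → (x + k) % L) (toℕ-idx w) ⟩
    (w % L + k) % L                 ≡⟨ %-distribˡ-+ (w % L) k L ⟩
    (w % L % L + k % L) % L         ≡⟨ cong (λ x → (x + k % L) % L) (m%n%n≡m%n w L) ⟩
    (w % L + k % L) % L             ≡⟨ sym (%-distribˡ-+ w k L) ⟩
    (w + k) % L                     ∎)
    where open ≤-Reasoning

  idx-cong-+ : ∀ {w w′} k → idx w ≡ idx w′ → idx (w + k) ≡ idx (w′ + k)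
  idx-cong-+ {w} {w′} k p = trans (sym (idx-+ w k)) (trans (cong (λ t → idx (toℕ t + k)) p) (idx-+ w′ k))

  idx-per : ∀ v → idx (v + L) ≡ idx v
  idx-per v = idx-cong ([m+n]%n≡m%n v L)

  idx-pers : ∀ v k → idx (v + k * L) ≡ idx v
  idx-pers v k = idx-cong ([m+kn]%n≡m%n v k L)

  -- This is `t` minus `v` modulo `L`, because `L′` is -1 modulo `L`.
  rel : ℕ → Fin L → ℕ
  rel v t = toℕ (idx (toℕ t + L′ * v))

  rel<L : ∀ v t → rel v t < L
  rel<L v t = toℕ<n (idx (toℕ t + L′ * v))

  wrap : ∀ v q → v + q + L′ * v ≡ q + v * L
  wrap v q = begin-equality
    v + q + L′ * v    ≡⟨ cong (_+ L′ * v) (+-comm v q) ⟩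
    q + v + L′ * v    ≡⟨ +-assoc q v _ ⟩
    q + (v + L′ * v)  ≡⟨ cong (q +_) (*-comm L v) ⟩
    q + v * L         ∎
    where open ≤-Reasoning

  idx-rel : ∀ v t → idx (v + rel v t) ≡ t
  idx-rel v t = begin
    idx (v + toℕ (idx (toℕ t + L′ * v)))  ≡⟨ cong idx (+-comm v _) ⟩
    idx (toℕ (idx (toℕ t + L′ * v)) + v)  ≡⟨ idx-+ (toℕ t + L′ * v) v ⟩
    idx (toℕ t + L′ * v + v)              ≡⟨ cong idx (trans (+-comm (toℕ t + L′ * v) v) (trans (sym (+-assoc v (toℕ t) _)) (wrap v (toℕ t)))) ⟩
    idx (toℕ t + v * L)                   ≡⟨ idx-pers (toℕ t) v ⟩
    idx (toℕ t)                           ≡⟨ idx-toℕ t ⟩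
    t                                     ∎
    where open ≡-Reasoning

  idx-cancel : ∀ v {q q′} → idx (v + q) ≡ idx (v + q′) → idx q ≡ idx q′
  idx-cancel v {q} {q′} p = begin
    idx q                 ≡⟨ sym (idx-pers q v) ⟩
    idx (q + v * L)       ≡⟨ cong idx (sym (wrap v q)) ⟩
    idx (v + q + L′ * v)  ≡⟨ idx-cong-+ (L′ * v) p ⟩
    idx (v + q′ + L′ * v) ≡⟨ cong idx (wrap v q′) ⟩
    idx (q′ + v * L)      ≡⟨ idx-pers q′ v ⟩
    idx q′                ∎
    where open ≡-Reasoning

  idx-inj : ∀ {q q′} → q < L → q′ < L → idx q ≡ idx q′ → q ≡ q′
  idx-inj p p′ e = trans (sym (toℕ-idx-< p)) (trans (cong toℕ e) (toℕ-idx-< p′))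

  rel-idx : ∀ v q → q < L → rel v (idx (v + q)) ≡ q
  rel-idx v q q<L = idx-inj (rel<L v _) q<L (idx-cancel v (idx-rel v (idx (v + q))))

  rel-0 : ∀ v t → rel v t ≡ 0 → t ≡ idx v
  rel-0 v t p = trans (sym (idx-rel v t)) (cong idx (trans (cong (v +_) p) (+-identityʳ v)))

  idx-top : idx (suc (toℕ (fromℕ L′))) ≡ zero
  idx-top = trans (idx-cong (trans (cong (λ x → suc x % L) (toℕ-fromℕ L′)) (n%n≡0 L))) (idx-toℕ zero)

  idx-inject : ∀ (t : Fin L′) → idx (suc (toℕ (inject₁ t))) ≡ suc t
  idx-inject t = trans (cong (idx ∘ suc) (toℕ-inject₁ t)) (idx-toℕ (suc t))

  around : (R : Fin L → Fin L → Set) → (∀ t → R (inject₁ t) (suc t)) → R (fromℕ L′) zero →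
           ∀ v → R (idx v) (idx (suc v))
  around R inner last v = subst (R (idx v)) (trans (turn v) refl) (at (idx v))
    where
    turn : ∀ v → idx (suc (toℕ (idx v))) ≡ idx (suc v)
    turn v = trans (cong idx (+-comm 1 (toℕ (idx v)))) (trans (idx-+ v 1) (cong idx (+-comm v 1)))
    at : ∀ t → R t (idx (suc (toℕ t)))
    at t with view t
    ... | ‵fromℕ = subst (R (fromℕ L′)) (sym idx-top) last
    ... | ‵inject₁ j = subst (R (inject₁ j)) (sym (idx-inject j)) (inner j)

  Σ<-idx : ∀ (f : Fin L → ℕ) → Σ< L (f ∘ idx) ≡ sum f
  Σ<-idx f = trans (Σ<-Fin L (f ∘ idx)) (∑-cong (λ t → cong f (idx-toℕ t)))

maxTo : ℕ → (ℕ → ℕ) → ℕ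
maxTo zero    f = 0
maxTo (suc n) f = f 0 ⊔ maxTo n (f ∘ suc)

maxTo-≥ : ∀ n f j → j < n → f j ≤ maxTo n f
maxTo-≥ (suc n) f zero    _       = m≤m⊔n _ _
maxTo-≥ (suc n) f (suc j) (s≤s p) = ≤-trans (maxTo-≥ n (f ∘ suc) j p) (m≤n⊔m _ _)

maxTo-lub : ∀ n f c → (∀ j → j < n → f j ≤ c) → maxTo n f ≤ c
maxTo-lub zero    f c le = z≤n
maxTo-lub (suc n) f c le = ⊔-lub (le 0 (s≤s z≤n)) (maxTo-lub n (f ∘ suc) c (λ j p → le (suc j) (s≤s p)))

maxTo-cong : ∀ n {f g} → (∀ j → f j ≡ g j) → maxTo n f ≡ maxTo n g
maxTo-cong zero    e = refl
maxTo-cong (suc n) e = cong₂ _⊔_ (e 0) (maxTo-cong n (e ∘ suc))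

maxTo-arg : ∀ n f → ∃ λ j → j < suc n × maxTo (suc n) f ≡ f j
maxTo-arg zero    f = 0 , s≤s z≤n , ⊔-identityʳ (f 0)
maxTo-arg (suc n) f with maxTo-arg n (f ∘ suc) | ≤-total (f 0) (maxTo (suc n) (f ∘ suc))
... | j , j<n , e | inj₁ p = suc j , s≤s j<n , trans (m≤n⇒m⊔n≡n p) e
... | j , j<n , e | inj₂ p = 0 , s≤s z≤n , m≥n⇒m⊔n≡m p

-- Walks avoiding a vertex, ancestors, and a longest path of a tree

data Way {n} (X : Graph n) (v : Fin n) : ℕ → Fin n → Fin n → Set where
  stop : ∀ {u} → u ≢ v → Way X v 0 u u
  move : ∀ {d u w z} → u ≢ v → Edge X u w → Way X v d w z → Way X v (suc d) u z

module _ {n} {X : Graph n} {v : Fin n} where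

  way-start : ∀ {d u w} → Way X v d u w → u ≢ v
  way-start (stop p)     = p
  way-start (move p _ _) = p

  way-++ : ∀ {d d′ u w z} → Way X v d u w → Way X v d′ w z → Way X v (d + d′) u z
  way-++ (stop _)     q = q
  way-++ (move p e w) q = move p e (way-++ w q)

  way-snoc : ∀ {d u w z} → Way X v d u w → Edge X w z → z ≢ v → Way X v (suc d) u z
  way-snoc (stop p)     e q = move p e (stop q)
  way-snoc (move p f w) e q = move p f (way-snoc w e q)

  way-sym : ∀ {d u w} → Way X v d u w → Way X v d w u
  way-sym (stop p)     = stop p
  way-sym (move p e w) = way-snoc (way-sym w) (edge-sym X e) p

  way-lipschitz : (f : Fin n → ℕ) → (∀ {u w} → u ≢ v → w ≢ v → Edge X u w → f u ≤ suc (f w)) →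
                  ∀ {d u w} → Way X v d u w → f u ≤ f w + d
  way-lipschitz f lip (stop p) = ≤-reflexive (sym (+-identityʳ _))
  way-lipschitz f lip {suc d} {u} {w} (move p e q) = ≤-trans (lip p (way-start q) e)
    (≤-trans (s≤s (way-lipschitz f lip q)) (≤-reflexive (sym (+-suc (f w) d))))

  way-closed : (Z : Fin n → Set) → (∀ {u w} → u ≢ v → w ≢ v → Edge X u w → Z u → Z w) →
               ∀ {d u w} → Way X v d u w → Z u → Z w
  way-closed Z cl (stop p)     z = z
  way-closed Z cl (move p e w) z = way-closed Z cl w (cl p (way-start w) e z)

way-match : ∀ {n} {X Y : Graph n} {x y} (M : Match X Y x y) {d u w} →
            Way X x d u w → Way Y y d (Match.to M u) (Match.to M w)
way-match M (stop p)     = stop (Match.to-≢ M p)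
way-match M (move p e w) = move (Match.to-≢ M p) (Match.edge-to M p (way-start w) e) (way-match M w)

module Ancestors {n} {X : Graph n} {S : Fin n → Bool} (R : Layering X S) where
  open Layering R public
  open LayeringProps R public using (Child; child-edge; child-dep)

  up : ℕ → Fin n → Fin n
  up zero    u = u
  up (suc j) u = up j (par u)

  up-dep : ∀ j u → j ≤ dep u → dep (up j u) + j ≡ dep u
  up-dep zero    u p = +-identityʳ _
  up-dep (suc j) u p = begin-equality
    dep (up j (par u)) + suc j    ≡⟨ +-suc _ j ⟩
    suc (dep (up j (par u)) + j)  ≡⟨ cong suc (up-dep j (par u) (s≤s⁻¹ (≤-trans p (≤-reflexive (sym (par-dep u (≤-trans (s≤s z≤n) p))))))) ⟩
    suc (dep (par u))             ≡⟨ par-dep u (≤-trans (s≤s z≤n) p) ⟩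
    dep u                         ∎
    where open ≤-Reasoning

  Anc : Fin n → Fin n → Set
  Anc x u = dep x ≤ dep u × up (dep u ∸ dep x) u ≡ x

  anc? : ∀ x u → Dec (Anc x u)
  anc? x u = (dep x ≤? dep u) ×-dec (up (dep u ∸ dep x) u ≟F x)

  anc-refl : ∀ x → Anc x x
  anc-refl x = ≤-refl , cong (λ j → up j x) (n∸n≡0 (dep x))

  anc-same : ∀ {x u} → Anc x u → dep x ≡ dep u → x ≡ u
  anc-same {x} {u} (_ , p) q = trans (sym p) (cong (λ j → up j u) (trans (cong (dep u ∸_) q) (n∸n≡0 (dep u))))

  step-up : ∀ {u w x} → Child u w → dep x ≤ dep u → up (dep w ∸ dep x) w ≡ up (dep u ∸ dep x) u
  step-up {u} {w} {x} c@(p , refl) le = cong (λ j → up j w) (trans (cong (_∸ dep x) (child-dep c)) (+-∸-assoc 1 le))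

  anc-down : ∀ {x u w} → Child u w → Anc x u → Anc x w
  anc-down {x} {u} {w} c (le , p) = ≤-trans le (≤-trans (n≤1+n _) (≤-reflexive (sym (child-dep c)))) , trans (step-up c le) p

  anc-up : ∀ {x u w} → Child u w → x ≢ w → Anc x w → Anc x u
  anc-up {x} {u} {w} c x≢w a@(le , p) = le′ , trans (sym (step-up c le′)) p
    where
    le′ : dep x ≤ dep u
    le′ = s≤s⁻¹ (≤-trans (≤∧≢⇒< le (λ q → x≢w (anc-same a q))) (≤-reflexive (child-dep c)))

  par-child : ∀ u → 1 ≤ dep u → Child (par u) u
  par-child u p = p , refl

  anc-dep0 : ∀ {x u} → dep u ≡ 0 → Anc x u → x ≡ u
  anc-dep0 {x} {u} p a = anc-same a (trans (n≤0⇒n≡0 (≤-trans (proj₁ a) (≤-reflexive p))) (sym p))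

  -- The way from `u` to its root runs exactly through the ancestors of `u`.
  climb : ∀ {x} d u → dep u ≡ d → ¬ Anc x u → Way X x d u (up d u)
  climb zero    u p ¬a = stop (λ q → ¬a (subst (λ z → Anc z u) q (anc-refl u)))
  climb (suc d) u p ¬a = move (λ q → ¬a (subst (λ z → Anc z u) q (anc-refl u))) (par-edge u 1≤)
    (climb d (par u) (suc-injective (trans (par-dep u 1≤) p)) (λ a → ¬a (anc-down (par-child u 1≤) a)))
    where
    1≤ : 1 ≤ dep u
    1≤ = ≤-trans (s≤s z≤n) (≤-reflexive (sym p))

argmax : ∀ {n} (f : Fin (suc n) → ℕ) → ∃ λ i → ∀ j → f j ≤ f i
argmax {zero}  f = zero , λ { zero → ≤-refl }
argmax {suc n} f with argmax (f ∘ suc)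
... | i , max with ≤-total (f zero) (f (suc i))
...   | inj₁ p = suc i , λ { zero → p ; (suc j) → max j }
...   | inj₂ p = zero , λ { zero → ≤-refl ; (suc j) → ≤-trans (max j) p }

module Tree {m} (G : Graph (suc m)) (conn : Connected G) (few : degrees G ≤ 2 * m) where

  root? : Fin (suc m) → Fin (suc m) → Bool
  root? a u = does (a ≟F u)

  lay : ∀ a → Layering G (root? a)
  lay a = layering G (root? a) conn (a , dec-true (a ≟F a) refl)

  open module At (a : Fin (suc m)) = Ancestors (lay a) public

  root-unique : ∀ a u → dep a u ≡ 0 → u ≡ a
  root-unique a u p with a ≟F u | dep-root a u p
  ... | yes q | _ = sym q

  dep-self : ∀ a → dep a a ≡ 0
  dep-self a = root-dep a a (dec-true (a ≟F a) refl)

  -- With an empty core the edges to parents are already n - 1, which is all that G has.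
  tree-edge : ∀ a {u w} → Edge G u w → Child a u w ⊎ Child a w u
  tree-edge a {u} {w} e = pick (LayeringProps.Sparse.edges (lay a) (λ _ _ → 0) (λ _ _ → z≤n) (λ _ _ ()) bound e)
    where
    open LayeringProps (lay a)
    outer : ℕ
    outer = sum (λ u → pos (dep a u))
    outer≡ : outer + 1 ≡ suc m
    outer≡ = trans (cong (outer +_) (sym (∑-δ₁ a))) ∑-outer
    none : ℕ
    none = sum {suc m} (λ _ → sum {suc m} (λ _ → 0))
    bound : degrees G ≤ none + 2 * outer
    bound = ≤-trans few (≤-trans (*-monoʳ-≤ 2 (s≤s⁻¹ (≤-reflexive (trans (sym outer≡) (+-comm outer 1)))))
              (m≤n+m (2 * outer) none))
    pick : ∀ {P : Set} → 1 ≤ 0 ⊎ P → P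
    pick (inj₂ c) = c

  below-closed : ∀ a x {u w} → u ≢ x → w ≢ x → Edge G u w → Anc a x u → Anc a x w
  below-closed a x {u} {w} u≢ w≢ e anc = go (tree-edge a e)
    where
    go : Child a u w ⊎ Child a w u → Anc a x w
    go (inj₁ c) = anc-down a c anc
    go (inj₂ c) = anc-up a c (u≢ ∘ sym) anc

  above-closed : ∀ a x {u w} → u ≢ x → w ≢ x → Edge G u w → ¬ Anc a x u → ¬ Anc a x w
  above-closed a x u≢ w≢ e ¬anc anc = ¬anc (below-closed a x w≢ u≢ (edge-sym G e) anc)

  -- In G − x a function changing by at most 1 along edges changes by at most
  -- the distance in G, since the path of G between connected vertices survives.
  stretch : ∀ x (f : Fin (suc m) → ℕ) → (∀ {u w} → u ≢ x → w ≢ x → Edge G u w → f u ≤ suc (f w)) →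
            ∀ {d α β} → Way G x d α β → f β ≤ f α + dep α β
  stretch x f lip {d} {α} {β} way = subst (λ z → f β ≤ f z + dep α β) top (way-lipschitz f lip (climb α (dep α β) β refl below))
    where
    below : ¬ Anc α x β
    below = way-closed (λ u → ¬ Anc α x u) (above-closed α x) way
      (λ a → way-start way (sym (anc-dep0 α (dep-self α) a)))
    top : up α (dep α β) β ≡ α
    top = root-unique α _ (+-cancelʳ-≡ (dep α β) _ _ (up-dep α (dep α β) β ≤-refl))

  abstract
    far : ∀ a → ∃ λ b → ∀ c → dep a c ≤ dep a b
    far a = argmax (dep a)
    widest : ∃ λ a → ∀ a′ → dep a′ (proj₁ (far a′)) ≤ dep a (proj₁ (far a))
    widest = argmax (λ a → dep a (proj₁ (far a)))

  end₁ end₂ : Fin (suc m)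
  end₁ = proj₁ widest
  end₂ = proj₁ (far end₁)

  diam : ℕ
  diam = dep end₁ end₂

  diam-max : ∀ u w → dep u w ≤ diam
  diam-max u w = ≤-trans (proj₂ (far u) w) (proj₂ widest u)

  -- With the root at `end₁`, the vertices of the path between the two ends are the ancestors of
  -- `end₂`.
  OnPath : Fin (suc m) → Set
  OnPath w = Anc end₁ w end₂

  abstract
    onPath : ∀ w → Dec (OnPath w)
    onPath w = anc? end₁ w end₂

  level : Fin (suc m) → ℕ
  level = dep end₁

  node : ℕ → Fin (suc m)
  node i = up end₁ (diam ∸ i) end₂

  level-node : ∀ i → i ≤ diam → level (node i) ≡ i
  level-node i p = +-cancelʳ-≡ (diam ∸ i) _ _ (trans (up-dep end₁ (diam ∸ i) end₂ (m∸n≤m diam i)) (sym (m+[n∸m]≡n p)))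

  onPath-node : ∀ i → i ≤ diam → OnPath (node i)
  onPath-node i p = ≤-trans (≤-reflexive (level-node i p)) p , cong (λ j → up end₁ (diam ∸ j) end₂) (level-node i p)

  node-level : ∀ {w} → OnPath w → node (level w) ≡ w
  node-level (_ , p) = p

  off-path : ∀ {x} → ¬ OnPath x → Way G x diam end₂ end₁
  off-path {x} ¬p = subst (Way G x diam end₂) (root-unique end₁ _ (+-cancelʳ-≡ diam _ _ (up-dep end₁ diam end₂ ≤-refl)))
    (climb end₁ diam end₂ refl ¬p)

  node-suc : ∀ i → suc i ≤ diam → Child end₁ (node i) (node (suc i))
  node-suc i p = ≤-trans (s≤s z≤n) (≤-reflexive (sym (level-node (suc i) p))) , trans (up-par (diam ∸ suc i) end₂)
      (cong (λ j → up end₁ j end₂) (sym (+-∸-assoc 1 p)))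
    where
    up-par : ∀ j u → par end₁ (up end₁ j u) ≡ up end₁ (suc j) u
    up-par zero    u = refl
    up-par (suc j) u = up-par j (par end₁ u)

  node-below : ∀ i j → i + j ≤ diam → Anc end₁ (node i) (node (i + j))
  node-below i zero    p = subst (λ k → Anc end₁ (node i) (node k)) (sym (+-identityʳ i)) (anc-refl end₁ (node i))
  node-below i (suc j) p = subst (λ k → Anc end₁ (node i) (node k)) (sym (+-suc i j))
    (anc-down end₁ (node-suc (i + j) (≤-trans (≤-reflexive (sym (+-suc i j))) p))
      (node-below i j (≤-trans (+-monoʳ-≤ i (n≤1+n j)) p)))

  node-above : ∀ i j → i < j → j ≤ diam → ¬ Anc end₁ (node j) (node i)
  node-above i j i<j j≤ (le , _) = <⇒≱ i<j (subst₂ _≤_ (level-node j j≤) (level-node i (≤-trans (<⇒≤ i<j) j≤)) le)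

does-true : ∀ {P : Set} (d : Dec P) → does d ≡ true → P
does-true (yes p) _ = p

∑-two : ∀ {n} {u u′ : Fin n} (f : Fin n → ℕ) → u ≢ u′ → 1 ≤ f u → 1 ≤ f u′ → 2 ≤ sum f
∑-two {u = u} {u′} f u≢u′ p p′ = ≤-trans (≤-reflexive (sym (trans (∑-+ (δ u) (δ u′)) (cong₂ _+_ (∑-δ₁ u) (∑-δ₁ u′))))) (∑-mono le)
  where
  le : ∀ w → δ u w + δ u′ w ≤ f w
  le w with u ≟F w | u′ ≟F w
  ... | yes refl | yes refl = contradiction refl u≢u′
  ... | yes refl | no _     = p
  ... | no _     | yes refl = p′
  ... | no _     | no _     = z≤n

∑-another : ∀ {n} (f : Fin n → ℕ) → (∀ i → f i ≤ 1) → 2 ≤ sum f → ∀ u → ∃ λ w → w ≢ u × 1 ≤ f w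
∑-another f f≤1 2≤ u with any? (λ w → ¬? (w ≟F u) ×-dec (1 ≤? f w))
... | yes found = found
... | no none = contradiction (≤-trans 2≤ (≤-trans (∑-mono le) (≤-reflexive (∑-δ₁ u)))) 1+n≰n
  where
  le : ∀ w → f w ≤ δ u w
  le w with u ≟F w
  ... | yes refl = f≤1 u
  ... | no u≢w = ≮⇒≥ (λ lt → none (w , (λ p → u≢w (sym p)) , lt))

-- Unicyclic graphs

module Ring {m} (H : Graph (suc m)) (conn : Connected H) {k₀} (C : Cycle H k₀) where

  open Cyclic (2 + k₀) public

  c : Fin L → Fin (suc m)
  c = proj₁ C

  c-inj : ∀ {s t} → c s ≡ c t → s ≡ t
  c-inj = proj₁ (proj₂ C)

  next : Fin L → Fin L
  next t = idx (suc (toℕ t))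

  next-idx : ∀ v → next (idx v) ≡ idx (suc v)
  next-idx v = trans (cong idx (+-comm 1 (toℕ (idx v)))) (trans (idx-+ v 1) (cong idx (+-comm v 1)))

  ring-edge : ∀ v → Edge H (c (idx v)) (c (idx (suc v)))
  ring-edge = around (λ s t → Edge H (c s) (c t)) (proj₁ (proj₂ (proj₂ C))) (proj₂ (proj₂ (proj₂ C)))

  next-edge : ∀ t → Edge H (c t) (c (next t))
  next-edge t = subst (λ s → Edge H (c s) (c (next t))) (idx-toℕ t) (ring-edge (toℕ t))

  -- A cycle of length at least 3 does not return after two steps. Hence the two summands in `core`
  -- are never both 1.
  next-next : ∀ {s t} → s ≡ next t → t ≢ next s
  next-next {s} {t} refl q = contradiction (idx-inj (s≤s z≤n) (s≤s (s≤s (s≤s z≤n))) (idx-cancel (toℕ t) {0} {2} (trans start (sym finish)))) λ ()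
    where
    start : idx (toℕ t + 0) ≡ t
    start = trans (cong idx (+-identityʳ (toℕ t))) (idx-toℕ t)
    finish : idx (toℕ t + 2) ≡ t
    finish = trans (cong idx (+-comm (toℕ t) 2)) (trans (sym (next-idx (suc (toℕ t)))) (sym q))

  onRing : ∀ u → Dec (∃ λ t → c t ≡ u)
  onRing u = any? (λ t → c t ≟F u)

  ring : Fin (suc m) → Bool
  ring u = does (onRing u)

  ring-c : ∀ t → ring (c t) ≡ true
  ring-c t = dec-true (onRing (c t)) (t , refl)

  lay : Layering H ring
  lay = layering H ring conn (c zero , ring-c zero)

  open Ancestors lay public
  open LayeringProps lay public using (ch; ch-elim; ch-intro; ch≤1; ∑-ch; inner-outer; ∑-outer)

  dep-c : ∀ t → dep (c t) ≡ 0
  dep-c t = root-dep (c t) (ring-c t)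

  top : Fin (suc m) → Fin (suc m)
  top u = up (dep u) u

  top-ring : ∀ u → ∃ λ t → c t ≡ top u
  top-ring u = does-true (onRing (top u)) (dep-root (top u) (+-cancelʳ-≡ (dep u) _ _ (up-dep (dep u) u ≤-refl)))

  abstract
    rt : Fin (suc m) → Fin L
    rt u = proj₁ (top-ring u)

    c-rt : ∀ u → c (rt u) ≡ top u
    c-rt u = proj₂ (top-ring u)

  c-rt-0 : ∀ u → dep u ≡ 0 → c (rt u) ≡ u
  c-rt-0 u p = trans (c-rt u) (cong (λ d → up d u) p)

  rt-c : ∀ t → rt (c t) ≡ t
  rt-c t = c-inj (c-rt-0 (c t) (dep-c t))

  rt-child : ∀ {u w} → Child u w → rt w ≡ rt u
  rt-child {u} {w} k@(p , refl) = c-inj (trans (c-rt w) (trans (cong (λ d → up d w) (child-dep k)) (sym (c-rt u))))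

  rt-up : ∀ j u → j ≤ dep u → rt (up j u) ≡ rt u
  rt-up zero    u p = refl
  rt-up (suc j) u p = trans (rt-up j (par u) (s≤s⁻¹ (≤-trans p (≤-reflexive (sym (par-dep u 1≤)))))) (sym (rt-child (par-child u 1≤)))
    where
    1≤ : 1 ≤ dep u
    1≤ = ≤-trans (s≤s z≤n) p

  inner : Fin (suc m) → ℕ
  inner u = 𝟙 (ring u)

  inner-0 : ∀ u → 1 ≤ inner u → dep u ≡ 0
  inner-0 u p with ring u in eq
  ... | true = root-dep u eq

  -- The adjacency matrix of the cycle. The factors `inner` are needed as `rt` is defined on the
  -- trees, too.
  core : Fin (suc m) → Fin (suc m) → ℕ
  core u w = inner u * (inner w * (δ (next (rt u)) (rt w) + δ (next (rt w)) (rt u)))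

  core-inner : ∀ u w → 1 ≤ core u w → (1 ≤ inner u × 1 ≤ inner w) × 1 ≤ δ (next (rt u)) (rt w) + δ (next (rt w)) (rt u)
  core-inner u w p with inner u | inner w
  ... | suc a | suc b = (s≤s z≤n , s≤s z≤n) , nz _ a b p
    where
    nz : ∀ x a b → 1 ≤ suc a * (suc b * x) → 1 ≤ x
    nz (suc x) a b _ = s≤s z≤n
    nz zero a b p = contradiction (subst (1 ≤_) (trans (cong (suc a *_) (*-zeroʳ (suc b))) (*-zeroʳ (suc a))) p) λ ()
  ... | suc a | zero = contradiction (subst (1 ≤_) (*-zeroʳ (suc a)) p) λ ()

  core-dep : ∀ u w → 1 ≤ core u w → dep u ≡ 0 × dep w ≡ 0
  core-dep u w p with core-inner u w p
  ... | (a , b) , _ = inner-0 u a , inner-0 w b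

  one-of : ∀ {a b} → 1 ≤ a + b → 1 ≤ a ⊎ 1 ≤ b
  one-of {suc a} _ = inj₁ (s≤s z≤n)
  one-of {zero}  p = inj₂ p

  core-next : ∀ u w → 1 ≤ core u w → next (rt u) ≡ rt w ⊎ next (rt w) ≡ rt u
  core-next u w p with one-of {δ (next (rt u)) (rt w)} (proj₂ (core-inner u w p))
  ... | inj₁ q = inj₁ (δ-elim {i = next (rt u)} q)
  ... | inj₂ q = inj₂ (δ-elim {i = next (rt w)} q)

  core≤1 : ∀ u w → core u w ≤ 1
  core≤1 u w = ≤-trans (*-mono-≤ (𝟙≤1 (ring u)) (*-mono-≤ (𝟙≤1 (ring w)) both)) ≤-refl
    where
    both : δ (next (rt u)) (rt w) + δ (next (rt w)) (rt u) ≤ 1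
    both with next (rt u) ≟F rt w | next (rt w) ≟F rt u
    ... | yes p | yes q = contradiction (sym q) (next-next (sym p))
    ... | yes p | no _  = ≤-refl
    ... | no _  | yes q = ≤-refl
    ... | no _  | no _  = z≤n

  core≤ : ∀ u w → core u w ≤ A H u w
  core≤ u w with 1 ≤? core u w
  ... | no p = ≤-trans (≤-reflexive (n<1⇒n≡0 (≰⇒> p))) z≤n
  ... | yes p = ≤-trans (core≤1 u w) (≤-reflexive (sym (A-edge H (go (core-next u w p)))))
    where
    cu : c (rt u) ≡ u
    cu = c-rt-0 u (proj₁ (core-dep u w p))
    cw : c (rt w) ≡ w
    cw = c-rt-0 w (proj₂ (core-dep u w p))
    go : next (rt u) ≡ rt w ⊎ next (rt w) ≡ rt u → Edge H u w
    go (inj₁ q) = subst₂ (Edge H) cu (trans (cong c q) cw) (next-edge (rt u))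
    go (inj₂ q) = edge-sym H (subst₂ (Edge H) cw (trans (cong c q) cu) (next-edge (rt w)))

  ring-≡ : ∀ u → ring u ≡ true → c (rt u) ≡ u
  ring-≡ u p = c-rt-0 u (root-dep u p)

  ∑-ring : ∀ (f : Fin L → ℕ) → sum (λ u → inner u * f (rt u)) ≡ sum f
  ∑-ring f = begin-equality
    sum (λ u → inner u * f (rt u))                ≡⟨ ∑-cong (λ u → sym (inside u)) ⟩
    sum (λ u → sum (λ t → δ (c t) u * f t))       ≡⟨ ∑-comm (λ u t → δ (c t) u * f t) ⟩
    sum (λ t → sum (λ u → δ (c t) u * f t))       ≡⟨ ∑-cong (λ t → trans (∑-*ʳ (f t) (δ (c t))) (trans (cong (_* f t) (∑-δ₁ (c t))) (*-identityˡ (f t)))) ⟩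
    sum f                                         ∎
    where
    open ≤-Reasoning
    inside : ∀ u → sum (λ t → δ (c t) u * f t) ≡ inner u * f (rt u)
    inside u with ring u in eq
    ... | true  = trans (∑-cong (λ t → cong (_* f t) (same t))) (trans (∑-δ (rt u) f) (sym (+-identityʳ _)))
      where
      same : ∀ t → δ (c t) u ≡ δ (rt u) t
      same t with c t ≟F u | rt u ≟F t
      ... | yes _ | yes _ = refl
      ... | no _  | no _  = refl
      ... | yes p | no q  = contradiction (trans (cong rt (sym p)) (rt-c t)) q
      ... | no p  | yes q = contradiction (trans (cong c (sym q)) (ring-≡ u eq)) p
    ... | false = ∑-zero (λ t → cong (_* f t) (δ-≢ (λ p → contradiction (trans (sym eq) (trans (cong ring (sym p)) (ring-c t))) λ ())))

  prev : Fin L → Fin L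
  prev t = idx (toℕ t + (2 + k₀))

  next-prev : ∀ t → next (prev t) ≡ t
  next-prev t = trans (next-idx (toℕ t + (2 + k₀))) (trans (cong idx (sym (+-suc (toℕ t) _))) (trans (idx-per (toℕ t)) (idx-toℕ t)))

  next-inj : ∀ {s t} → next s ≡ next t → s ≡ t
  next-inj {s} {t} p = trans (sym (idx-toℕ s)) (trans (idx-cancel 1 p) (idx-toℕ t))

  ∑-core : ∀ u → sum (core u) ≡ 2 * inner u
  ∑-core u = begin-equality
    sum (core u)
      ≡⟨ ∑-* (inner u) (λ w → inner w * (δ (next (rt u)) (rt w) + δ (next (rt w)) (rt u))) ⟩
    inner u * sum (λ w → inner w * (δ (next (rt u)) (rt w) + δ (next (rt w)) (rt u)))
      ≡⟨ cong (inner u *_) (∑-ring (λ t → δ (next (rt u)) t + δ (next t) (rt u))) ⟩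
    inner u * sum (λ t → δ (next (rt u)) t + δ (next t) (rt u))
      ≡⟨ cong (inner u *_) (trans (∑-+ (δ (next (rt u))) (λ t → δ (next t) (rt u))) (cong₂ _+_ (∑-δ₁ (next (rt u))) back)) ⟩
    inner u * 2
      ≡⟨ *-comm (inner u) 2 ⟩
    2 * inner u ∎
    where
    open ≤-Reasoning
    same : ∀ t → δ (next t) (rt u) ≡ δ (prev (rt u)) t
    same t with next t ≟F rt u | prev (rt u) ≟F t
    ... | yes _ | yes _ = refl
    ... | no _  | no _  = refl
    ... | yes p | no q  = contradiction (next-inj (trans (next-prev (rt u)) (sym p))) q
    ... | no p  | yes q = contradiction (trans (cong next (sym q)) (next-prev (rt u))) p
    back : sum (λ t → δ (next t) (rt u)) ≡ 1
    back = trans (∑-cong same) (∑-δ₁ (prev (rt u)))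

  ∑-sparse : sum (sum ∘ core) + 2 * sum (λ u → pos (dep u)) ≡ 2 * suc m
  ∑-sparse = begin-equality
    sum (sum ∘ core) + 2 * sum (λ u → pos (dep u)) ≡⟨ cong (_+ 2 * sum (λ u → pos (dep u))) (trans (∑-cong ∑-core) (∑-* 2 inner)) ⟩
    2 * sum inner + 2 * sum (λ u → pos (dep u))    ≡⟨ +-comm (2 * sum inner) _ ⟩
    2 * sum (λ u → pos (dep u)) + 2 * sum inner    ≡⟨ sym (*-distribˡ-+ 2 (sum (λ u → pos (dep u))) (sum inner)) ⟩
    2 * (sum (λ u → pos (dep u)) + sum inner)      ≡⟨ cong (2 *_) ∑-outer ⟩
    2 * suc m                                      ∎
    where open ≤-Reasoning

  -- The cycle edges together with one parent edge for each other vertex are n edges.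
  degrees≥ : 2 * suc m ≤ degrees H
  degrees≥ = ≤-trans (≤-reflexive (sym ∑-sparse)) (LayeringProps.Sparse.enough lay core core≤ core-dep)

module Unicyclic {m} (H : Graph (suc m)) (conn : Connected H) {k₀} (C : Cycle H k₀)
                 (few : degrees H ≤ 2 * suc m) where

  open Ring H conn C public

  bound : degrees H ≤ sum (sum ∘ core) + 2 * sum (λ u → pos (dep u))
  bound = ≤-trans few (≤-reflexive (sym ∑-sparse))

  data Kind (u w : Fin (suc m)) : Set where
    along : dep u ≡ 0 → dep w ≡ 0 → next (rt u) ≡ rt w ⊎ next (rt w) ≡ rt u → Kind u w
    down  : Child u w → Kind u w
    upw   : Child w u → Kind u w

  kind : ∀ {u w} → Edge H u w → Kind u w
  kind {u} {w} e = go (LayeringProps.Sparse.edges lay core core≤ core-dep bound e)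
    where
    go : 1 ≤ core u w ⊎ Child u w ⊎ Child w u → Kind u w
    go (inj₁ p) = along (proj₁ (core-dep u w p)) (proj₂ (core-dep u w p)) (core-next u w p)
    go (inj₂ (inj₁ k)) = down k
    go (inj₂ (inj₂ k)) = upw k

  kids : Fin (suc m) → ℕ
  kids u = sum (ch u)

  deg≡ : ∀ u → deg H u ≡ 2 * inner u + (kids u + pos (dep u))
  deg≡ u = begin-equality
    deg H u                                                     ≡⟨ ∑-cong (λ w → sym (LayeringProps.Sparse.exact lay core core≤ core-dep bound u w)) ⟩
    sum (λ w → core u w + (ch u w + ch w u))                    ≡⟨ trans (∑-+ (core u) (λ w → ch u w + ch w u)) (cong (sum (core u) +_) (∑-+ (ch u) (λ w → ch w u))) ⟩
    sum (core u) + (kids u + sum (λ w → ch w u))                ≡⟨ cong₂ (λ a b → a + (kids u + b)) (∑-core u) (∑-ch u) ⟩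
    2 * inner u + (kids u + pos (dep u))                        ∎
    where open ≤-Reasoning

  deg-ring : ∀ t → deg H (c t) ≡ 2 + kids (c t)
  deg-ring t = trans (deg≡ (c t)) (cong₂ (λ a b → 2 * 𝟙 a + b) (ring-c t) (trans (cong (λ d → kids (c t) + pos d) (dep-c t)) (+-identityʳ _)))

  deg-off : ∀ u → 1 ≤ dep u → deg H u ≡ suc (kids u)
  deg-off u p = trans (deg≡ u) (trans (cong₂ (λ a b → 2 * a + (kids u + b)) (off p (inner-outer u)) (on p)) (+-comm (kids u) 1))
    where
    on : ∀ {d} → 1 ≤ d → pos d ≡ 1
    on (s≤s _) = refl
    off : ∀ {d b} → 1 ≤ d → pos d + b ≡ 1 → b ≡ 0
    off (s≤s _) e = suc-injective e

-- Leaves, and the trees hanging at the cycle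

module _ {n} (X : Graph n) where

  leaf : Fin n → ℕ
  leaf u = is1 (deg X u)

  leaves : ℕ
  leaves = sum leaf

  -- Marks a pendant path of two edges by its end `u` and its middle vertex `w`.
  pendant : Fin n → Fin n → ℕ
  pendant u w = A X u w * (leaf u * is2 (deg X w))

  pendants : ℕ
  pendants = sum (λ u → sum (pendant u))

  is1≤1 : ∀ d → is1 d ≤ 1
  is1≤1 0 = z≤n
  is1≤1 1 = ≤-refl
  is1≤1 (suc (suc d)) = z≤n

  leaf≤1 : ∀ u → leaf u ≤ 1
  leaf≤1 u = is1≤1 (deg X u)

  leaf-elim : ∀ {u} → 1 ≤ leaf u → deg X u ≡ 1
  leaf-elim {u} p with deg X u
  ... | 1 = refl

  leaf-intro : ∀ {u} → deg X u ≡ 1 → leaf u ≡ 1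
  leaf-intro p = cong is1 p

  is1-* : ∀ d → is1 d * d ≤ is1 d
  is1-* 0 = z≤n
  is1-* 1 = ≤-refl
  is1-* (suc (suc d)) = z≤n

  ∑-pendant : ∀ u → sum (pendant u) ≤ leaf u
  ∑-pendant u = begin
    sum (λ w → A X u w * (leaf u * is2 (deg X w)))   ≤⟨ ∑-mono (λ w → ≤-trans (*-monoʳ-≤ (A X u w) (≤-trans (*-monoʳ-≤ (leaf u) (is2≤1 (deg X w))) (≤-reflexive (*-identityʳ (leaf u))))) (≤-reflexive (*-comm (A X u w) (leaf u)))) ⟩
    sum (λ w → leaf u * A X u w)                     ≡⟨ ∑-* (leaf u) (A X u) ⟩
    leaf u * deg X u                                 ≤⟨ is1-* (deg X u) ⟩
    leaf u                                           ∎
    where open ≤-Reasoning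

δ-case : ∀ {n} {i j : Fin n} (P : ℕ → Set) → (i ≡ j → P 1) → (i ≢ j → P 0) → P (δ i j)
δ-case {i = i} {j} P y n with i ≟F j
... | yes p = y p
... | no p  = n p

pos-positive : ∀ {d} → 1 ≤ d → pos d ≡ 1
pos-positive (s≤s _) = refl

*-positive : ∀ a b → 1 ≤ a * b → 1 ≤ a × 1 ≤ b
*-positive (suc a) (suc b) _ = s≤s z≤n , s≤s z≤n
*-positive (suc a) zero    p = contradiction (subst (1 ≤_) (*-zeroʳ a) p) λ ()

module Hanging {m} (H : Graph (suc m)) (conn : Connected H) {k₀} (C : Cycle H k₀)
               (few : degrees H ≤ 2 * suc m) where

  open Unicyclic H conn C few public

  V : Set
  V = Fin (suc m)

  size leafs pends offs : Fin L → ℕ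
  size  j = sum (λ u → δ (rt u) j)
  leafs j = sum (λ u → δ (rt u) j * leaf H u)
  pends j = sum (λ u → δ (rt u) j * sum (pendant H u))
  offs  j = sum (λ u → δ (rt u) j * (pos (dep u) * (1 ∸ leaf H u)))

  abstract
    height : Fin L → ℕ
    height j = δ (rt (proj₁ (argmax (λ u → δ (rt u) j * dep u)))) j * dep (proj₁ (argmax (λ u → δ (rt u) j * dep u)))

    dep≤height : ∀ u → dep u ≤ height (rt u)
    dep≤height u = ≤-trans (≤-reflexive (sym (trans (cong (_* dep u) (δ-refl (rt u))) (*-identityˡ (dep u)))))
      (proj₂ (argmax (λ w → δ (rt w) (rt u) * dep w)) u)

    deepest : ∀ j → 1 ≤ height j → ∃ λ u → rt u ≡ j × dep u ≡ height j
    deepest j p = u , r , sym (trans (cong (λ j → δ (rt u) j * dep u) (sym r)) (trans (cong (_* dep u) (δ-refl (rt u))) (*-identityˡ (dep u))))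
      where
      u : Fin (suc m)
      u = proj₁ (argmax (λ u → δ (rt u) j * dep u))
      nz : ∀ a b → 1 ≤ a * b → 1 ≤ a
      nz (suc a) b _ = s≤s z≤n
      r : rt u ≡ j
      r = δ-elim {i = rt u} (nz (δ (rt u) j) (dep u) p)

  dep≤height′ : ∀ {u j} → rt u ≡ j → dep u ≤ height j
  dep≤height′ {u} refl = dep≤height u

  some-in : ∀ j → ∃ λ u → rt u ≡ j × dep u ≡ height j
  some-in j with height j in eq
  ... | zero = c j , rt-c j , dep-c j
  ... | suc h with deepest j (≤-trans (s≤s z≤n) (≤-reflexive (sym eq)))
  ...   | u , r , d = u , r , trans d eq

  kid : ∀ {u w} → Child u w → 1 ≤ kids u
  kid {u} {w} k = ≤-trans (≤-reflexive (sym (ch-intro k))) (term≤∑ (ch u) w)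

  deepest-kids : ∀ u → dep u ≡ height (rt u) → kids u ≡ 0
  deepest-kids u p = n≤0⇒n≡0 (≮⇒≥ λ lt → impossible (∑-pos (ch u) lt))
    where
    impossible : (∃ λ w → 1 ≤ ch u w) → ⊥
    impossible (w , q) = 1+n≰n (≤-trans (≤-reflexive (trans (cong suc (sym p)) (sym (child-dep k))))
        (dep≤height′ (rt-child k)))
      where
      k : Child u w
      k = ch-elim q

  deepest-leaf : ∀ u → 1 ≤ dep u → dep u ≡ height (rt u) → deg H u ≡ 1
  deepest-leaf u p q = trans (deg-off u p) (cong suc (deepest-kids u q))

  ring-not-leaf : ∀ t → leaf H (c t) ≡ 0
  ring-not-leaf t = cong is1 (deg-ring t)

  dep0-not-leaf : ∀ u → dep u ≡ 0 → leaf H u ≡ 0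
  dep0-not-leaf u p = trans (cong (leaf H) (sym (c-rt-0 u p))) (ring-not-leaf (rt u))

  leaf-dep : ∀ u → 1 ≤ leaf H u → 1 ≤ dep u
  leaf-dep u p with dep u in eq
  ... | zero  = contradiction (≤-trans p (≤-reflexive (dep0-not-leaf u eq))) λ ()
  ... | suc d = s≤s z≤n

  leaf-kids : ∀ u → 1 ≤ leaf H u → kids u ≡ 0
  leaf-kids u p = suc-injective (trans (sym (deg-off u (leaf-dep u p))) (leaf-elim H p))

  -- The root is not a leaf, since its degree is at least 2; every other vertex is a leaf or is
  -- counted in `offs`.
  parts : ∀ j → size j ≡ 1 + leafs j + offs j
  parts j = begin-equality
    sum (λ u → δ (rt u) j)
      ≡⟨ ∑-cong split ⟩
    sum (λ u → (δ (c j) u + δ (rt u) j * leaf H u) + δ (rt u) j * (pos (dep u) * (1 ∸ leaf H u)))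
      ≡⟨ ∑-+ (λ u → δ (c j) u + δ (rt u) j * leaf H u) (λ u → δ (rt u) j * (pos (dep u) * (1 ∸ leaf H u))) ⟩
    sum (λ u → δ (c j) u + δ (rt u) j * leaf H u) + offs j
      ≡⟨ cong (_+ offs j) (trans (∑-+ (δ (c j)) (λ u → δ (rt u) j * leaf H u)) (cong (_+ leafs j) (∑-δ₁ (c j)))) ⟩
    1 + leafs j + offs j ∎
    where
    open ≤-Reasoning
    lv : ∀ l → l ≤ 1 → l + 1 * (1 ∸ l) ≡ 1
    lv 0 _ = refl
    lv 1 _ = refl
    lv (suc (suc l)) (s≤s ())
    at-root : ∀ u → rt u ≡ j → Dec (1 ≤ dep u) → 1 ≡ (δ (c j) u + 1 * leaf H u) + 1 * (pos (dep u) * (1 ∸ leaf H u))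
    at-root u r (yes p) = sym (trans (cong₂ (λ a b → a + 1 * leaf H u + 1 * (b * (1 ∸ leaf H u)))
        (δ-≢ {i = c j} (λ q → contradiction (≤-trans p (≤-reflexive (trans (cong dep (sym q)) (dep-c j)))) λ ())) (pos-positive p))
      (trans (cong₂ _+_ (*-identityˡ (leaf H u)) (*-identityˡ (1 * (1 ∸ leaf H u)))) (lv (leaf H u) (leaf≤1 H u))))
    at-root u r (no p) = sym (trans (cong₂ (λ a b → a + 1 * b + 1 * (pos (dep u) * (1 ∸ b)))
        (trans (cong (λ w → δ w u) (trans (cong c (sym r)) (c-rt-0 u d0))) (δ-refl u)) (dep0-not-leaf u d0))
      (cong (λ d → 1 + 1 * (pos d * 1)) d0))
      where
      d0 : dep u ≡ 0
      d0 = n<1⇒n≡0 (≰⇒> p)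
    split : ∀ u → δ (rt u) j ≡ (δ (c j) u + δ (rt u) j * leaf H u) + δ (rt u) j * (pos (dep u) * (1 ∸ leaf H u))
    split u = δ-case (λ x → x ≡ (δ (c j) u + x * leaf H u) + x * (pos (dep u) * (1 ∸ leaf H u)))
      (λ r → at-root u r (1 ≤? dep u))
      (λ r≢j → sym (trans (+-identityʳ _) (trans (+-identityʳ _) (δ-≢ (λ p → r≢j (trans (cong rt (sym p)) (rt-c j)))))))

  pends≤leafs : ∀ j → pends j ≤ leafs j
  pends≤leafs j = ∑-mono (λ u → *-monoʳ-≤ (δ (rt u) j) (∑-pendant H u))

  in-leafs : ∀ {u j} → rt u ≡ j → deg H u ≡ 1 → 1 ≤ δ (rt u) j * leaf H u
  in-leafs {u} refl p = ≤-reflexive (sym (cong₂ _*_ (δ-refl (rt u)) (leaf-intro H p)))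

  module Tall (j : Fin L) {h} (hj : height j ≡ suc h) where

    tip : V
    tip = proj₁ (deepest j (≤-trans (s≤s z≤n) (≤-reflexive (sym hj))))

    rt-tip : rt tip ≡ j
    rt-tip = proj₁ (proj₂ (deepest j (≤-trans (s≤s z≤n) (≤-reflexive (sym hj)))))

    dep-tip : dep tip ≡ suc h
    dep-tip = trans (proj₂ (proj₂ (deepest j (≤-trans (s≤s z≤n) (≤-reflexive (sym hj)))))) hj

    1≤dep-tip : 1 ≤ dep tip
    1≤dep-tip = ≤-trans (s≤s z≤n) (≤-reflexive (sym dep-tip))

    tip-leaf : deg H tip ≡ 1
    tip-leaf = deepest-leaf tip 1≤dep-tip (trans dep-tip (trans (sym hj) (cong height (sym rt-tip))))

    some-leaf : 1 ≤ leafs j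
    some-leaf = ≤-trans (in-leafs rt-tip tip-leaf) (term≤∑ (λ u → δ (rt u) j * leaf H u) tip)

    stem : ∀ (i : Fin h) → V
    stem i = up (suc (toℕ i)) tip

    stem≤ : ∀ (i : Fin h) → suc (toℕ i) ≤ dep tip
    stem≤ i = ≤-trans (toℕ<n i) (≤-trans (n≤1+n h) (≤-reflexive (sym dep-tip)))

    stem-dep : ∀ i → dep (stem i) + suc (toℕ i) ≡ suc h
    stem-dep i = trans (up-dep (suc (toℕ i)) tip (stem≤ i)) dep-tip

    1≤stem-dep : ∀ i → 1 ≤ dep (stem i)
    1≤stem-dep i = +-cancelʳ-≤ (suc (toℕ i)) 1 _ (≤-trans (s≤s (toℕ<n i)) (≤-reflexive (sym (stem-dep i))))

    up-child : ∀ i u → suc i ≤ dep u → Child (up (suc i) u) (up i u)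
    up-child zero    u p = par-child u p
    up-child (suc i) u p = up-child i (par u) (s≤s⁻¹ (≤-trans p (≤-reflexive (sym (par-dep u (≤-trans (s≤s z≤n) p))))))

    stem-not-leaf : ∀ i → leaf H (stem i) ≡ 0
    stem-not-leaf i = trans (cong is1 (deg-off (stem i) (1≤stem-dep i))) (zero-leaf (kid (up-child (toℕ i) tip (stem≤ i))))
      where
      zero-leaf : ∀ {k} → 1 ≤ k → is1 (suc k) ≡ 0
      zero-leaf (s≤s _) = refl

    -- The ancestors of a deepest vertex strictly between it and the cycle lie at different depths
    -- and have children.
    many-offs : h ≤ offs j
    many-offs = ≤-trans (≤-reflexive (sym (∑-1 h)))
      (∑-inj stem (λ _ → 1) (λ u → δ (rt u) j * (pos (dep u) * (1 ∸ leaf H u))) (λ _ → ≤-refl)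
        (λ i i′ _ _ p → toℕ-injective (suc-injective (+-cancelˡ-≡ (dep (stem i)) _ _ (trans (stem-dep i) (trans (sym (stem-dep i′)) (cong (λ u → dep u + suc (toℕ i′)) (sym p)))))))
        (λ i _ → ≤-reflexive (sym (cong₂ _*_ (trans (cong (λ r → δ r j) (trans (rt-up (suc (toℕ i)) tip (stem≤ i)) rt-tip)) (δ-refl j))
          (cong₂ _*_ (positive (1≤stem-dep i)) (cong (1 ∸_) (stem-not-leaf i)))))))
      where
      positive : ∀ {d} → 1 ≤ d → pos d ≡ 1
      positive (s≤s _) = refl

  shape-bare : ∀ j → height j ≡ 0 → size j ≡ 1 × leafs j ≡ 0 × pends j ≡ 0 × offs j ≡ 0
  shape-bare j p = s , ql , n≤0⇒n≡0 (≤-trans (pends≤leafs j) (≤-reflexive ql)) , ol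
    where
    flat : ∀ u → rt u ≡ j → dep u ≡ 0
    flat u r = n≤0⇒n≡0 (≤-trans (dep≤height′ r) (≤-reflexive p))
    ql : leafs j ≡ 0
    ql = ∑-zero z
      where
      z : ∀ u → δ (rt u) j * leaf H u ≡ 0
      z u = δ-case (λ x → x * leaf H u ≡ 0) (λ r → trans (+-identityʳ _) (dep0-not-leaf u (flat u r))) (λ _ → refl)
    ol : offs j ≡ 0
    ol = ∑-zero z
      where
      z : ∀ u → δ (rt u) j * (pos (dep u) * (1 ∸ leaf H u)) ≡ 0
      z u = δ-case (λ x → x * (pos (dep u) * (1 ∸ leaf H u)) ≡ 0) (λ r → trans (+-identityʳ _) (cong (λ d → pos d * (1 ∸ leaf H u)) (flat u r))) (λ _ → refl)
    s : size j ≡ 1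
    s = trans (parts j) (cong₂ (λ a b → 1 + a + b) ql ol)

  -- A leaf at depth 1 hangs at a cycle vertex, whose degree is at least 3, so it ends no pendant
  -- path.
  shape-star : ∀ j → height j ≡ 1 → pends j ≡ 0 × offs j ≡ 0
  shape-star j hj = ∑-zero z , ∑-zero o
    where
    deep : ∀ {u} → rt u ≡ j → 1 ≤ dep u → dep u ≡ 1
    deep r p = ≤-antisym (≤-trans (dep≤height′ r) (≤-reflexive hj)) p
    allleaf : ∀ {u} → rt u ≡ j → 1 ≤ dep u → leaf H u ≡ 1
    allleaf {u} r p = leaf-intro H (deepest-leaf u p (trans (deep r p) (trans (sym hj) (cong height (sym r)))))
    o : ∀ u → δ (rt u) j * (pos (dep u) * (1 ∸ leaf H u)) ≡ 0
    o u = δ-case (λ x → x * (pos (dep u) * (1 ∸ leaf H u)) ≡ 0) (λ r → trans (+-identityʳ _) (pick r (1 ≤? dep u))) (λ _ → refl)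
      where
      pick : rt u ≡ j → Dec (1 ≤ dep u) → pos (dep u) * (1 ∸ leaf H u) ≡ 0
      pick r (no p)  = cong (λ d → pos d * (1 ∸ leaf H u)) (n<1⇒n≡0 (≰⇒> p))
      pick r (yes p) = trans (cong (λ l → pos (dep u) * (1 ∸ l)) (allleaf r p)) (*-zeroʳ (pos (dep u)))
    z : ∀ u → δ (rt u) j * sum (pendant H u) ≡ 0
    z u = δ-case (λ x → x * sum (pendant H u) ≡ 0) (λ r → trans (+-identityʳ _) (∑-zero (pz r))) (λ _ → refl)
      where
      pz : rt u ≡ j → ∀ w → pendant H u w ≡ 0
      pz r w = n≤0⇒n≡0 (≮⇒≥ λ lt → impossible (adj-of lt) (proj₁ (factors lt)) (proj₂ (factors lt)))
        where
        adj-of : 1 ≤ pendant H u w → Edge H u w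
        adj-of q = edge-A H (proj₁ (*-positive (A H u w) _ q))
        factors : 1 ≤ pendant H u w → 1 ≤ leaf H u × 1 ≤ is2 (deg H w)
        factors q = *-positive (leaf H u) _ (proj₂ (*-positive (A H u w) _ q))
        impossible : Edge H u w → 1 ≤ leaf H u → 1 ≤ is2 (deg H w) → ⊥
        impossible e lu two = go (kind e)
          where
          no2 : ∀ {k} → 1 ≤ k → ¬ 1 ≤ is2 (2 + k)
          no2 (s≤s _) ()
          go : Kind u w → ⊥
          go (along d0 _ _) = contradiction (≤-trans (leaf-dep u lu) (≤-reflexive d0)) λ ()
          go (down k) = contradiction (≤-trans (kid k) (≤-reflexive (leaf-kids u lu))) λ ()
          go (upw k) = no2 (kid k) (≤-trans two (≤-reflexive (cong is2 (trans (cong (deg H) (sym w≡)) (trans (deg-ring (rt w)) (cong (λ v → 2 + kids v) w≡))))))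
            where
            w≡ : c (rt w) ≡ w
            w≡ = c-rt-0 w (suc-injective (trans (sym (child-dep k)) (deep r (leaf-dep u lu))))

  -- The parent of a deepest leaf lies off the cycle. Either its degree is 2 and the leaf ends a
  -- pendant path, or it has another child, which is again a deepest leaf.
  tall-pends : ∀ j {h} → height j ≡ suc (suc h) → 2 ≤ leafs j + pends j
  tall-pends j {h} hj = decide (deg H w ≟ 2)
    where
    open Tall j hj
    w : V
    w = par tip
    dep-w : dep w ≡ suc h
    dep-w = suc-injective (trans (par-dep tip 1≤dep-tip) dep-tip)
    1≤dep-w : 1 ≤ dep w
    1≤dep-w = ≤-trans (s≤s z≤n) (≤-reflexive (sym dep-w))
    decide : Dec (deg H w ≡ 2) → 2 ≤ leafs j + pends j
    decide (yes two) = +-mono-≤ some-leaf (≤-trans tip-pair (term≤∑ (λ u → δ (rt u) j * sum (pendant H u)) tip))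
      where
      tip-pair : 1 ≤ δ (rt tip) j * sum (pendant H tip)
      tip-pair = ≤-trans (≤-trans (≤-reflexive (sym (cong₂ _*_ (A-edge H (par-edge tip 1≤dep-tip)) (cong₂ _*_ (leaf-intro H tip-leaf) (cong is2 two)))))
        (term≤∑ (pendant H tip) w)) (≤-reflexive (sym (trans (cong (_* sum (pendant H tip)) (trans (cong (λ r → δ r j) rt-tip) (δ-refl j))) (*-identityˡ (sum (pendant H tip))))))
    decide (no ¬two) = ≤-trans (∑-two (λ u → δ (rt u) j * leaf H u) (proj₁ (proj₂ another) ∘ sym) (in-leafs rt-tip tip-leaf) (in-leafs rt-u′ leaf-u′)) (m≤m+n _ _)
      where
      2≤kids : 2 ≤ kids w
      2≤kids = ≤∧≢⇒< (kid (par-child tip 1≤dep-tip)) (λ p → ¬two (trans (deg-off w 1≤dep-w) (cong suc (sym p))))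
      another : ∃ λ u′ → u′ ≢ tip × 1 ≤ ch w u′
      another = ∑-another (ch w) (ch≤1 w) 2≤kids tip
      u′ : V
      u′ = proj₁ another
      k′ : Child w u′
      k′ = ch-elim (proj₂ (proj₂ another))
      rt-u′ : rt u′ ≡ j
      rt-u′ = trans (rt-child k′) (trans (sym (rt-child (par-child tip 1≤dep-tip))) rt-tip)
      dep-u′ : dep u′ ≡ suc (suc h)
      dep-u′ = trans (child-dep k′) (cong suc dep-w)
      leaf-u′ : deg H u′ ≡ 1
      leaf-u′ = deepest-leaf u′ (≤-trans (s≤s z≤n) (≤-reflexive (sym dep-u′))) (trans dep-u′ (trans (sym hj) (cong height (sym rt-u′))))

  reshape : ∀ {t q z h o t′ q′ z′ h′ o′} → t ≡ t′ → q ≡ q′ → z ≡ z′ → h ≡ h′ → o ≡ o′ → Shape t q z h o → Shape t′ q′ z′ h′ o′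
  reshape refl refl refl refl refl s = s

  shape : ∀ j → Shape (size j) (leafs j) (pends j) (height j) (offs j)
  shape j = go (height j) refl
    where
    go : ∀ h → height j ≡ h → Shape (size j) (leafs j) (pends j) (height j) (offs j)
    go zero p = reshape (sym (proj₁ b)) (sym (proj₁ (proj₂ b))) (sym (proj₁ (proj₂ (proj₂ b)))) (sym p) (sym (proj₂ (proj₂ (proj₂ b)))) bare
      where
      b = shape-bare j p
    go (suc zero) p = one (leafs j) refl (Tall.some-leaf j p)
      where
      one : ∀ q → leafs j ≡ q → 1 ≤ q → Shape (size j) (leafs j) (pends j) (height j) (offs j)
      one (suc q) e _ = reshape (sym (trans (parts j) (trans (cong₂ (λ a b → 1 + a + b) e (proj₂ (shape-star j p))) (cong (2 +_) (+-identityʳ q)))))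
        (sym e) (sym (proj₁ (shape-star j p))) (sym p) (sym (proj₂ (shape-star j p))) (star q)
    go (suc (suc h)) p = two (leafs j) refl (Tall.some-leaf j p)
      where
      two : ∀ q → leafs j ≡ q → 1 ≤ q → Shape (size j) (leafs j) (pends j) (height j) (offs j)
      two (suc q) e _ = reshape (sym (trans (parts j) (cong (λ q → 1 + q + offs j) e))) (sym e) refl (sym p) refl
        (tall q (pends j) h (offs j) (Tall.many-offs j p)
          (≤-trans (pends≤leafs j) (≤-reflexive e)) (s≤s⁻¹ (≤-trans (tall-pends j p) (≤-reflexive (cong (_+ pends j) e)))))

  kids-size : ∀ j → 1 + kids (c j) ≤ size j
  kids-size j = ≤-trans (≤-reflexive (sym (trans (∑-+ (δ (c j)) (ch (c j))) (cong (_+ kids (c j)) (∑-δ₁ (c j)))))) (∑-mono le)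
    where
    le : ∀ u → δ (c j) u + ch (c j) u ≤ δ (rt u) j
    le u = go (1 ≤? ch (c j) u)
      where
      go : Dec (1 ≤ ch (c j) u) → δ (c j) u + ch (c j) u ≤ δ (rt u) j
      go (yes p) = ≤-trans (+-mono-≤ (≤-reflexive (δ-≢ {i = c j} (λ e → contradiction (trans (sym (child-dep k)) (trans (cong dep (sym e)) (dep-c j))) λ ()))) (ch≤1 (c j) u))
          (≤-reflexive (sym (trans (cong (λ r → δ r j) (trans (rt-child k) (rt-c j))) (δ-refl j))))
        where
        k : Child (c j) u
        k = ch-elim p
      go (no p) = ≤-trans (+-monoʳ-≤ (δ (c j) u) (≤-reflexive (n<1⇒n≡0 (≰⇒> p)))) (≤-trans (≤-reflexive (+-identityʳ _))
        (δ-case {i = c j} {u} (λ x → x ≤ δ (rt u) j) (λ e → ≤-reflexive (sym (trans (cong (λ r → δ r j) (trans (cong rt (sym e)) (rt-c j))) (δ-refl j)))) (λ _ → z≤n)))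

  some-kid : ∀ j {h} → height j ≡ suc h → ∃ λ u → Child (c j) u
  some-kid j {h} hj = up h tip , subst (λ w → Child w (up h tip)) root (up-child h tip (≤-reflexive (sym dep-tip)))
    where
    open Tall j hj
    h≤ : suc h ≤ dep tip
    h≤ = ≤-reflexive (sym dep-tip)
    root : up (suc h) tip ≡ c j
    root = trans (sym (c-rt-0 _ (+-cancelʳ-≡ (suc h) _ 0 (trans (up-dep (suc h) tip h≤) dep-tip))))
      (cong c (trans (rt-up (suc h) tip h≤) rt-tip))

  kids-bare : ∀ j → is0 (kids (c j)) ≡ is0 (height j)
  kids-bare j = go (height j) refl
    where
    go : ∀ h → height j ≡ h → is0 (kids (c j)) ≡ is0 (height j)
    go zero e = trans (cong is0 (deepest-kids (c j) (trans (dep-c j) (trans (sym e) (cong height (sym (rt-c j))))))) (sym (cong is0 e))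
    go (suc h) e = trans (not0 (kid (proj₂ (some-kid j e)))) (sym (cong is0 e))
      where
      not0 : ∀ {k} → 1 ≤ k → is0 k ≡ 0
      not0 (s≤s _) = refl

  lone-kid : ∀ j {u} → Child (c j) u → kids (c j) ≤ 1 → kids u ≡ 0 → size j ≡ 2
  lone-kid j {u} k one nil = ≤-antisym
      (≤-trans (∑-mono only) (≤-reflexive (trans (∑-+ (δ (c j)) (δ u)) (cong₂ _+_ (∑-δ₁ (c j)) (∑-δ₁ u)))))
      (≤-trans (s≤s (kid k)) (kids-size j))
    where
    same : ∀ {w} → Child (c j) w → w ≡ u
    same {w} k′ = go (w ≟F u)
      where
      go : Dec (w ≡ u) → w ≡ u
      go (yes e) = e
      go (no ne) = contradiction (≤-trans (∑-two (ch (c j)) ne (≤-reflexive (sym (ch-intro k′))) (≤-reflexive (sym (ch-intro k)))) one) 1+n≰n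
    first : ∀ {w} → rt w ≡ j → dep w ≡ 1 → w ≡ u
    first {w} r d = same (subst (λ z → Child z w) root (par-child w (≤-reflexive (sym d))))
      where
      root : par w ≡ c j
      root = trans (sym (c-rt-0 _ (suc-injective (trans (par-dep w (≤-reflexive (sym d))) d)))) (cong c (trans (sym (rt-child (par-child w (≤-reflexive (sym d))))) r))
    second : ∀ {w} → rt w ≡ j → dep w ≡ 2 → ⊥
    second {w} r d = 1+n≰n (≤-trans (kid (subst (λ z → Child z w) (first (trans (sym (rt-child k′)) r) (suc-injective (trans (par-dep w 1≤) d))) k′)) (≤-reflexive nil))
      where
      1≤ : 1 ≤ dep w
      1≤ = ≤-trans (s≤s z≤n) (≤-reflexive (sym d))
      k′ : Child (par w) w
      k′ = par-child w 1≤
    cases : ∀ w → rt w ≡ j → ∀ d → dep w ≡ d → 1 ≤ δ (c j) w + δ u w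
    cases w r 0 d = ≤-trans (≤-reflexive (sym (trans (cong (λ z → δ z w) (trans (cong c (sym r)) (c-rt-0 w d))) (δ-refl w)))) (m≤m+n _ _)
    cases w r 1 d = ≤-trans (≤-reflexive (sym (trans (cong (λ z → δ z w) (sym (first r d))) (δ-refl w)))) (m≤n+m _ (δ (c j) w))
    cases w r (suc (suc d)) e = ⊥-elim (second (trans (rt-up d w d≤) r) (+-cancelʳ-≡ d _ 2 (trans (up-dep d w d≤) e)))
      where
      d≤ : d ≤ dep w
      d≤ = ≤-trans (≤-trans (n≤1+n d) (n≤1+n (suc d))) (≤-reflexive (sym e))
    only : ∀ w → δ (rt w) j ≤ δ (c j) w + δ u w
    only w = δ-case {i = rt w} {j} (λ x → x ≤ δ (c j) w + δ u w) (λ r → cases w r (dep w) refl) (λ _ → z≤n)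

  ∑-parts : ∀ (g : Fin (suc m) → ℕ) → sum (λ j → sum (λ u → δ (rt u) j * g u)) ≡ sum g
  ∑-parts g = trans (∑-comm (λ j u → δ (rt u) j * g u))
    (∑-cong (λ u → trans (∑-*ʳ (g u) (δ (rt u))) (trans (cong (_* g u) (∑-δ₁ (rt u))) (*-identityˡ (g u)))))

  ∑-size : sum size ≡ suc m
  ∑-size = trans (∑-comm (λ j u → δ (rt u) j)) (trans (∑-cong (λ u → ∑-δ₁ (rt u))) (∑-1 (suc m)))

-- Distances in the opened cycle against distances in the tree

module Compare {m} (G H : Graph (suc m)) (connG : Connected G) (fewG : degrees G ≤ 2 * m)
               (connH : Connected H) {k₀} (C : Cycle H k₀) (fewH : degrees H ≤ 2 * suc m) where

  module T = Tree G connG fewG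
  open Hanging H connH C fewH public

  hN tN : ℕ → ℕ
  hN v = height (idx v)
  tN v = size (idx v)

  L′ : ℕ
  L′ = 2 + k₀

  -- Modulo `L`, adding `L′ ∸ j` means going back by `1 + j`. Both maxima go all the way round: at
  -- `j = L′` each reads the tree at `v` itself, whose contribution is 0 once `low′` is known.
  reachR reachL : ℕ → ℕ
  reachR v = maxTo L (λ j → hN (v + suc j) ∸ j)
  reachL v = maxTo L (λ j → hN (v + (L′ ∸ j)) ∸ j)

  module Card {y x} (M : Match H G y x) (v : ℕ) (cv : c (idx v) ≡ y) where
    open Match M

    q : V → ℕ
    q u = rel v (rt u)

    q<L : ∀ u → q u < L
    q<L u = rel<L v (rt u)

    rt-q : ∀ u → idx (v + q u) ≡ rt u
    rt-q u = idx-rel v (rt u)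

    q-c : ∀ p → p < L → q (c (idx (v + p))) ≡ p
    q-c p p<L = trans (cong (rel v) (rt-c _)) (rel-idx v p p<L)

    q-0 : ∀ {u} → q u ≡ 0 → rt u ≡ idx v
    q-0 {u} = rel-0 v (rt u)

    q-pos : ∀ {u} → dep u ≡ 0 → u ≢ y → 1 ≤ q u
    q-pos {u} d u≢y = n≢0⇒n>0 (λ z → u≢y (trans (sym (c-rt-0 u d)) (trans (cong c (q-0 z)) cv)))

    -- The only step that does not increase the position is the one from the last position back to
    -- `y`, and `1 ≤ q w` excludes it.
    q-next : ∀ {u w} → next (rt u) ≡ rt w → 1 ≤ q w → q w ≡ suc (q u)
    q-next {u} {w} e 1≤ = go (suc (q u) <? L)
      where
      rw : rt w ≡ idx (v + suc (q u))
      rw = trans (sym e) (trans (cong next (sym (rt-q u))) (trans (next-idx _) (cong idx (sym (+-suc v (q u))))))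
      go : Dec (suc (q u) < L) → q w ≡ suc (q u)
      go (yes lt) = trans (cong (rel v) rw) (rel-idx v (suc (q u)) lt)
      go (no ge) = contradiction (≤-trans 1≤ (≤-reflexive (trans (cong (rel v) (trans rw (trans (cong (λ z → idx (v + z)) full) (trans (idx-per v) (cong idx (sym (+-identityʳ v))))))) (rel-idx v 0 (s≤s z≤n))))) λ ()
        where
        full : suc (q u) ≡ L
        full = ≤-antisym (q<L u) (≮⇒≥ ge)

    -- An offset at least as large as every depth, which keeps the truncated subtraction in
    -- `reading` exact.
    K : ℕ
    K = sum dep

    dep≤K : ∀ u → dep u ≤ K
    dep≤K = term≤∑ dep

    -- position along the opened cycle, trees up to position p pointing backwards and later ones forwards
    reading : ℕ → V → ℕ
    reading p u with q u ≤? p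
    ... | yes _ = K + q u ∸ dep u
    ... | no _  = K + q u + dep u

    reading-≤ : ∀ p u → q u ≤ p → reading p u ≡ K + q u ∸ dep u
    reading-≤ p u le with q u ≤? p
    ... | yes _ = refl
    ... | no ¬p = contradiction le ¬p

    reading-> : ∀ p u → p < q u → reading p u ≡ K + q u + dep u
    reading-> p u lt with q u ≤? p
    ... | yes le = contradiction lt (≤⇒≯ le)
    ... | no _ = refl

    reading-0 : ∀ p u → dep u ≡ 0 → reading p u ≡ K + q u
    reading-0 p u d with q u ≤? p
    ... | yes _ = cong (K + q u ∸_) d
    ... | no _  = trans (cong (K + q u +_) d) (+-identityʳ _)

    lip-child : ∀ p {u w} → Child u w → reading p u ≤ suc (reading p w) × reading p w ≤ suc (reading p u)
    lip-child p {u} {w} k = go (q u ≤? p)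
      where
      qq : q w ≡ q u
      qq = cong (rel v) (rt-child k)
      dd : dep w ≡ suc (dep u)
      dd = child-dep k
      a≤ : ∀ a d → a ∸ d ≤ suc (a ∸ suc d)
      a≤ zero    zero    = z≤n
      a≤ zero    (suc d) = z≤n
      a≤ (suc a) zero    = ≤-refl
      a≤ (suc a) (suc d) = a≤ a d
      go : Dec (q u ≤ p) → reading p u ≤ suc (reading p w) × reading p w ≤ suc (reading p u)
      go (yes le) rewrite reading-≤ p u le | reading-≤ p w (subst (_≤ p) (sym qq) le) | qq | dd =
        a≤ (K + q u) (dep u) , ≤-trans (∸-monoʳ-≤ (K + q u) (n≤1+n (dep u))) (n≤1+n _)
      go (no gt) rewrite reading-> p u (≰⇒> gt) | reading-> p w (subst (p <_) (sym qq) (≰⇒> gt)) | qq | dd =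
        ≤-trans (+-monoʳ-≤ (K + q u) (n≤1+n (dep u))) (n≤1+n _) , ≤-reflexive (+-suc (K + q u) (dep u))

    lip : ∀ p {u w} → u ≢ y → w ≢ y → Edge H u w → reading p u ≤ suc (reading p w)
    lip p {u} {w} u≢ w≢ e = go (kind e)
      where
      go : Kind u w → reading p u ≤ suc (reading p w)
      go (down k) = proj₁ (lip-child p k)
      go (upw k) = proj₂ (lip-child p k)
      go (along du dw (inj₁ n)) rewrite reading-0 p u du | reading-0 p w dw | q-next {u} {w} n (q-pos dw w≢) =
        ≤-trans (n≤1+n _) (≤-trans (≤-reflexive (sym (+-suc K (q u)))) (n≤1+n _))
      go (along du dw (inj₂ n)) rewrite reading-0 p u du | reading-0 p w dw | q-next {w} {u} n (q-pos du u≢) =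
        ≤-reflexive (+-suc K (q w))

    not-below : ∀ {u} → 1 ≤ q u → ¬ Anc y u
    not-below {u} 1≤ (_ , e) = contradiction (≤-trans 1≤ (≤-reflexive (trans (cong (rel v) r) (trans (cong (rel v ∘ idx) (sym (+-identityʳ v))) (rel-idx v 0 (s≤s z≤n)))))) λ ()
      where
      dy : dep y ≡ 0
      dy = trans (cong dep (sym cv)) (dep-c _)
      r : rt u ≡ idx v
      r = c-inj (trans (c-rt u) (trans (cong (λ d → up (dep u ∸ d) u) (sym dy)) (trans e (sym cv))))

    to-ring : ∀ u → 1 ≤ q u → Way H y (dep u) u (c (idx (v + q u)))
    to-ring u 1≤ = subst (Way H y (dep u) u) (trans (sym (c-rt u)) (cong c (sym (rt-q u)))) (climb (dep u) u refl (not-below 1≤))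

    ring-≢ : ∀ p → 1 ≤ p → p < L → c (idx (v + p)) ≢ y
    ring-≢ p 1≤ p<L e = contradiction (≤-trans 1≤ (≤-reflexive (trans (sym (q-c p p<L)) (trans (cong q (trans e (trans (sym cv) (cong (c ∘ idx) (sym (+-identityʳ v)))))) (q-c 0 (s≤s z≤n)))))) λ ()

    along-ring : ∀ p d → 1 ≤ p → p + d < L → Way H y d (c (idx (v + p))) (c (idx (v + (p + d))))
    along-ring p zero 1≤ lt = subst (λ z → Way H y 0 (c (idx (v + p))) (c (idx (v + z)))) (sym (+-identityʳ p))
      (stop (ring-≢ p 1≤ (≤-trans (s≤s (≤-reflexive (sym (+-identityʳ p)))) lt)))
    along-ring p (suc d) 1≤ lt = way-snoc (along-ring p d 1≤ (≤-trans (s≤s (+-monoʳ-≤ p (n≤1+n d))) lt))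
      (subst (λ z → Edge H (c (idx (v + (p + d)))) (c (idx z))) (trans (sym (+-suc v (p + d))) (cong (v +_) (sym (+-suc p d)))) (ring-edge (v + (p + d))))
      (ring-≢ (p + suc d) (≤-trans 1≤ (m≤m+n p _)) lt)

    between : ∀ u w → 1 ≤ q u → q u ≤ q w → Way H y (dep u + ((q w ∸ q u) + dep w)) u w
    between u w 1≤ le = way-++ (to-ring u 1≤)
      (way-++ (subst (λ z → Way H y (q w ∸ q u) (c (idx (v + q u))) (c (idx (v + z)))) (m+[n∸m]≡n le)
                (along-ring (q u) (q w ∸ q u) 1≤ (≤-trans (s≤s (≤-reflexive (m+[n∸m]≡n le))) (q<L w))))
              (way-sym (to-ring w (≤-trans 1≤ le))))

    q-closed : ∀ {u w} → u ≢ y → w ≢ y → Edge H u w → 1 ≤ q u → 1 ≤ q w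
    q-closed {u} {w} u≢ w≢ e 1≤ = go (kind e)
      where
      go : Kind u w → 1 ≤ q w
      go (down k) = ≤-trans 1≤ (≤-reflexive (cong (rel v) (sym (rt-child k))))
      go (upw k) = ≤-trans 1≤ (≤-reflexive (cong (rel v) (rt-child k)))
      go (along _ dw _) = q-pos dw w≢

    in-tree : ∀ {u} → ¬ 1 ≤ q u → rt u ≡ idx v
    in-tree ¬q = q-0 (n<1⇒n≡0 (≰⇒> ¬q))

    -- `reading p` changes by at most 1 along the edges of H - y, hence its transport does so along
    -- those of G - x, and `stretch` applies.
    spread : ∀ p → ∀ {d u w} → Way H y d u w → reading p w ≤ reading p u + T.diam
    spread p {d} {u} {w} way = begin
      reading p w                               ≡⟨ cong (reading p) (sym (from-to w)) ⟩
      reading p (from (to w))                   ≤⟨ T.stretch x (reading p ∘ from) (λ a≢ b≢ e → lip p (from-≢ a≢) (from-≢ b≢) (edge-from a≢ b≢ e)) (way-match M way) ⟩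
      reading p (from (to u)) + T.dep (to u) (to w) ≤⟨ +-mono-≤ (≤-reflexive (cong (reading p) (from-to u))) (T.diam-max (to u) (to w)) ⟩
      reading p u + T.diam                      ∎
      where open ≤-Reasoning

    -- Between deepest vertices of the two trees `reading p` grows by the sum of both heights and
    -- `p′ − p`: the tree at `p` points backwards and the tree at `p′` forwards.
    pair : ∀ p p′ → 1 ≤ p → p < p′ → p′ < L → hN (v + p) + hN (v + p′) + p′ ≤ T.diam + p
    pair p p′ 1≤p p<p′ p′<L = finish
      where
      p<L : p < L
      p<L = <-trans p<p′ p′<L
      u w : V
      u = proj₁ (some-in (idx (v + p)))
      w = proj₁ (some-in (idx (v + p′)))
      qu : q u ≡ p
      qu = trans (cong (rel v) (proj₁ (proj₂ (some-in (idx (v + p)))))) (rel-idx v p p<L)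
      qw : q w ≡ p′
      qw = trans (cong (rel v) (proj₁ (proj₂ (some-in (idx (v + p′)))))) (rel-idx v p′ p′<L)
      du : dep u ≡ hN (v + p)
      du = proj₂ (proj₂ (some-in (idx (v + p))))
      dw : dep w ≡ hN (v + p′)
      dw = proj₂ (proj₂ (some-in (idx (v + p′))))
      raw : reading p w ≤ reading p u + T.diam
      raw = spread p (between u w (≤-trans 1≤p (≤-reflexive (sym qu))) (≤-trans (≤-reflexive qu) (≤-trans (<⇒≤ p<p′) (≤-reflexive (sym qw)))))
      fw : reading p w ≡ K + p′ + hN (v + p′)
      fw = trans (reading-> p w (≤-trans p<p′ (≤-reflexive (sym qw)))) (cong₂ (λ a b → K + a + b) qw dw)
      fu : reading p u + hN (v + p) ≡ K + p
      fu = trans (cong₂ _+_ (reading-≤ p u (≤-reflexive qu)) (sym du))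
             (trans (m∸n+n≡m (≤-trans (dep≤K u) (m≤m+n K (q u)))) (cong (K +_) qu))
      finish : hN (v + p) + hN (v + p′) + p′ ≤ T.diam + p
      finish = lin 8 (λ h h′ p p′ D K a b → b ⊑ a ⊕ D ∷ K ⊕ p′ ⊕ h′ ⊑ b ∷ a ⊕ h ⊑ K ⊕ p ∷ [] ⊢ h ⊕ h′ ⊕ p′ ⊑ D ⊕ p)
        (hN (v + p)) (hN (v + p′)) p p′ T.diam K (reading p u) (reading p w) raw (≤-reflexive (sym fw)) (≤-reflexive fu)

    -- The two cycle neighbours of `y`, at positions 1 and `L′`, are `L − 2` apart on the opened
    -- cycle.
    long : L ≤ T.diam + 2
    long = lin 2 (λ D k → con 2 ⊕ k ⊑ D ⊕ con 1 ∷ [] ⊢ con 3 ⊕ k ⊑ D ⊕ con 2) T.diam k₀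
      (≤-trans (m≤n+m L′ (hN (v + 1) + hN (v + L′))) (pair 1 L′ ≤-refl (s≤s (s≤s z≤n)) ≤-refl))

    -- Position 0 belongs to the tree at `y`. The extra vertex in `suc N` is `y`, which none of the
    -- `g i` is matched with.
    hanging : ∀ N (g : Fin N → V) → (∀ i → g i ≢ x) → (∀ i j → g i ≡ g j → i ≡ j) →
              (∀ i → ¬ 1 ≤ q (from (g i))) → suc N ≤ tN v
    hanging N g g≢ inj out = ≤-trans (s≤s (≤-trans (≤-reflexive (sym (∑-1 N)))
        (∑-inj (from ∘ g) (λ _ → 1) (λ u → δ (rt u) (idx v) * (1 ∸ δ y u)) (λ _ → ≤-refl)
          (λ i j _ _ e → inj i j (trans (sym (to-from (g i))) (trans (cong to e) (to-from (g j)))))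
          (λ i _ → ≤-reflexive (sym (cong₂ (λ a b → a * (1 ∸ b)) (trans (cong (λ r → δ r (idx v)) (in-tree (out i))) (δ-refl (idx v)))
             (δ-≢ (λ e → from-≢ (g≢ i) (sym e)))))))))
        (≤-reflexive whole)
      where
      whole : suc (sum (λ u → δ (rt u) (idx v) * (1 ∸ δ y u))) ≡ tN v
      whole = trans (cong (_+ sum (λ u → δ (rt u) (idx v) * (1 ∸ δ y u))) (sym (∑-δ₁ y)))
        (trans (sym (∑-+ (δ y) (λ u → δ (rt u) (idx v) * (1 ∸ δ y u)))) (∑-cong each))
        where
        ry : rt y ≡ idx v
        ry = trans (cong rt (sym cv)) (rt-c _)
        each : ∀ u → δ y u + δ (rt u) (idx v) * (1 ∸ δ y u) ≡ δ (rt u) (idx v)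
        each u = δ-case (λ a → a + δ (rt u) (idx v) * (1 ∸ a) ≡ δ (rt u) (idx v))
          (λ e → trans (cong (1 +_) (*-zeroʳ (δ (rt u) (idx v)))) (sym (trans (cong (λ r → δ r (idx v)) (trans (cong rt (sym e)) ry)) (δ-refl (idx v)))))
          (λ _ → *-identityʳ (δ (rt u) (idx v)))

    -- A representative of the component of H - y that contains the rest of the cycle.
    centre : V
    centre = c (idx (v + 1))

    q-centre : q centre ≡ 1
    q-centre = q-c 1 (s≤s (s≤s z≤n))

    from-centre : ∀ u → 1 ≤ q u → ∃ λ d → Way H y d centre u
    from-centre u 1≤ = _ , between centre u (≤-reflexive (sym q-centre)) (≤-trans (≤-reflexive q-centre) 1≤)

    node-≢ : ∀ i → i ≤ T.diam → T.level x ≢ i → T.node i ≢ x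
    node-≢ i le ne e = ne (trans (cong T.level (sym e)) (T.level-node i le))

    node-inj : ∀ {i j} → i ≤ T.diam → j ≤ T.diam → T.node i ≡ T.node j → i ≡ j
    node-inj {i} {j} p p′ e = trans (sym (T.level-node i p)) (trans (cong T.level e) (T.level-node j p′))

    level≤ : T.OnPath x → T.level x ≤ T.diam
    level≤ = proj₁

    -- A matched vertex on the longest path cuts off at least one of its two halves.
    cut : T.OnPath x → suc (T.level x) ≤ tN v ⊎ suc (T.diam ∸ T.level x) ≤ tN v
    cut on = go (T.anc? T.end₁ x (to centre))
      where
      lv : ℕ
      lv = T.level x
      lv≤ : lv ≤ T.diam
      lv≤ = level≤ on
      xn : T.node lv ≡ x
      xn = T.node-level on
      go : Dec (T.Anc T.end₁ x (to centre)) → suc lv ≤ tN v ⊎ suc (T.diam ∸ lv) ≤ tN v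
      -- The image of the component of `centre` is connected in G - x and lies below `x`, so the
      -- path nodes above `x` come from the tree at `y`. In the other case the nodes below `x` do.
      go (yes a) = inj₁ (hanging lv (T.node ∘ toℕ)
          (λ i → node-≢ (toℕ i) (i≤ i) (λ e → <⇒≢ (toℕ<n i) (sym e)))
          (λ i j e → toℕ-injective (node-inj (i≤ i) (i≤ j) e))
          (λ i 1≤ → T.node-above (toℕ i) lv (toℕ<n i) lv≤ (subst₂ (T.Anc T.end₁) (sym xn) (to-from _)
             (way-closed (T.Anc T.end₁ x) (T.below-closed T.end₁ x) (way-match M (proj₂ (from-centre _ 1≤))) a))))
        where
        i≤ : ∀ (i : Fin lv) → toℕ i ≤ T.diam
        i≤ i = ≤-trans (<⇒≤ (toℕ<n i)) lv≤
      go (no ¬a) = inj₂ (hanging (T.diam ∸ lv) (λ i → T.node (lv + suc (toℕ i)))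
          (λ i → node-≢ _ (i≤ i) (λ e → <⇒≢ (≤-trans (s≤s (m≤m+n lv (toℕ i))) (≤-reflexive (sym (+-suc lv (toℕ i))))) e))
          (λ i j e → toℕ-injective (suc-injective (+-cancelˡ-≡ lv _ _ (node-inj (i≤ i) (i≤ j) e))))
          (λ i 1≤ → subst (λ z → ¬ T.Anc T.end₁ x z) (to-from _)
             (way-closed (λ z → ¬ T.Anc T.end₁ x z) (T.above-closed T.end₁ x) (way-match M (proj₂ (from-centre _ 1≤))) ¬a)
             (subst (λ z → T.Anc T.end₁ z (T.node (lv + suc (toℕ i)))) xn (T.node-below lv (suc (toℕ i)) (i≤ i)))))
        where
        i≤ : ∀ (i : Fin (T.diam ∸ lv)) → lv + suc (toℕ i) ≤ T.diam
        i≤ i = ≤-trans (+-monoʳ-≤ lv (toℕ<n i)) (≤-reflexive (m+[n∸m]≡n lv≤))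

    -- If the longest path avoids x, it survives in the card and is covered by the reaches at y.
    covered : ¬ T.OnPath x → tN v ≤ T.diam + 1 → T.diam + 2 ≤ reachL v + reachR v + L
    covered off small = decide (1 ≤? q α)
      where
      α β : V
      α = from T.end₁
      β = from T.end₂
      joined : Way H y T.diam β α
      joined = way-match (match-sym M) (T.off-path off)
      -- Levels in G change by at most 1 along an edge and differ by `diam` at the two ends of the
      -- longest path.
      measure : ∀ {d} → Way H y d α β ⊎ Way H y d β α → T.diam ≤ d
      measure (inj₁ w) = begin
        T.diam                        ≡⟨ cong T.level (sym (to-from T.end₂)) ⟩
        T.level (to β)                ≤⟨ way-lipschitz T.level (λ _ _ e → T.dep-edge T.end₁ e) (way-sym (way-match M w)) ⟩
        T.level (to α) + _            ≡⟨ cong (_+ _) (trans (cong T.level (to-from T.end₁)) (T.dep-self T.end₁)) ⟩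
        _                             ∎
        where open ≤-Reasoning
      measure (inj₂ w) = measure (inj₁ (way-sym w))
      -- The depth of `u` is at most `reachR v` plus the distance of its root from position 1, that
      -- of `w` at most `reachL v` plus the distance of its root from position `L′`. These distances
      -- and the gap between the roots add up to `L − 2`.
      route : ∀ u w → 1 ≤ q u → q u ≤ q w → dep u + ((q w ∸ q u) + dep w) + 2 ≤ reachL v + reachR v + L
      route u w 1≤ le = lin 10 (λ a b d s t qu qw l k g →
           a ⊑ s ⊕ d ∷ b ⊑ t ⊕ l ∷ qw ⊕ t ⊑ con 2 ⊕ k ∷ s ⊕ con 1 ⊑ qu ∷ qu ⊕ g ⊑ qw ∷ [] ⊢
             a ⊕ (g ⊕ b) ⊕ con 2 ⊑ l ⊕ d ⊕ (con 3 ⊕ k))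
           (dep u) (dep w) (reachR v) (pred (q u)) (L′ ∸ q w) (q u) (q w) (reachL v) k₀ (q w ∸ q u)
           nearR nearL (≤-reflexive (m+[n∸m]≡n (s≤s⁻¹ (q<L w)))) pq (≤-reflexive (m+[n∸m]≡n le))
        where
        suc-pred-q : suc (pred (q u)) ≡ q u
        suc-pred-q = s-p 1≤
          where
          s-p : ∀ {z} → 1 ≤ z → suc (pred z) ≡ z
          s-p (s≤s _) = refl
        pq : pred (q u) + 1 ≤ q u
        pq = ≤-reflexive (trans (+-comm (pred (q u)) 1) suc-pred-q)
        nearR : dep u ≤ pred (q u) + reachR v
        nearR = ≤-trans (≤-trans (dep≤height′ {u} (trans (sym (rt-q u)) (cong (λ z → idx (v + z)) (sym suc-pred-q)))) (m≤n+m∸n (hN (v + suc (pred (q u)))) (pred (q u))))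
          (+-monoʳ-≤ (pred (q u)) (maxTo-≥ L (λ j → hN (v + suc j) ∸ j) (pred (q u)) (≤-trans (≤-reflexive suc-pred-q) (<⇒≤ (q<L u)))))
        nearL : dep w ≤ (L′ ∸ q w) + reachL v
        nearL = ≤-trans (≤-trans (dep≤height′ {w} (trans (sym (rt-q w)) (cong (λ z → idx (v + z)) (sym (m∸[m∸n]≡n (s≤s⁻¹ (q<L w))))))) (m≤n+m∸n (hN (v + (L′ ∸ (L′ ∸ q w)))) (L′ ∸ q w)))
          (+-monoʳ-≤ (L′ ∸ q w) (maxTo-≥ L (λ j → hN (v + (L′ ∸ j)) ∸ j) (L′ ∸ q w) (s≤s (m∸n≤m L′ (q w)))))
      decide : Dec (1 ≤ q α) → T.diam + 2 ≤ reachL v + reachR v + L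
      decide (yes 1≤α) = sides (≤-total (q α) (q β))
        where
        1≤β : 1 ≤ q β
        1≤β = way-closed (λ u → 1 ≤ q u) q-closed (way-sym joined) 1≤α
        sides : q α ≤ q β ⊎ q β ≤ q α → T.diam + 2 ≤ reachL v + reachR v + L
        sides (inj₁ le) = ≤-trans (+-monoˡ-≤ 2 (measure (inj₁ (between α β 1≤α le)))) (route α β 1≤α le)
        sides (inj₂ le) = ≤-trans (+-monoˡ-≤ 2 (measure (inj₂ (between β α 1≤β le)))) (route β α 1≤β le)
      -- Otherwise the whole path comes from the tree at `y`, which with `y` itself would have
      -- `diam + 2` vertices.
      decide (no ¬α) = contradiction (≤-trans (hanging (suc T.diam) (T.node ∘ toℕ) node≢ (λ i j e → toℕ-injective (node-inj (i≤ i) (i≤ j) e)) (λ i → out (toℕ i) (i≤ i))) small)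
          (λ le → 1+n≰n (≤-trans le (≤-reflexive (+-comm T.diam 1))))
        where
        i≤ : ∀ (i : Fin (suc T.diam)) → toℕ i ≤ T.diam
        i≤ i = s≤s⁻¹ (toℕ<n i)
        miss : ∀ i → i ≤ T.diam → T.node i ≢ x
        miss i le e = off (subst T.OnPath e (T.onPath-node i le))
        node≢ : ∀ i → T.node (toℕ i) ≢ x
        node≢ i = miss (toℕ i) (i≤ i)
        out : ∀ i → i ≤ T.diam → ¬ 1 ≤ q (from (T.node i))
        out zero le 1≤ = ¬α (subst (λ z → 1 ≤ q (from z)) (T.root-unique T.end₁ _ (T.level-node 0 z≤n)) 1≤)
        out (suc i) le 1≤ = out i (≤-trans (n≤1+n i) le)
          (q-closed (from-≢ (miss (suc i) le)) (from-≢ (miss i (≤-trans (n≤1+n i) le)))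
            (edge-from (miss (suc i) le) (miss i (≤-trans (n≤1+n i) le)) (edge-sym G (T.child-edge T.end₁ (T.node-suc i le)))) 1≤)

-- Leaves and pendant paths under matching

module MatchCounts {n} {X Z : Graph n} {x z} (M : Match X Z x z) where
  open Match M

  -- Both sides add the deleted vertex's edge of the opposite graph to what is common to the two
  -- cards, which avoids subtraction.
  deg-match : ∀ u → u ≢ x → deg X u + A Z (to u) z ≡ deg Z (to u) + A X u x
  deg-match u u≢x = begin-equality
    deg X u + A Z (to u) z
      ≡⟨ cong (deg X u +_) (sym (∑-δ x (λ _ → A Z (to u) z))) ⟩
    deg X u + sum (λ w → δ x w * A Z (to u) z)
      ≡⟨ sym (∑-+ (A X u) (λ w → δ x w * A Z (to u) z)) ⟩
    sum (λ w → A X u w + δ x w * A Z (to u) z)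
      ≡⟨ ∑-cong each ⟩
    sum (λ w → A Z (to u) (to w) + δ x w * A X u x)
      ≡⟨ ∑-+ (λ w → A Z (to u) (to w)) (λ w → δ x w * A X u x) ⟩
    sum (λ w → A Z (to u) (to w)) + sum (λ w → δ x w * A X u x)
      ≡⟨ cong₂ _+_ (∑-to (A Z (to u))) (∑-δ x (λ _ → A X u x)) ⟩
    deg Z (to u) + A X u x ∎
    where
    open ≤-Reasoning
    each : ∀ w → A X u w + δ x w * A Z (to u) z ≡ A Z (to u) (to w) + δ x w * A X u x
    each w = δ-case {i = x} {j = w} (λ d → A X u w + d * A Z (to u) z ≡ A Z (to u) (to w) + d * A X u x)
      (λ { refl → trans (cong (A X u x +_) (trans (*-identityˡ _) (cong (A Z (to u)) (sym to-x))))
                    (trans (+-comm (A X u x) _) (cong (A Z (to u) (to x) +_) (sym (*-identityˡ _)))) })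
      (λ x≢w → cong (_+ 0) (cong 𝟙 (adj-to u w u≢x (x≢w ∘ sym))))

  calm : ∀ u → u ≢ x → A X x u ≡ 0 → A Z z (to u) ≡ 0 → deg X u ≡ deg Z (to u)
  calm u u≢x p q = +-cancelʳ-≡ 0 _ _ (trans (cong (deg X u +_) (sym (trans (A-sym Z (to u) z) q)))
    (trans (deg-match u u≢x) (cong (deg Z (to u) +_) (trans (A-sym X u x) p))))

  data Near (u : Fin n) : Set where
    itself : x ≡ u → Near u
    next-x : A X x u ≡ 1 → Near u
    next-z : A Z z (to u) ≡ 1 → Near u
    away   : u ≢ x → deg X u ≡ deg Z (to u) → Near u

  near : ∀ u → Near u
  near u = go (x ≟F u) (A X x u) refl (A Z z (to u)) refl
    where
    one : ∀ {b} a → 𝟙 b ≡ suc a → 𝟙 b ≡ 1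
    one {true} a _ = refl
    go : Dec (x ≡ u) → ∀ a → A X x u ≡ a → ∀ b → A Z z (to u) ≡ b → Near u
    go (yes p) _ _ _ _ = itself p
    go (no p) (suc a) e _ _ = next-x (one {adj X x u} a e)
    go (no p) zero e (suc b) e′ = next-z (one {adj Z z (to u)} b e′)
    go (no p) zero e zero e′ = away (p ∘ sym) (calm u (p ∘ sym) e e′)

  -- Only `x`, its neighbours and the vertices matched with neighbours of `z` can lose the property
  -- of being a leaf.
  leaves-≤ : leaves X ≤ leaves Z + (1 + deg X x + deg Z z)
  leaves-≤ = begin
    leaves X
      ≤⟨ ∑-mono each ⟩
    sum (λ u → leaf Z (to u) + (δ x u + A X x u + A Z z (to u)))
      ≡⟨ trans (∑-+ (leaf Z ∘ to) (λ u → δ x u + A X x u + A Z z (to u)))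
           (cong₂ _+_ (∑-to (leaf Z)) (trans (∑-+ (λ u → δ x u + A X x u) (λ u → A Z z (to u)))
             (cong₂ _+_ (trans (∑-+ (δ x) (A X x)) (cong (_+ deg X x) (∑-δ₁ x))) (∑-to (A Z z))))) ⟩
    leaves Z + (1 + deg X x + deg Z z) ∎
    where
    open ≤-Reasoning
    each : ∀ u → leaf X u ≤ leaf Z (to u) + (δ x u + A X x u + A Z z (to u))
    each u = go (near u)
      where
      one : ∀ {s} → 1 ≤ s → leaf X u ≤ leaf Z (to u) + s
      one 1≤ = ≤-trans (leaf≤1 X u) (≤-trans 1≤ (m≤n+m _ (leaf Z (to u))))
      go : Near u → leaf X u ≤ leaf Z (to u) + (δ x u + A X x u + A Z z (to u))
      go (itself refl) = one (≤-trans (≤-reflexive (sym (δ-refl x))) (≤-trans (m≤m+n _ (A X x x)) (m≤m+n _ (A Z z (to x)))))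
      go (next-x e) = one (≤-trans (≤-trans (≤-reflexive (sym e)) (m≤n+m _ (δ x u))) (m≤m+n _ (A Z z (to u))))
      go (next-z e) = one (≤-trans (≤-reflexive (sym e)) (m≤n+m _ (δ x u + A X x u)))
      go (away _ e) = ≤-trans (≤-reflexive (cong is1 e)) (m≤m+n _ _)

pendants-at : ∀ {n} (X : Graph n) → Fin n → ℕ
pendants-at X w = sum (λ u → pendant X u w)

module _ {n} (X : Graph n) where

  pendants-swap : pendants X ≡ sum (pendants-at X)
  pendants-swap = ∑-comm (pendant X)

  pendant≤A : ∀ u w → pendant X u w ≤ A X u w
  pendant≤A u w = ≤-trans (*-monoʳ-≤ (A X u w) (*-mono-≤ (leaf≤1 X u) (is2≤1 (deg X w)))) (≤-reflexive (*-identityʳ _))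

  pendants-at≤2 : ∀ w → pendants-at X w ≤ 2
  pendants-at≤2 w = begin
    sum (λ u → pendant X u w)               ≤⟨ ∑-mono (λ u → ≤-trans (*-monoʳ-≤ (A X u w) (*-monoˡ-≤ (is2 (deg X w)) (leaf≤1 X u))) (≤-reflexive (trans (cong₂ _*_ (A-sym X u w) (*-identityˡ (is2 (deg X w)))) (*-comm (A X w u) (is2 (deg X w)))))) ⟩
    sum (λ u → is2 (deg X w) * A X w u)     ≡⟨ ∑-* (is2 (deg X w)) (A X w) ⟩
    is2 (deg X w) * deg X w                 ≤⟨ is2-* (deg X w) ⟩
    2                                       ∎
    where
    open ≤-Reasoning
    is2-* : ∀ d → is2 d * d ≤ 2
    is2-* 0 = z≤n
    is2-* 1 = z≤n
    is2-* 2 = ≤-refl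
    is2-* (suc (suc (suc d))) = z≤n

module PendantCounts {n} {X Z : Graph n} {x z} (M : Match X Z x z) where
  open Match M
  open MatchCounts M

  -- A pendant path is lost only if its end is `x` or if the degree of its end or middle vertex
  -- changes. A vertex is the end of at most one such path and the middle of at most two, hence the
  -- factor 3.
  pendants-≤ : pendants X ≤ pendants Z + (1 + 3 * deg X x + 3 * deg Z z)
  pendants-≤ = begin
    sum (λ u → sum (pendant X u))
      ≤⟨ ∑-mono (λ u → ∑-mono (each u)) ⟩
    sum (λ u → sum (λ w → pendant Z (to u) (to w) + (e₁ u * pendant X u w + e₂ w * pendant X u w)))
      ≡⟨ trans (∑-cong (λ u → trans (∑-+ (λ w → pendant Z (to u) (to w)) (λ w → e₁ u * pendant X u w + e₂ w * pendant X u w))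
           (cong₂ _+_ (∑-to (pendant Z (to u))) (∑-+ (λ w → e₁ u * pendant X u w) (λ w → e₂ w * pendant X u w)))))
         (trans (∑-+ (λ u → sum (pendant Z (to u))) (λ u → sum (λ w → e₁ u * pendant X u w) + sum (λ w → e₂ w * pendant X u w)))
           (cong₂ _+_ (∑-to (λ u → sum (pendant Z u))) (∑-+ (λ u → sum (λ w → e₁ u * pendant X u w)) (λ u → sum (λ w → e₂ w * pendant X u w))))) ⟩
    pendants Z + (sum (λ u → sum (λ w → e₁ u * pendant X u w)) + sum (λ u → sum (λ w → e₂ w * pendant X u w)))
      ≤⟨ +-monoʳ-≤ (pendants Z) (+-mono-≤ first second) ⟩
    pendants Z + (1 + (deg X x + deg Z z) + 2 * (deg X x + deg Z z))
      ≡⟨ cong (pendants Z +_) (≤-antisym (lin 2 (λ a b → [] ⊢ con 1 ⊕ (a ⊕ b) ⊕ 2 ⊛ (a ⊕ b) ⊑ con 1 ⊕ 3 ⊛ a ⊕ 3 ⊛ b) (deg X x) (deg Z z))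
                                         (lin 2 (λ a b → [] ⊢ con 1 ⊕ 3 ⊛ a ⊕ 3 ⊛ b ⊑ con 1 ⊕ (a ⊕ b) ⊕ 2 ⊛ (a ⊕ b)) (deg X x) (deg Z z))) ⟩
    pendants Z + (1 + 3 * deg X x + 3 * deg Z z) ∎
    where
    open ≤-Reasoning
    e₁ e₂ : Fin n → ℕ
    e₁ u = δ x u + (A X x u + A Z z (to u))
    e₂ w = A X x w + A Z z (to w)
    ∑e₂ : sum e₂ ≡ deg X x + deg Z z
    ∑e₂ = trans (∑-+ (A X x) (λ w → A Z z (to w))) (cong (deg X x +_) (∑-to (A Z z)))
    first : sum (λ u → sum (λ w → e₁ u * pendant X u w)) ≤ 1 + (deg X x + deg Z z)
    first = begin
      sum (λ u → sum (λ w → e₁ u * pendant X u w))   ≡⟨ ∑-cong (λ u → ∑-* (e₁ u) (pendant X u)) ⟩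
      sum (λ u → e₁ u * sum (pendant X u))           ≤⟨ ∑-mono (λ u → ≤-trans (*-monoʳ-≤ (e₁ u) (≤-trans (∑-pendant X u) (leaf≤1 X u))) (≤-reflexive (*-identityʳ (e₁ u)))) ⟩
      sum e₁                                         ≡⟨ trans (∑-+ (δ x) e₂) (cong₂ _+_ (∑-δ₁ x) ∑e₂) ⟩
      1 + (deg X x + deg Z z)                        ∎
    second : sum (λ u → sum (λ w → e₂ w * pendant X u w)) ≤ 2 * (deg X x + deg Z z)
    second = begin
      sum (λ u → sum (λ w → e₂ w * pendant X u w))   ≡⟨ ∑-comm (λ u w → e₂ w * pendant X u w) ⟩
      sum (λ w → sum (λ u → e₂ w * pendant X u w))   ≡⟨ ∑-cong (λ w → ∑-* (e₂ w) (λ u → pendant X u w)) ⟩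
      sum (λ w → e₂ w * pendants-at X w)             ≤⟨ ∑-mono (λ w → ≤-trans (*-monoʳ-≤ (e₂ w) (pendants-at≤2 X w)) (≤-reflexive (*-comm (e₂ w) 2))) ⟩
      sum (λ w → 2 * e₂ w)                           ≡⟨ trans (∑-* 2 e₂) (cong (2 *_) ∑e₂) ⟩
      2 * (deg X x + deg Z z)                        ∎
    each : ∀ u w → pendant X u w ≤ pendant Z (to u) (to w) + (e₁ u * pendant X u w + e₂ w * pendant X u w)
    each u w = go (near u) (near w)
      where
      Goal : Set
      Goal = pendant X u w ≤ pendant Z (to u) (to w) + (e₁ u * pendant X u w + e₂ w * pendant X u w)
      by₁ : 1 ≤ e₁ u → Goal
      by₁ p = ≤-trans (≤-trans (≤-reflexive (sym (*-identityˡ _))) (*-monoˡ-≤ (pendant X u w) p))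
        (≤-trans (m≤m+n _ (e₂ w * pendant X u w)) (m≤n+m _ (pendant Z (to u) (to w))))
      by₂ : 1 ≤ e₂ w → Goal
      by₂ p = ≤-trans (≤-trans (≤-reflexive (sym (*-identityˡ _))) (*-monoˡ-≤ (pendant X u w) p))
        (≤-trans (m≤n+m _ (e₁ u * pendant X u w)) (m≤n+m _ (pendant Z (to u) (to w))))
      go : Near u → Near w → Goal
      go (itself refl) _ = by₁ (≤-trans (≤-reflexive (sym (δ-refl x))) (m≤m+n _ _))
      go (next-x e) _ = by₁ (≤-trans (≤-trans (≤-reflexive (sym e)) (m≤m+n _ (A Z z (to u)))) (m≤n+m _ (δ x u)))
      go (next-z e) _ = by₁ (≤-trans (≤-trans (≤-reflexive (sym e)) (m≤n+m _ (A X x u))) (m≤n+m _ (δ x u)))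
      go (away _ _) (next-x e) = by₂ (≤-trans (≤-reflexive (sym e)) (m≤m+n _ _))
      go (away _ _) (next-z e) = by₂ (≤-trans (≤-reflexive (sym e)) (m≤n+m _ _))
      -- `e₂` need not include `x`: if the middle vertex is `x`, the leaf is a neighbour of `x` and
      -- counts in `e₁`.
      go (away _ _) (itself refl) = adjacent (A X u x) refl
        where
        adjacent : ∀ a → A X u x ≡ a → Goal
        adjacent zero    e = ≤-trans (≤-reflexive (cong (_* (leaf X u * is2 (deg X x))) e)) z≤n
        adjacent (suc a) e = by₁ (≤-trans (≤-trans (s≤s z≤n) (≤-reflexive (sym (trans (A-sym X x u) e)))) (≤-trans (m≤m+n _ (A Z z (to u))) (m≤n+m _ (δ x u))))
      go (away u≢ du) (away w≢ dw) = ≤-trans (≤-reflexive (cong₂ _*_ (cong 𝟙 (adj-to u w u≢ w≢)) (cong₂ (λ a b → is1 a * is2 b) du dw))) (m≤m+n _ _)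

-- Leaves and pendant paths of the tree, on and off its longest path

∑-three : ∀ {n} {u v w : Fin n} (f : Fin n → ℕ) → u ≢ v → u ≢ w → v ≢ w → 1 ≤ f u → 1 ≤ f v → 1 ≤ f w → 3 ≤ sum f
∑-three {u = u} {v} {w} f uv uw vw fu fv fw = ≤-trans (≤-reflexive (sym (trans (∑-+ (δ u) (λ i → δ v i + δ w i))
    (cong₂ _+_ (∑-δ₁ u) (trans (∑-+ (δ v) (δ w)) (cong₂ _+_ (∑-δ₁ v) (∑-δ₁ w))))))) (∑-mono le)
  where
  le : ∀ i → δ u i + (δ v i + δ w i) ≤ f i
  le i with u ≟F i | v ≟F i | w ≟F i
  ... | yes refl | yes p    | _        = contradiction (sym p) uv
  ... | yes refl | no _     | yes p    = contradiction (sym p) uw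
  ... | yes refl | no _     | no _     = fu
  ... | no _     | yes refl | yes p    = contradiction (sym p) vw
  ... | no _     | yes refl | no _     = fv
  ... | no _     | no _     | yes refl = fw
  ... | no _     | no _     | no _     = z≤n

module _ {m} (X : Graph (suc m)) (conn : Connected X) (big : 4 ≤ m) where

  walk-first : ∀ {u w} → Walk X u w → u ≢ w → ∃ λ v → Edge X u v
  walk-first here ne = contradiction refl ne
  walk-first (step e _) _ = _ , e

  deg≥1 : ∀ u → 1 ≤ deg X u
  deg≥1 u = ≤-trans (≤-reflexive (sym (A-edge X (proj₂ e)))) (term≤∑ (A X u) (proj₁ e))
    where
    second : ∀ {m} → 4 ≤ m → Fin (suc m)
    second (s≤s _) = suc zero
    differs : ∀ {m} (p : 4 ≤ m) → second p ≢ zero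
    differs (s≤s _) ()
    e : ∃ λ v → Edge X u v
    e with u ≟F zero
    ... | yes refl = walk-first (conn zero (second big)) (differs big ∘ sym)
    ... | no ne    = walk-first (conn u zero) ne

module TreeCounts {m} (G : Graph (suc m)) (conn : Connected G) (big : 4 ≤ m) where
  -- Two leaves at a vertex of degree 2 would be the whole tree.
  pendants-at≤1 : ∀ w → pendants-at G w ≤ 1
  pendants-at≤1 w = ≮⇒≥ λ lt → impossible (∑-another f f≤1 lt w) lt
    where
    f : Fin (suc m) → ℕ
    f u = pendant G u w
    f≤1 : ∀ u → f u ≤ 1
    f≤1 u = ≤-trans (pendant≤A G u w) (𝟙≤1 _)
    facts : ∀ {u} → 1 ≤ f u → Edge G w u × deg G u ≡ 1 × deg G w ≡ 2
    facts {u} p = edge-sym G (edge-A G (proj₁ (*-positive (A G u w) _ p))) ,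
      leaf-elim G (proj₁ (*-positive (leaf G u) _ q)) , two (proj₂ (*-positive (leaf G u) _ q))
      where
      q = proj₂ (*-positive (A G u w) _ p)
      two : ∀ {d} → 1 ≤ is2 d → d ≡ 2
      two {2} _ = refl
    impossible : (∃ λ u → u ≢ w × 1 ≤ f u) → 2 ≤ sum f → ⊥
    impossible (u , _ , fu) lt = collapse (∑-another f f≤1 lt u)
      where
      collapse : (∃ λ u′ → u′ ≢ u × 1 ≤ f u′) → ⊥
      collapse (u′ , u′≢u , fu′) = <⇒≱ (s≤s big) (≤-trans size₃ (n≤1+n 3))
        where
        Three : Fin (suc m) → Set
        Three v = v ≡ w ⊎ v ≡ u ⊎ v ≡ u′
        only : ∀ {l v} → Edge G w l → deg G l ≡ 1 → Edge G l v → v ≡ w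
        only {l} {v} e d e′ with v ≟F w
        ... | yes p = p
        ... | no ne = contradiction (≤-trans (∑-two (A G l) ne (≤-reflexive (sym (A-edge G e′))) (≤-reflexive (sym (A-edge G (edge-sym G e))))) (≤-reflexive d)) 1+n≰n
        among : ∀ {v} → Edge G w v → v ≡ u ⊎ v ≡ u′
        among {v} e with v ≟F u | v ≟F u′
        ... | yes p | _ = inj₁ p
        ... | no _ | yes p = inj₂ p
        ... | no p | no p′ = contradiction (≤-trans (∑-three (A G w) p p′ (u′≢u ∘ sym) (≤-reflexive (sym (A-edge G e)))
              (≤-reflexive (sym (A-edge G (proj₁ (facts fu))))) (≤-reflexive (sym (A-edge G (proj₁ (facts fu′)))))) (≤-reflexive (proj₂ (proj₂ (facts fu))))) 1+n≰n
        closed : ∀ {v v′} → Walk G v v′ → Three v → Three v′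
        closed here t = t
        closed (step e p) (inj₁ refl) = closed p (inj₂ (among e))
        closed (step e p) (inj₂ (inj₁ refl)) = closed p (inj₁ (only (proj₁ (facts fu)) (proj₁ (proj₂ (facts fu))) e))
        closed (step e p) (inj₂ (inj₂ refl)) = closed p (inj₁ (only (proj₁ (facts fu′)) (proj₁ (proj₂ (facts fu′))) e))
        size₃ : suc m ≤ 3
        size₃ = ≤-trans (≤-reflexive (sym (∑-1 (suc m))))
          (≤-trans (∑-mono (λ v → cover (closed (conn w v) (inj₁ refl))))
            (≤-reflexive (trans (∑-+ (δ w) (λ i → δ u i + δ u′ i)) (cong₂ _+_ (∑-δ₁ w) (trans (∑-+ (δ u) (δ u′)) (cong₂ _+_ (∑-δ₁ u) (∑-δ₁ u′)))))))
          where
          cover : ∀ {v} → Three v → 1 ≤ δ w v + (δ u v + δ u′ v)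
          cover (inj₁ refl) = ≤-trans (≤-reflexive (sym (δ-refl w))) (m≤m+n _ _)
          cover {v} (inj₂ (inj₁ refl)) = ≤-trans (≤-trans (≤-reflexive (sym (δ-refl u))) (m≤m+n _ (δ u′ v))) (m≤n+m _ (δ w v))
          cover {v} (inj₂ (inj₂ refl)) = ≤-trans (≤-trans (≤-reflexive (sym (δ-refl u′))) (m≤n+m _ (δ u v))) (m≤n+m _ (δ w v))

module PathCounts {m} (G : Graph (suc m)) (conn : Connected G) (few : degrees G ≤ 2 * m) (big : 4 ≤ m) where
  open Tree G conn few
  open TreeCounts G conn big

  onP : Fin (suc m) → ℕ
  onP w = ⟪ onPath w ⟫

  node-edge : ∀ i → suc i ≤ diam → Edge G (node i) (node (suc i))
  node-edge i p = child-edge end₁ (node-suc i p)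

  node-≢ : ∀ {i j} → i ≤ diam → j ≤ diam → i ≢ j → node i ≢ node j
  node-≢ {i} {j} p q ne e = ne (trans (sym (level-node i p)) (trans (cong level e) (level-node j q)))

  inner-degree : ∀ i → suc (suc i) ≤ diam → 2 ≤ deg G (node (suc i))
  inner-degree i p = ∑-two (A G (node (suc i))) (node-≢ (≤-trans (n≤1+n i) (<⇒≤ p)) p (λ e → <⇒≢ (s≤s (n≤1+n i)) e))
    (≤-reflexive (sym (A-edge G (edge-sym G (node-edge i (<⇒≤ p)))))) (≤-reflexive (sym (A-edge G (node-edge (suc i) p))))

  inner-neighbour : ∀ i {u} → suc (suc i) ≤ diam → deg G (node (suc i)) ≡ 2 → Edge G (node (suc i)) u → u ≡ node i ⊎ u ≡ node (suc (suc i))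
  inner-neighbour i {u} p d e = go (u ≟F node i) (u ≟F node (suc (suc i)))
    where
    go : Dec (u ≡ node i) → Dec (u ≡ node (suc (suc i))) → u ≡ node i ⊎ u ≡ node (suc (suc i))
    go (yes q) _ = inj₁ q
    go (no _) (yes q) = inj₂ q
    go (no a) (no b) = contradiction (≤-trans (∑-three (A G (node (suc i))) a b (node-≢ (≤-trans (n≤1+n i) (<⇒≤ p)) p (λ e → <⇒≢ (s≤s (n≤1+n i)) e))
      (≤-reflexive (sym (A-edge G e))) (≤-reflexive (sym (A-edge G (edge-sym G (node-edge i (<⇒≤ p)))))) (≤-reflexive (sym (A-edge G (node-edge (suc i) p)))))
      (≤-reflexive d)) 1+n≰n

  no-leaf : ∀ i → suc (suc i) ≤ diam → leaf G (node (suc i)) ≡ 0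
  no-leaf i p = big-deg (inner-degree i p)
    where
    big-deg : ∀ {d} → 2 ≤ d → is1 d ≡ 0
    big-deg (s≤s (s≤s _)) = refl

  -- If such a vertex has degree 2, both its neighbours are interior vertices of the path and hence
  -- no leaves.
  no-pendant : ∀ i → suc (suc (suc (suc i))) ≤ diam → pendants-at G (node (suc (suc i))) ≡ 0
  no-pendant i p = ∑-zero (λ u → n≤0⇒n≡0 (≮⇒≥ (none u)))
    where
    w = node (suc (suc i))
    none : ∀ u → ¬ 1 ≤ pendant G u w
    none u q = go (inner-neighbour (suc i) (<⇒≤ p) (two (proj₂ lw)) (edge-sym G (edge-A G (proj₁ (*-positive (A G u w) _ q)))))
      where
      lw : 1 ≤ leaf G u × 1 ≤ is2 (deg G w)
      lw = *-positive (leaf G u) _ (proj₂ (*-positive (A G u w) _ q))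
      two : ∀ {d} → 1 ≤ is2 d → d ≡ 2
      two {2} _ = refl
      go : u ≡ node (suc i) ⊎ u ≡ node (suc (suc (suc i))) → ⊥
      go (inj₁ e) = contradiction (≤-trans (proj₁ lw) (≤-reflexive (trans (cong (leaf G) e) (no-leaf i (<⇒≤ (<⇒≤ p)))))) λ ()
      go (inj₂ e) = contradiction (≤-trans (proj₁ lw) (≤-reflexive (trans (cong (leaf G) e) (no-leaf (suc (suc i)) p)))) λ ()

  ends nearly : Fin (suc m) → ℕ
  ends w = δ (node 0) w + δ (node diam) w
  nearly w = ends w + (δ (node 1) w + δ (node (pred diam)) w)

  end-mark : Fin (suc m) → ℕ
  end-mark w = leaf G w + pendants-at G w

  -- A leaf is not the middle of a pendant path, as its degree is not 2.
  end-mark≤1 : ∀ w → end-mark w ≤ 1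
  end-mark≤1 w = go (deg G w ≟ 1)
    where
    go : Dec (deg G w ≡ 1) → end-mark w ≤ 1
    go (yes d) = ≤-trans (+-mono-≤ (leaf≤1 G w) (≤-reflexive (∑-zero (λ u → trans (cong (λ d → A G u w * (leaf G u * is2 d)) d)
      (trans (cong (A G u w *_) (*-zeroʳ (leaf G u))) (*-zeroʳ (A G u w))))))) ≤-refl
    go (no d) = ≤-trans (+-monoˡ-≤ (pendants-at G w) (≤-reflexive (none d))) (pendants-at≤1 w)
      where
      none : ∀ {d} → d ≢ 1 → is1 d ≡ 0
      none {0} _ = refl
      none {1} ne = contradiction refl ne
      none {suc (suc d)} _ = refl

  data Spot (w : Fin (suc m)) : Set where
    first : node 0 ≡ w → Spot w
    last  : node diam ≡ w → Spot w
    mid   : ∀ i → suc (suc i) ≤ diam → node (suc i) ≡ w → Spot w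

  spot : ∀ {w} → OnPath w → Spot w
  spot {w} on = go (level w) refl
    where
    go : ∀ l → level w ≡ l → Spot w
    go zero e = first (trans (cong node (sym e)) (node-level on))
    go (suc l) e = near (suc l ≟ diam)
      where
      at : node (suc l) ≡ w
      at = trans (cong node (sym e)) (node-level on)
      near : Dec (suc l ≡ diam) → Spot w
      near (yes q) = last (trans (cong node (sym q)) at)
      near (no q)  = mid l (≤∧≢⇒< (≤-trans (≤-reflexive (sym e)) (proj₁ on)) q) at

  ∑-ends : sum ends ≡ 2
  ∑-ends = trans (∑-+ (δ (node 0)) (δ (node diam))) (cong₂ _+_ (∑-δ₁ (node 0)) (∑-δ₁ (node diam)))

  ∑-nearly : sum nearly ≡ 4
  ∑-nearly = trans (∑-+ ends (λ w → δ (node 1) w + δ (node (pred diam)) w))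
    (cong₂ _+_ ∑-ends (trans (∑-+ (δ (node 1)) (δ (node (pred diam)))) (cong₂ _+_ (∑-δ₁ (node 1)) (∑-δ₁ (node (pred diam))))))

  onP-case : ∀ (g h : Fin (suc m) → ℕ) w → (OnPath w → g w ≤ h w) → onP w * g w ≤ h w
  onP-case g h w le = ⟪⟫-case (onPath w) (λ x → x * g w ≤ h w) (λ on → ≤-trans (≤-reflexive (*-identityˡ (g w))) (le on)) (λ _ → z≤n)

  path-leaves : sum (λ w → onP w * leaf G w) ≤ 2
  path-leaves = ≤-trans (∑-mono (λ w → onP-case (leaf G) ends w (λ on → at (spot on)))) (≤-reflexive ∑-ends)
    where
    at : ∀ {w} → Spot w → leaf G w ≤ ends w
    at {w} (first refl) = ≤-trans (leaf≤1 G w) (≤-trans (≤-reflexive (sym (δ-refl w))) (m≤m+n _ (δ (node diam) w)))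
    at {w} (last refl) = ≤-trans (leaf≤1 G w) (≤-trans (≤-reflexive (sym (δ-refl w))) (m≤n+m _ (δ (node 0) w)))
    at (mid i p refl) = ≤-trans (≤-reflexive (no-leaf i p)) z≤n

  -- Only the first two and the last two vertices of the path can carry a mark.
  path-marks : sum (λ w → onP w * end-mark w) ≤ 4
  path-marks = ≤-trans (∑-mono (λ w → onP-case end-mark nearly w (λ on → at (spot on)))) (≤-reflexive ∑-nearly)
    where
    at : ∀ {w} → Spot w → end-mark w ≤ nearly w
    at {w} (first refl) = ≤-trans (end-mark≤1 w) (≤-trans (≤-trans (≤-reflexive (sym (δ-refl w))) (m≤m+n _ (δ (node diam) w))) (m≤m+n _ _))
    at {w} (last refl) = ≤-trans (end-mark≤1 w) (≤-trans (≤-trans (≤-reflexive (sym (δ-refl w))) (m≤n+m _ (δ (node 0) w))) (m≤m+n _ _))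
    at {w} (mid zero p refl) = ≤-trans (end-mark≤1 w) (≤-trans (≤-trans (≤-reflexive (sym (δ-refl w))) (m≤m+n _ (δ (node (pred diam)) w))) (m≤n+m _ (ends w)))
    at {w} (mid (suc i) p refl) = go (suc (suc (suc i)) ≟ diam)
      where
      go : Dec (suc (suc (suc i)) ≡ diam) → end-mark w ≤ nearly w
      go (yes q) = ≤-trans (end-mark≤1 w) (≤-trans (≤-trans (≤-reflexive (sym (trans (cong (λ d → δ (node (pred d)) w) (sym q)) (δ-refl w)))) (m≤n+m _ (δ (node 1) w))) (m≤n+m _ (ends w)))
      go (no q) = ≤-trans (≤-reflexive (cong₂ _+_ (no-leaf (suc i) p) (no-pendant i (≤∧≢⇒< p q)))) z≤n

  path-size : diam + 1 ≤ sum onP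
  path-size = ≤-trans (≤-reflexive (trans (+-comm diam 1) (sym (∑-1 (suc diam)))))
    (∑-inj (node ∘ toℕ) (λ _ → 1) onP (λ _ → ≤-refl)
      (λ i j _ _ e → toℕ-injective (trans (sym (level-node (toℕ i) (i≤ i))) (trans (cong level e) (level-node (toℕ j) (i≤ j)))))
      (λ i _ → ≤-reflexive (sym (⟪⟫-yes (onPath (node (toℕ i))) (onPath-node (toℕ i) (i≤ i))))))
    where
    i≤ : ∀ (i : Fin (suc diam)) → toℕ i ≤ diam
    i≤ i = s≤s⁻¹ (toℕ<n i)

  module Marked {k} (xs : Fin k → Fin (suc m)) (xs-inj : ∀ {i j} → xs i ≡ xs j → i ≡ j) where

    isX nonX : Fin (suc m) → ℕ
    isX w = sum (λ i → δ (xs i) w)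
    nonX w = 1 ∸ isX w

    isX≤1 : ∀ w → isX w ≤ 1
    isX≤1 w = ∑-≤1 (λ i → 𝟙≤1 _) (λ i j p q → xs-inj (trans (δ-elim {i = xs i} p) (sym (δ-elim {i = xs j} q))))

    ∑-isX : ∀ (g : Fin (suc m) → ℕ) → sum (λ w → isX w * g w) ≡ sum (g ∘ xs)
    ∑-isX g = trans (∑-cong (λ w → sym (∑-*ʳ (g w) (λ i → δ (xs i) w))))
      (trans (∑-comm (λ w i → δ (xs i) w * g w)) (∑-cong (λ i → ∑-δ (xs i) g)))

    ν : ℕ
    ν = sum (λ w → nonX w * (1 ∸ onP w))

    onCount : ℕ
    onCount = sum (onP ∘ xs)

    total≡ : ∀ (g : Fin (suc m) → ℕ) → sum g ≡ sum (g ∘ xs) + sum (λ w → nonX w * g w)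
    total≡ g = trans (∑-cong each) (trans (∑-+ (λ w → isX w * g w) (λ w → nonX w * g w)) (cong (_+ sum (λ w → nonX w * g w)) (∑-isX g)))
      where
      each : ∀ w → g w ≡ isX w * g w + nonX w * g w
      each w = trans (sym (*-identityˡ (g w))) (trans (cong (_* g w) (sym (m+[n∸m]≡n (isX≤1 w)))) (*-distribʳ-+ (g w) (isX w) (nonX w)))

    -- A vertex without a card is counted in `ν` if it is off the path; otherwise the sum over the
    -- path pays for it.
    unmatched : ∀ (g : Fin (suc m) → ℕ) → (∀ w → g w ≤ 1) → sum (λ w → nonX w * g w) ≤ ν + sum (λ w → onP w * g w)
    unmatched g g≤1 = ≤-trans (∑-mono each) (≤-reflexive (∑-+ (λ w → nonX w * (1 ∸ onP w)) (λ w → onP w * g w)))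
      where
      each : ∀ w → nonX w * g w ≤ nonX w * (1 ∸ onP w) + onP w * g w
      each w = go (onP w) (𝟙≤1 _) refl
        where
        go : ∀ o → o ≤ 1 → onP w ≡ o → nonX w * g w ≤ nonX w * (1 ∸ onP w) + onP w * g w
        go 0 _ e = ≤-trans (*-monoʳ-≤ (nonX w) (g≤1 w)) (≤-trans (≤-reflexive (cong (λ o → nonX w * (1 ∸ o)) (sym e))) (m≤m+n _ (onP w * g w)))
        go 1 _ e = ≤-trans (≤-trans (*-monoˡ-≤ (g w) (m∸n≤m 1 (isX w))) (≤-reflexive (cong (_* g w) (sym e)))) (m≤n+m _ (nonX w * (1 ∸ onP w)))
        go (suc (suc o)) (s≤s ()) _

    -- The `k` vertices with cards, the `ν` vertices and the path vertices without cards make up G,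
    -- and the path has at least `diam + 1` vertices, of which `onCount` have cards.
    path-balance : diam + 1 + ν + k ≤ onCount + suc m
    path-balance = ≤-trans
        (lin 6 (λ d P c x ν k → d ⊑ P ∷ P ⊑ c ⊕ x ∷ [] ⊢ d ⊕ ν ⊕ k ⊑ c ⊕ (k ⊕ (ν ⊕ x)))
          (diam + 1) (sum onP) onCount (sum (λ w → nonX w * onP w)) ν k path-size (≤-reflexive (total≡ onP)))
        (≤-reflexive (cong (onCount +_) (sym n≡)))
      where
      n≡ : suc m ≡ k + (ν + sum (λ w → nonX w * onP w))
      n≡ = begin-equality
        suc m                                                       ≡⟨ sym (∑-1 (suc m)) ⟩
        sum {suc m} (λ _ → 1)                                       ≡⟨ total≡ (λ _ → 1) ⟩
        sum {k} (λ _ → 1) + sum (λ w → nonX w * 1)                  ≡⟨ cong₂ _+_ (∑-1 k) (trans (∑-cong split) (∑-+ (λ w → nonX w * (1 ∸ onP w)) (λ w → nonX w * onP w))) ⟩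
        k + (ν + sum (λ w → nonX w * onP w))                        ∎
        where
        open ≤-Reasoning
        split : ∀ w → nonX w * 1 ≡ nonX w * (1 ∸ onP w) + nonX w * onP w
        split w = trans (cong (nonX w *_) (sym (m∸n+n≡m (𝟙≤1 (does (onPath w)))))) (*-distribˡ-+ (nonX w) (1 ∸ onP w) (onP w))

    leaves-bound : leaves G ≤ sum (leaf G ∘ xs) + ν + 2
    leaves-bound = ≤-trans (≤-reflexive (total≡ (leaf G)))
      (≤-trans (+-monoʳ-≤ (sum (leaf G ∘ xs)) (≤-trans (unmatched (leaf G) (leaf≤1 G)) (+-monoʳ-≤ ν path-leaves)))
        (≤-reflexive (sym (+-assoc (sum (leaf G ∘ xs)) ν 2))))

    marks-bound : leaves G + pendants G ≤ sum (leaf G ∘ xs) + sum (pendants-at G ∘ xs) + ν + 4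
    marks-bound = begin
      leaves G + pendants G                                   ≡⟨ cong (leaves G +_) (pendants-swap G) ⟩
      leaves G + sum (pendants-at G)                          ≡⟨ sym (∑-+ (leaf G) (pendants-at G)) ⟩
      sum end-mark                                            ≡⟨ total≡ end-mark ⟩
      sum (end-mark ∘ xs) + sum (λ w → nonX w * end-mark w)   ≤⟨ +-mono-≤ (≤-reflexive (∑-+ (leaf G ∘ xs) (pendants-at G ∘ xs))) (≤-trans (unmatched end-mark end-mark≤1) (+-monoʳ-≤ ν path-marks)) ⟩
      sum (leaf G ∘ xs) + sum (pendants-at G ∘ xs) + (ν + 4)  ≡⟨ sym (+-assoc (sum (leaf G ∘ xs) + sum (pendants-at G ∘ xs)) ν 4) ⟩
      sum (leaf G ∘ xs) + sum (pendants-at G ∘ xs) + ν + 4    ∎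
      where open ≤-Reasoning

    leaves-lower : sum (leaf G ∘ xs) ≤ leaves G
    leaves-lower = ≤-trans (m≤m+n _ _) (≤-reflexive (sym (total≡ (leaf G))))

    pendants-lower : sum (pendants-at G ∘ xs) ≤ pendants G
    pendants-lower = ≤-trans (m≤m+n _ _) (≤-reflexive (trans (sym (total≡ (pendants-at G))) (sym (pendants-swap G))))

-- Local inequalities of the discharging

-- A cycle vertex is matched to a vertex off the longest path, matched to a
-- vertex on it, or not matched to any common card.
data Role : Set where
  off on free : Role

matched? offPath? onPath? free? : Role → ℕ
matched? off  = 1
matched? on   = 1
matched? free = 0
offPath? off  = 1
offPath? on   = 0
offPath? free = 0
onPath?  off  = 0
onPath?  on   = 1
onPath?  free = 0
free?    off  = 0
free?    on   = 0
free?    free = 1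

-- What flows into a vertex from one side, s being the reach on that side
-- and s′ the reach on the other side.
data Inflow (c e h s s′ : ℕ) : ℕ → Set where
  none : Inflow c e h s s′ 0
  some : s ≤ c → h ⊔ (s′ ∸ 1) ≡ e → Inflow c e h s s′ 1

-- A reach of at most `e` has dropped below `e` one vertex earlier, so the maximum must be the
-- height. This identifies the trees that receive charge.
⊔-≡⇒ : ∀ {h r e} → 1 ≤ e → r ≤ e → h ⊔ (r ∸ 1) ≡ e → h ≡ e
⊔-≡⇒ {h} {r} {suc e} _ r≤e eq with ⊔-sel h (r ∸ 1)
... | inj₁ p = trans (sym p) eq
... | inj₂ p = contradiction (≤-trans (≤-reflexive (sym (trans (sym p) eq))) (∸-monoˡ-≤ 1 r≤e)) 1+n≰n

-- In the discharging for e = 1 and e ≥ 3 a short tree matched off the path without reach on its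
-- left sends one unit to its right neighbour, which has a tree of height e if it is matched.
sendR₁ : Role → ℕ → ℕ → ℕ
sendR₁ off 0 0 = 1
sendR₁ _   _ _ = 0

-- A bare vertex matched off the path has exactly one reach equal to 0 and so sends exactly one
-- unit. A receiver matched off the path has height 1, and charge from both sides would make both of
-- its reaches 0. So, up to errors, there are at least as many trees of height 1 as bare vertices.
local₁ : ∀ ρ h l r x y → (ρ ≢ free → l + r ≤ 1) → (ρ ≡ off → l + r ≡ 1) →
  Inflow 0 1 h l r x → Inflow 0 1 h r l y →
  matched? ρ * is0 h + 2 * x + 2 * y + offPath? ρ * is0 h
    ≤ 2 * (matched? ρ * is1 h) + 2 * sendR₁ ρ h l + 2 * sendR₁ ρ h r + 2 * onPath? ρ + 4 * free? ρ
local₁ ρ h l r x y le eq (some p u) b with ρ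
local₁ ρ h l r x y le eq (some p u) none       | free = ≤ᵇ⇒≤ (2) (4) _
local₁ ρ h l r x y le eq (some p u) (some _ _) | free = ≤-refl
local₁ ρ h l r x y le eq (some p u) b | on with ⊔-≡⇒ ≤-refl (≤-trans (m≤n+m r l) (le λ ())) u
local₁ ρ h l r x y le eq (some p u) none       | on | refl = ≤ᵇ⇒≤ 2 4 _
local₁ ρ h l r x y le eq (some p u) (some _ _) | on | refl = ≤-refl
local₁ ρ h l r x y le eq (some p u) b | off with ⊔-≡⇒ ≤-refl (≤-trans (m≤n+m r l) (le λ ())) u
local₁ ρ h l r x y le eq (some p u) none       | off | refl = s≤s (s≤s z≤n)
local₁ ρ h zero zero x y le eq (some p u) (some p′ u′) | off | refl = contradiction (eq refl) λ ()
local₁ ρ h l r x y le eq none (some p u) with ρ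
... | free = ≤ᵇ⇒≤ 2 4 _
... | on with ⊔-≡⇒ {e = 1} ≤-refl (≤-trans (m≤m+n l r) (le λ ())) u
...   | refl = ≤ᵇ⇒≤ 2 4 _
local₁ ρ h l r x y le eq none (some p u) | off with ⊔-≡⇒ {e = 1} ≤-refl (≤-trans (m≤m+n l r) (le λ ())) u
...   | refl = s≤s (s≤s z≤n)
local₁ free h l r x y le eq none none = z≤n
local₁ on 0 l r x y le eq none none = s≤s z≤n
local₁ on 1 l r x y le eq none none = z≤n
local₁ on (suc (suc h)) l r x y le eq none none = z≤n
local₁ off 0 0 0 x y le eq none none = contradiction (eq refl) λ ()
local₁ off 0 0 (suc r) x y le eq none none = ≤-refl
local₁ off 0 (suc l) 0 x y le eq none none = ≤-refl
local₁ off 0 (suc l) (suc r) x y le eq none none = contradiction (trans (sym (+-suc l r)) (suc-injective (eq refl))) λ ()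
local₁ off 1 l r x y le eq none none = z≤n
local₁ off (suc (suc h)) l r x y le eq none none = z≤n

-- For e = 2 it pulls charge from that neighbour instead and pushes some to the left one; vertices
-- not matched off the path push charge both ways.
pullR : Role → ℕ → ℕ → ℕ
pullR off 0 0 = 21
pullR off 1 0 = 7
pullR _   _ _ = 0

push : Role → ℕ → ℕ → ℕ
push off 0 0 = 7
push off 1 0 = 7
push off _ _ = 0
push _   _ _ = 7

data Pull (h s s′ : ℕ) : ℕ → Set where
  none : Pull h s s′ 0
  less : s ≡ 1 → h ⊔ (s′ ∸ 1) ≡ 2 → Pull h s s′ 7
  more : s ≡ 0 → h ⊔ (s′ ∸ 1) ≡ 2 → Pull h s s′ 21

pull≤21 : ∀ {h s s′ x} → Pull h s s′ x → x ≤ 21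
pull≤21 none = z≤n
pull≤21 (less _ _) = ≤ᵇ⇒≤ 7 21 _
pull≤21 (more _ _) = ≤-refl

pull-none : ∀ {h s s′ x} → h ≤ 1 → s′ ≤ 2 → Pull h s s′ x → x ≡ 0
pull-none h≤1 s≤2 none = refl
pull-none h≤1 s≤2 (less _ u) = contradiction (subst (_≤ 1) (⊔-≡⇒ (s≤s z≤n) s≤2 u) h≤1) λ { (s≤s ()) }
pull-none h≤1 s≤2 (more _ u) = contradiction (subst (_≤ 1) (⊔-≡⇒ (s≤s z≤n) s≤2 u) h≤1) λ { (s≤s ()) }

-- For a tree this low, a pull from one side needs reach 3 on the other side, where a pull requires
-- reach at most 1.
pull-one : ∀ {h l r x y} → h ≤ 1 → Pull h l r x → Pull h r l y → x + y ≤ 21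
pull-one h≤1 none b = pull≤21 b
pull-one h≤1 a none = ≤-trans (≤-reflexive (+-identityʳ _)) (pull≤21 a)
pull-one {h} h≤1 (less _ u) (less refl _) = ⊥-elim (1+n≰n (≤-trans (≤-reflexive (sym u)) (⊔-lub h≤1 z≤n)))
pull-one {h} h≤1 (less _ u) (more refl _) = ⊥-elim (1+n≰n (≤-trans (≤-reflexive (sym u)) (⊔-lub h≤1 z≤n)))
pull-one {h} h≤1 (more _ u) (less refl _) = ⊥-elim (1+n≰n (≤-trans (≤-reflexive (sym u)) (⊔-lub h≤1 z≤n)))
pull-one {h} h≤1 (more _ u) (more refl _) = ⊥-elim (1+n≰n (≤-trans (≤-reflexive (sym u)) (⊔-lub h≤1 z≤n)))

pull-sum : ∀ {h l r x y} → l + r ≡ 2 → Pull h l r x → Pull h r l y → x + y ≤ 21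
pull-sum e none b = pull≤21 b
pull-sum e a none = ≤-trans (≤-reflexive (+-identityʳ _)) (pull≤21 a)
pull-sum e (less refl _) (less refl _) = ≤ᵇ⇒≤ 14 21 _
pull-sum () (less refl _) (more refl _)
pull-sum () (more refl _) (less refl _)
pull-sum () (more refl _) (more refl _)

is2-tall : ∀ q {h o} → suc h ≤ o → is2 (2 + q + o) ≤ 0
is2-tall zero    (s≤s _) = z≤n
is2-tall (suc q) (s≤s _) = z≤n

push≤pull : ∀ s → push off 1 s ≤ pullR off 1 s
push≤pull zero    = ≤-refl
push≤pull (suc s) = z≤n

-- The weights make four cases off the path tight: no tree with reaches 0 and 2, no tree with
-- reaches 1 and 1, a star with one leaf, and a path of two edges from which 21 is pulled. The
-- constants 38 and 44 are the largest deficits of unmatched vertices and of vertices matched onto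
-- the path, under the bounds on pulls used here.
local₂ : ∀ ρ {t q z h o} l r x y x′ y′ → Shape t q z h o →
  (ρ ≢ free → l + r ≤ 2) → (ρ ≡ off → l + r ≡ 2) →
  Pull h l r x → Pull h r l y →
  (ρ ≡ off → h ≡ 0 → l ≡ 1 → r ≡ 1 → 7 ≤ x′ × 7 ≤ y′) →
  9 * (matched? ρ * is0 h) + 9 * (matched? ρ * is2 t) + 6 + 2 * (offPath? ρ * is0 h)
    + 3 * (onPath? ρ * t) + (x + y) + (push ρ h l + push ρ h r)
  ≤ 9 * (q + z) + 3 * t + (pullR ρ h l + pullR ρ h r) + (x′ + y′) + 38 * free? ρ + 44 * onPath? ρ
local₂ off l r x y x′ y′ bare le eq a b pushed
  with pull-none z≤n (≤-trans (m≤n+m r l) (le λ ())) a | pull-none z≤n (≤-trans (m≤m+n l r) (le λ ())) b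
local₂ off 0 (suc r) x y x′ y′ bare le eq a b pushed | refl | refl =
  lin 2 (λ u v → [] ⊢ con 24 ⊑ con 24 ⊕ (u ⊕ v) ⊕ con 0 ⊕ con 0) x′ y′
local₂ off 1 1 x y x′ y′ bare le eq a b pushed | refl | refl with pushed refl refl refl refl
... | p , p′ = lin 2 (λ u v → (con 7 ⊑ u) ∷ (con 7 ⊑ v) ∷ [] ⊢ con 17 ⊑ con 3 ⊕ (u ⊕ v) ⊕ con 0 ⊕ con 0) x′ y′ p p′
local₂ off 0 0 x y x′ y′ bare le eq a b pushed | refl | refl = contradiction (eq refl) λ ()
local₂ off (suc (suc l)) 0 x y x′ y′ bare le eq a b pushed | refl | refl =
  lin 2 (λ u v → [] ⊢ con 24 ⊑ con 24 ⊕ (u ⊕ v) ⊕ con 0 ⊕ con 0) x′ y′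
local₂ off (suc (suc l)) (suc r) x y x′ y′ bare le eq a b pushed | refl | refl =
  contradiction (trans (sym (+-suc l r)) (suc-injective (suc-injective (eq refl)))) λ ()
local₂ off 1 0 x y x′ y′ bare le eq a b pushed | refl | refl = contradiction (eq refl) λ ()
local₂ off 1 (suc (suc r)) x y x′ y′ bare le eq a b pushed | refl | refl = contradiction (eq refl) λ ()
local₂ on l r x y x′ y′ bare le eq a b pushed
  with pull-none z≤n (≤-trans (m≤n+m r l) (le λ ())) a | pull-none z≤n (≤-trans (m≤m+n l r) (le λ ())) b
... | refl | refl = lin 2 (λ u v → [] ⊢ con 32 ⊑ con 3 ⊕ (u ⊕ v) ⊕ con 0 ⊕ con 44) x′ y′
local₂ free l r x y x′ y′ bare le eq a b pushed =
  lin 3 (λ p u v → (p ⊑ con 21) ∷ [] ⊢ con 6 ⊕ p ⊕ con 14 ⊑ con 3 ⊕ (u ⊕ v) ⊕ con 38 ⊕ con 0) (x + y) x′ y′ (pull-one z≤n a b)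
local₂ off l r x y x′ y′ (star q) le eq a b pushed
  with pull-none ≤-refl (≤-trans (m≤n+m r l) (le λ ())) a | pull-none ≤-refl (≤-trans (m≤m+n l r) (le λ ())) b
... | refl | refl = lin 6 (λ i q f g u v → 9 ⊛ i ⊑ 9 ⊛ con 1 ∷ (f ⊑ g) ∷ [] ⊢
    con 0 ⊕ 9 ⊛ (1 ⊛ i) ⊕ con 6 ⊕ con 0 ⊕ con 0 ⊕ con 0 ⊕ f
      ⊑ 9 ⊛ (con 1 ⊕ q ⊕ con 0) ⊕ 3 ⊛ (con 2 ⊕ q) ⊕ g ⊕ (u ⊕ v) ⊕ con 0 ⊕ con 0)
    (is2 (2 + q)) q (push off 1 l + push off 1 r) (pullR off 1 l + pullR off 1 r) x′ y′
    (*-monoʳ-≤ 9 (is2≤1 (2 + q))) (+-mono-≤ (push≤pull l) (push≤pull r))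
local₂ on l r x y x′ y′ (star q) le eq a b pushed
  with pull-none ≤-refl (≤-trans (m≤n+m r l) (le λ ())) a | pull-none ≤-refl (≤-trans (m≤m+n l r) (le λ ())) b
... | refl | refl = lin 4 (λ i q u v → 9 ⊛ i ⊑ 9 ⊛ con 1 ∷ [] ⊢
    con 0 ⊕ 9 ⊛ (1 ⊛ i) ⊕ con 6 ⊕ con 0 ⊕ 3 ⊛ (1 ⊛ (con 2 ⊕ q)) ⊕ con 0 ⊕ con 14
      ⊑ 9 ⊛ (con 1 ⊕ q ⊕ con 0) ⊕ 3 ⊛ (con 2 ⊕ q) ⊕ con 0 ⊕ (u ⊕ v) ⊕ con 0 ⊕ con 44)
    (is2 (2 + q)) q x′ y′ (*-monoʳ-≤ 9 (is2≤1 (2 + q)))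
local₂ free l r x y x′ y′ (star q) le eq a b pushed =
  lin 4 (λ q p u v → (p ⊑ con 21) ∷ [] ⊢ con 6 ⊕ con 0 ⊕ con 0 ⊕ p ⊕ con 14
      ⊑ 9 ⊛ (con 1 ⊕ q ⊕ con 0) ⊕ 3 ⊛ (con 2 ⊕ q) ⊕ con 0 ⊕ (u ⊕ v) ⊕ con 38 ⊕ con 0)
    q (x + y) x′ y′ (pull-one ≤-refl a b)
local₂ off l r x y x′ y′ (tall q z h o ho zq qz) le eq a b pushed =
  lin 8 (λ i q z h o p u v → (p ⊑ con 21) ∷ 3 ⊛ (con 1 ⊕ h) ⊑ 3 ⊛ o ∷ 9 ⊛ con 1 ⊑ 9 ⊛ (q ⊕ z) ∷ 9 ⊛ i ⊑ 9 ⊛ con 0 ∷ [] ⊢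
    con 0 ⊕ 9 ⊛ (1 ⊛ i) ⊕ con 6 ⊕ con 0 ⊕ con 0 ⊕ p ⊕ con 0
      ⊑ 9 ⊛ (con 1 ⊕ q ⊕ z) ⊕ 3 ⊛ (con 2 ⊕ q ⊕ o) ⊕ con 0 ⊕ (u ⊕ v) ⊕ con 0 ⊕ con 0)
    (is2 (2 + q + o)) q z h o (x + y) x′ y′ (pull-sum (eq refl) a b)
    (*-monoʳ-≤ 3 ho) (*-monoʳ-≤ 9 qz) (*-monoʳ-≤ 9 (is2-tall q ho))
local₂ on l r x y x′ y′ (tall q z h o ho zq qz) le eq a b pushed =
  lin 7 (λ i q z o p u v → 9 ⊛ i ⊑ 9 ⊛ con 0 ∷ (p ⊑ con 42) ∷ 9 ⊛ con 1 ⊑ 9 ⊛ (q ⊕ z) ∷ [] ⊢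
    con 0 ⊕ 9 ⊛ (1 ⊛ i) ⊕ con 6 ⊕ con 0 ⊕ 3 ⊛ (1 ⊛ (con 2 ⊕ q ⊕ o)) ⊕ p ⊕ con 14
      ⊑ 9 ⊛ (con 1 ⊕ q ⊕ z) ⊕ 3 ⊛ (con 2 ⊕ q ⊕ o) ⊕ con 0 ⊕ (u ⊕ v) ⊕ con 0 ⊕ con 44)
    (is2 (2 + q + o)) q z o (x + y) x′ y′ (*-monoʳ-≤ 9 (is2-tall q ho))
    (+-mono-≤ (pull≤21 a) (pull≤21 b)) (*-monoʳ-≤ 9 qz)
local₂ free l r x y x′ y′ (tall q z h o ho zq qz) le eq a b pushed =
  lin 6 (λ q z o p u v → (p ⊑ con 42) ∷ 9 ⊛ con 1 ⊑ 9 ⊛ (q ⊕ z) ∷ [] ⊢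
    con 0 ⊕ con 0 ⊕ con 6 ⊕ con 0 ⊕ con 0 ⊕ p ⊕ con 14
      ⊑ 9 ⊛ (con 1 ⊕ q ⊕ z) ⊕ 3 ⊛ (con 2 ⊕ q ⊕ o) ⊕ con 0 ⊕ (u ⊕ v) ⊕ con 38 ⊕ con 0)
    q z o (x + y) x′ y′ (+-mono-≤ (pull≤21 a) (pull≤21 b)) (*-monoʳ-≤ 9 qz)

sendR₃ : Role → ℕ → ℕ → ℕ
sendR₃ off 0 0 = 1
sendR₃ off 1 0 = 1
sendR₃ _   _ _ = 0

inflow≤1 : ∀ {c e h s s′ x} → Inflow c e h s s′ x → x ≤ 1
inflow≤1 none       = z≤n
inflow≤1 (some _ _) = ≤-refl

inflow-none : ∀ {c e h s s′ x} → 1 ≤ e → h < e → s′ ≤ e → Inflow c e h s s′ x → x ≡ 0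
inflow-none 1≤e h<e s≤e none       = refl
inflow-none 1≤e h<e s≤e (some _ u) = contradiction (⊔-≡⇒ 1≤e s≤e u) (<⇒≢ h<e)

⊓-sum : ∀ k l r → k ≤ l + r → k ≤ l ⊓ k + r ⊓ k
⊓-sum k l r p with ≤-total l k | ≤-total r k
... | inj₂ k≤l | _ rewrite m≥n⇒m⊓n≡n k≤l = m≤m+n k _
... | inj₁ l≤k | inj₂ k≤r rewrite m≥n⇒m⊓n≡n k≤r = m≤n+m k _
... | inj₁ l≤k | inj₁ r≤k rewrite m≤n⇒m⊓n≡m l≤k | m≤n⇒m⊓n≡m r≤k = p

-- Around the cycle the minima add up to twice the sum of the heights (`⊔-⊓`), which cancels
-- `4 * h`; what remains relates sizes to the number of cycle vertices. Off the path, vertices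
-- without a tree are tight, and so are stars with one leaf when their reaches are 0 and `e`.
local₃ : ∀ ρ e {t q z h o} l r x y → 3 ≤ e → Shape t q z h o →
  (ρ ≢ free → l + r ≤ e) → (ρ ≡ off → l + r ≡ e) →
  Inflow 1 e h l r x → Inflow 1 e h r l y →
  (h ∸ 1) + onPath? ρ * t + 8 + 2 * pos h + 2 * x + 2 * y + 4 * h
    ≤ 2 * (2 * t + (l ⊓ suc h + r ⊓ suc h) + o) + 2 * sendR₃ ρ h l + 2 * sendR₃ ρ h r + 10 * free? ρ + 13 * onPath? ρ
local₃ free e l r x y 3≤e bare le eq a b =
  lin 3 (λ x y w → 2 ⊛ x ⊑ 2 ⊛ con 1 ∷ 2 ⊛ y ⊑ 2 ⊛ con 1 ∷ [] ⊢
    con 0 ⊕ con 0 ⊕ con 8 ⊕ con 0 ⊕ 2 ⊛ x ⊕ 2 ⊛ y ⊕ con 0 ⊑ 2 ⊛ (con 2 ⊕ w ⊕ con 0) ⊕ con 0 ⊕ con 0 ⊕ con 10 ⊕ con 0)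
    x y (l ⊓ 1 + r ⊓ 1) (*-monoʳ-≤ 2 (inflow≤1 a)) (*-monoʳ-≤ 2 (inflow≤1 b))
local₃ free e l r x y 3≤e (star q) le eq a b =
  lin 4 (λ x y w q → 2 ⊛ x ⊑ 2 ⊛ con 1 ∷ 2 ⊛ y ⊑ 2 ⊛ con 1 ∷ [] ⊢
    con 0 ⊕ con 0 ⊕ con 8 ⊕ con 2 ⊕ 2 ⊛ x ⊕ 2 ⊛ y ⊕ con 4 ⊑ 2 ⊛ (2 ⊛ (con 2 ⊕ q) ⊕ w ⊕ con 0) ⊕ con 0 ⊕ con 0 ⊕ con 10 ⊕ con 0)
    x y (l ⊓ 2 + r ⊓ 2) q (*-monoʳ-≤ 2 (inflow≤1 a)) (*-monoʳ-≤ 2 (inflow≤1 b))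
local₃ free e l r x y 3≤e (tall q z h o ho zq qz) le eq a b =
  lin 6 (λ x y w q h o → 2 ⊛ x ⊑ 2 ⊛ con 1 ∷ 2 ⊛ y ⊑ 2 ⊛ con 1 ∷ 6 ⊛ (con 1 ⊕ h) ⊑ 6 ⊛ o ∷ [] ⊢
    (con 1 ⊕ h) ⊕ con 0 ⊕ con 8 ⊕ con 2 ⊕ 2 ⊛ x ⊕ 2 ⊛ y ⊕ 4 ⊛ (con 2 ⊕ h)
      ⊑ 2 ⊛ (2 ⊛ (con 2 ⊕ q ⊕ o) ⊕ w ⊕ o) ⊕ con 0 ⊕ con 0 ⊕ con 10 ⊕ con 0)
    x y (l ⊓ (3 + h) + r ⊓ (3 + h)) q h o (*-monoʳ-≤ 2 (inflow≤1 a)) (*-monoʳ-≤ 2 (inflow≤1 b)) (*-monoʳ-≤ 6 ho)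
local₃ on e l r x y 3≤e bare le eq a b =
  lin 3 (λ x y w → 2 ⊛ x ⊑ 2 ⊛ con 1 ∷ 2 ⊛ y ⊑ 2 ⊛ con 1 ∷ [] ⊢
    con 0 ⊕ con 1 ⊕ con 8 ⊕ con 0 ⊕ 2 ⊛ x ⊕ 2 ⊛ y ⊕ con 0 ⊑ 2 ⊛ (con 2 ⊕ w ⊕ con 0) ⊕ con 0 ⊕ con 0 ⊕ con 0 ⊕ con 13)
    x y (l ⊓ 1 + r ⊓ 1) (*-monoʳ-≤ 2 (inflow≤1 a)) (*-monoʳ-≤ 2 (inflow≤1 b))
local₃ on e l r x y 3≤e (star q) le eq a b =
  lin 4 (λ x y w q → 2 ⊛ x ⊑ 2 ⊛ con 1 ∷ 2 ⊛ y ⊑ 2 ⊛ con 1 ∷ [] ⊢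
    con 0 ⊕ 1 ⊛ (con 2 ⊕ q) ⊕ con 8 ⊕ con 2 ⊕ 2 ⊛ x ⊕ 2 ⊛ y ⊕ con 4 ⊑ 2 ⊛ (2 ⊛ (con 2 ⊕ q) ⊕ w ⊕ con 0) ⊕ con 0 ⊕ con 0 ⊕ con 0 ⊕ con 13)
    x y (l ⊓ 2 + r ⊓ 2) q (*-monoʳ-≤ 2 (inflow≤1 a)) (*-monoʳ-≤ 2 (inflow≤1 b))
local₃ on e l r x y 3≤e (tall q z h o ho zq qz) le eq a b =
  lin 6 (λ x y w q h o → 2 ⊛ x ⊑ 2 ⊛ con 1 ∷ 2 ⊛ y ⊑ 2 ⊛ con 1 ∷ 5 ⊛ (con 1 ⊕ h) ⊑ 5 ⊛ o ∷ [] ⊢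
    (con 1 ⊕ h) ⊕ 1 ⊛ (con 2 ⊕ q ⊕ o) ⊕ con 8 ⊕ con 2 ⊕ 2 ⊛ x ⊕ 2 ⊛ y ⊕ 4 ⊛ (con 2 ⊕ h)
      ⊑ 2 ⊛ (2 ⊛ (con 2 ⊕ q ⊕ o) ⊕ w ⊕ o) ⊕ con 0 ⊕ con 0 ⊕ con 0 ⊕ con 13)
    x y (l ⊓ (3 + h) + r ⊓ (3 + h)) q h o (*-monoʳ-≤ 2 (inflow≤1 a)) (*-monoʳ-≤ 2 (inflow≤1 b)) (*-monoʳ-≤ 5 ho)
local₃ off e l r x y 3≤e bare le eq a b
  with inflow-none (≤-trans (s≤s z≤n) 3≤e) (≤-trans (s≤s z≤n) 3≤e) (≤-trans (m≤n+m r l) (le λ ())) a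
     | inflow-none (≤-trans (s≤s z≤n) 3≤e) (≤-trans (s≤s z≤n) 3≤e) (≤-trans (m≤m+n l r) (le λ ())) b
local₃ off e 0 0 x y 3≤e bare le eq a b | refl | refl = contradiction (subst (3 ≤_) (sym (eq refl)) 3≤e) λ ()
local₃ off e 0 (suc r) x y 3≤e bare le eq a b | refl | refl rewrite ⊓-zeroʳ r = ≤-refl
local₃ off e (suc l) 0 x y 3≤e bare le eq a b | refl | refl rewrite ⊓-zeroʳ l = ≤-refl
local₃ off e (suc l) (suc r) x y 3≤e bare le eq a b | refl | refl rewrite ⊓-zeroʳ l | ⊓-zeroʳ r = ≤-refl
local₃ off e l r x y 3≤e (star q) le eq a b
  with inflow-none (≤-trans (s≤s z≤n) 3≤e) (≤-trans (s≤s (s≤s z≤n)) 3≤e) (≤-trans (m≤n+m r l) (le λ ())) a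
     | inflow-none (≤-trans (s≤s z≤n) 3≤e) (≤-trans (s≤s (s≤s z≤n)) 3≤e) (≤-trans (m≤m+n l r) (le λ ())) b
... | refl | refl = lin 4 (λ q w s s′ → 2 ⊛ con 3 ⊑ 2 ⊛ (w ⊕ s ⊕ s′) ∷ [] ⊢
    con 14 ⊑ 2 ⊛ (2 ⊛ (con 2 ⊕ q) ⊕ w ⊕ con 0) ⊕ 2 ⊛ s ⊕ 2 ⊛ s′ ⊕ con 0 ⊕ con 0)
    q (l ⊓ 2 + r ⊓ 2) (sendR₃ off 1 l) (sendR₃ off 1 r) (*-monoʳ-≤ 2 (reach l r (subst (3 ≤_) (sym (eq refl)) 3≤e)))
  where
  reach : ∀ l r → 3 ≤ l + r → 3 ≤ l ⊓ 2 + r ⊓ 2 + sendR₃ off 1 l + sendR₃ off 1 r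
  reach 0 (suc (suc r)) p rewrite ⊓-zeroʳ r = ≤-refl
  reach 0 (suc 0) (s≤s ())
  reach 1 (suc (suc r)) p rewrite ⊓-zeroʳ r = ≤-refl
  reach 1 0 (s≤s ())
  reach 1 1 (s≤s (s≤s ()))
  reach (suc (suc l)) 0 p rewrite ⊓-zeroʳ l = ≤-refl
  reach (suc (suc l)) 1 p rewrite ⊓-zeroʳ l = ≤-refl
  reach (suc (suc l)) (suc (suc r)) p rewrite ⊓-zeroʳ l | ⊓-zeroʳ r = s≤s (s≤s (s≤s z≤n))
local₃ off e l r x y 3≤e (tall q z h o ho zq qz) le eq a b =
  lin 6 (λ x y w q h o → con 5 ⊕ 2 ⊛ x ⊕ 2 ⊛ y ⊑ h ⊕ 2 ⊛ w ∷ 6 ⊛ (con 1 ⊕ h) ⊑ 6 ⊛ o ∷ [] ⊢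
    (con 1 ⊕ h) ⊕ con 0 ⊕ con 8 ⊕ con 2 ⊕ 2 ⊛ x ⊕ 2 ⊛ y ⊕ 4 ⊛ (con 2 ⊕ h)
      ⊑ 2 ⊛ (2 ⊛ (con 2 ⊕ q ⊕ o) ⊕ w ⊕ o) ⊕ con 0 ⊕ con 0 ⊕ con 0 ⊕ con 0)
    x y (l ⊓ (3 + h) + r ⊓ (3 + h)) q h o (surplus a b) (*-monoʳ-≤ 6 ho)
  where
  l≤e : l ≤ e
  l≤e = ≤-trans (m≤m+n l r) (le λ ())
  r≤e : r ≤ e
  r≤e = ≤-trans (m≤n+m r l) (le λ ())
  1≤e : 1 ≤ e
  1≤e = ≤-trans (s≤s z≤n) 3≤e
  full : 2 + h ≡ e → l ⊓ (3 + h) + r ⊓ (3 + h) ≡ e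
  full refl rewrite m≤n⇒m⊓n≡m (m≤n⇒m≤1+n l≤e) | m≤n⇒m⊓n≡m (m≤n⇒m≤1+n r≤e) = eq refl
  one-sided : 2 + h ≡ e → 7 ≤ h + 2 * (l ⊓ (3 + h) + r ⊓ (3 + h))
  -- The bound `3 ≤ e` is needed with multiplicity three.
  one-sided p = lin 3 (λ h w e → con 3 ⊑ e ∷ con 3 ⊑ e ∷ con 3 ⊑ e ∷ e ⊑ con 2 ⊕ h ∷ 2 ⊛ e ⊑ 2 ⊛ w ∷ [] ⊢ con 7 ⊑ h ⊕ 2 ⊛ w)
    h (l ⊓ (3 + h) + r ⊓ (3 + h)) e 3≤e 3≤e 3≤e (≤-reflexive (sym p)) (*-monoʳ-≤ 2 (≤-reflexive (sym (full p))))
  surplus : ∀ {x y} → Inflow 1 e (2 + h) l r x → Inflow 1 e (2 + h) r l y →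
            5 + 2 * x + 2 * y ≤ h + 2 * (l ⊓ (3 + h) + r ⊓ (3 + h))
  surplus none none = lin 2 (λ h w → 2 ⊛ con 3 ⊑ 2 ⊛ w ∷ [] ⊢ con 5 ⊑ h ⊕ 2 ⊛ w) h (l ⊓ (3 + h) + r ⊓ (3 + h))
    (*-monoʳ-≤ 2 (≤-trans (⊓-sum 3 l r (subst (3 ≤_) (sym (eq refl)) 3≤e))
      (+-mono-≤ (⊓-monoʳ-≤ l (m≤m+n 3 h)) (⊓-monoʳ-≤ r (m≤m+n 3 h)))))
  -- Charge from one side forces height `e`. Then neither minimum cuts its reach, and together they
  -- give `e`.
  surplus (some _ u) none = one-sided (⊔-≡⇒ 1≤e r≤e u)
  surplus none (some _ u) = one-sided (⊔-≡⇒ 1≤e l≤e u)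
  surplus (some p _) (some p′ _) = contradiction (≤-trans 3≤e (≤-trans (≤-reflexive (sym (eq refl))) (+-mono-≤ p p′))) λ { (s≤s (s≤s ())) }

-- Sums around the cycle, and the contradiction for each e

at : ∀ {n} → Vec (ℕ → ℕ) n → ℕ → Vec ℕ n
at []       v = []
at (f ∷ fs) v = f v ∷ at fs v

sums : ∀ {n} → ℕ → Vec (ℕ → ℕ) n → Vec ℕ n
sums L []       = []
sums L (f ∷ fs) = Σ< L f ∷ sums L fs

⟦_⟧Σ : ∀ {n} → Lin n → ℕ → Vec (ℕ → ℕ) n → ℕ
⟦ var i ⟧Σ L fs = lookup (sums L fs) i
⟦ con k ⟧Σ L fs = L * k
⟦ e ⊕ f ⟧Σ L fs = ⟦ e ⟧Σ L fs + ⟦ f ⟧Σ L fs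
⟦ k ⊛ e ⟧Σ L fs = k * ⟦ e ⟧Σ L fs

Σ<-lookup : ∀ {n} L (fs : Vec (ℕ → ℕ) n) i → Σ< L (λ v → lookup (at fs v) i) ≡ lookup (sums L fs) i
Σ<-lookup L (f ∷ fs) Fin.zero    = refl
Σ<-lookup L (f ∷ fs) (Fin.suc i) = Σ<-lookup L fs i

Σ<-lin : ∀ {n} L (e : Lin n) fs → Σ< L (λ v → ⟦ e ⟧ (at fs v)) ≡ ⟦ e ⟧Σ L fs
Σ<-lin L (var i) fs = Σ<-lookup L fs i
Σ<-lin L (con k) fs = Σ<-const L k
Σ<-lin L (e ⊕ f) fs = trans (Σ<-+ L _ _) (cong₂ _+_ (Σ<-lin L e fs) (Σ<-lin L f fs))
Σ<-lin L (k ⊛ e) fs = trans (Σ<-* L k _) (cong (k *_) (Σ<-lin L e fs))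

Σ-ineq : ∀ n L (f : N-ary n (Lin n) (Ineq n)) (fs : Vec (ℕ → ℕ) n) →
         (∀ v → Holds (f $ⁿ vars) (at fs v)) →
         ⟦ Ineq.lhs (f $ⁿ vars) ⟧Σ L fs ≤ ⟦ Ineq.rhs (f $ⁿ vars) ⟧Σ L fs
Σ-ineq n L f fs p = subst₂ _≤_ (Σ<-lin L (Ineq.lhs (f $ⁿ vars)) fs) (Σ<-lin L (Ineq.rhs (f $ⁿ vars)) fs) (Σ<-mono L p)

-- The cycle of H, indexed periodically by ℕ. The parameters t q z h o of the tree at v are those
-- of Shape; l v and r v are the largest heights of the trees before and after v, each reduced by
-- the number of cycle vertices passed on the way from v; L + e is the diameter of G plus 2.
record Profile : Set where
  field
    L e : ℕ
    role : ℕ → Role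
    t q z h o l r : ℕ → ℕ
    shape : ∀ v → Shape (t v) (q v) (z v) (h v) (o v)
    l-suc : ∀ v → l (suc v) ≡ h v ⊔ (l v ∸ 1)
    r-suc : ∀ v → r v ≡ h (suc v) ⊔ (r (suc v) ∸ 1)
    reach≤ : ∀ v → role v ≢ free → l v + r v ≤ e
    reach≡ : ∀ v → role v ≡ off → l v + r v ≡ e
    role-per : ∀ v → role (v + L) ≡ role v
    t-per : ∀ v → t (v + L) ≡ t v
    q-per : ∀ v → q (v + L) ≡ q v
    z-per : ∀ v → z (v + L) ≡ z v
    h-per : ∀ v → h (v + L) ≡ h v
    o-per : ∀ v → o (v + L) ≡ o v
    l-per : ∀ v → l (v + L) ≡ l v
    r-per : ∀ v → r (v + L) ≡ r v
  y p f a aJ st N : ℕ → ℕ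
  y v = matched? (role v)
  p v = onPath? (role v)
  f v = free? (role v)
  a v = y v * is0 (h v)
  aJ v = offPath? (role v) * is0 (h v)
  st v = y v * is1 (h v)
  N v = y v * is2 (t v)

-- G and H have n vertices, k of them matched, m of those on the longest path of G, and ν vertices
-- of G are neither matched nor on that path. A matched vertex v comes from a leaf of G if a v = 1,
-- and from a neighbour of degree 2 of a leaf if N v = 1.
record Census (R : Profile) : Set where
  open Profile R
  field
    k n m ν : ℕ
    Σt : Σ< L t ≡ n
    Σy : Σ< L y ≡ k
    Σp : Σ< L p ≡ m
    n+3≤2k : n + 3 ≤ 2 * k
    2502≤k : 2502 ≤ k
    path : L + e + ν + k ≤ m + n + 1
    -- at most 2i vertices matched onto the path carry trees of size i or less
    on-path : ∀ s → Σ< L (λ v → p v * (s ∸ t v)) + s ≤ s * s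
    leaves≥ : Σ< L a ≤ Σ< L q + 4
    leaves≤ : Σ< L q ≤ Σ< L a + ν + 6
    leaves+ : Σ< L q + Σ< L z ≤ Σ< L a + Σ< L N + ν + 18
    pendants≤ : Σ< L N ≤ Σ< L z + 10

-- A sender has no reach behind it, so all of `e` lies ahead, and the recursions express this by the
-- receiver. For charge moving the other way `l` and `r` are exchanged.
inflow₁ : ∀ ρ h l r h′ l′ r′ → (ρ ≡ off → l + r ≡ 1) → l′ ≡ h ⊔ (l ∸ 1) → r ≡ h′ ⊔ (r′ ∸ 1) →
          Inflow 0 1 h′ l′ r′ (sendR₁ ρ h l)
inflow₁ off 0 0 r h′ l′ r′ eq refl eq′ = some z≤n (trans (sym eq′) (eq refl))
inflow₁ off 0 (suc l) r h′ l′ r′ eq _ _ = none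
inflow₁ off (suc h) l r h′ l′ r′ eq _ _ = none
inflow₁ on h l r h′ l′ r′ eq _ _ = none
inflow₁ free h l r h′ l′ r′ eq _ _ = none

inflow₃ : ∀ ρ e h l r h′ l′ r′ → (ρ ≡ off → l + r ≡ e) → l′ ≡ h ⊔ (l ∸ 1) → r ≡ h′ ⊔ (r′ ∸ 1) →
          Inflow 1 e h′ l′ r′ (sendR₃ ρ h l)
inflow₃ off e 0 0 r h′ l′ r′ eq refl eq′ = some z≤n (trans (sym eq′) (eq refl))
inflow₃ off e 0 (suc l) r h′ l′ r′ eq _ _ = none
inflow₃ off e 1 0 r h′ l′ r′ eq refl eq′ = some ≤-refl (trans (sym eq′) (eq refl))
inflow₃ off e 1 (suc l) r h′ l′ r′ eq _ _ = none
inflow₃ off e (suc (suc h)) l r h′ l′ r′ eq _ _ = none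
inflow₃ on e h l r h′ l′ r′ eq _ _ = none
inflow₃ free e h l r h′ l′ r′ eq _ _ = none

pulled : ∀ ρ h l r h′ l′ r′ → (ρ ≡ off → l + r ≡ 2) → l′ ≡ h ⊔ (l ∸ 1) → r ≡ h′ ⊔ (r′ ∸ 1) →
         Pull h′ l′ r′ (pullR ρ h l)
pulled off 0 0 r h′ l′ r′ eq refl eq′ = more refl (trans (sym eq′) (eq refl))
pulled off 0 (suc l) r h′ l′ r′ eq _ _ = none
pulled off 1 0 r h′ l′ r′ eq refl eq′ = less refl (trans (sym eq′) (eq refl))
pulled off 1 (suc l) r h′ l′ r′ eq _ _ = none
pulled off (suc (suc h)) l r h′ l′ r′ eq _ _ = none
pulled on h l r h′ l′ r′ eq _ _ = none
pulled free h l r h′ l′ r′ eq _ _ = none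

-- The middle vertex is bare with reach 1 on both sides. So its neighbour has height at most 1 and
-- no reach across the middle vertex, which is when a vertex matched off the path pushes.
pushed : ∀ ρ h l h′ l′ r′ r″ → h′ ≡ 0 → l′ ≡ 1 → r′ ≡ 1 → l ≡ h′ ⊔ (l′ ∸ 1) → r′ ≡ h ⊔ r″ → 7 ≤ push ρ h l
pushed on h l h′ l′ r′ r″ refl refl refl refl eq = ≤-refl
pushed free h l h′ l′ r′ r″ refl refl refl refl eq = ≤-refl
pushed off 0 l h′ l′ r′ r″ refl refl refl refl eq = ≤-refl
pushed off 1 l h′ l′ r′ r″ refl refl refl refl eq = ≤-refl
pushed off (suc (suc h)) l h′ l′ r′ r″ refl refl refl refl eq with ≤-trans (m≤m⊔n (2 + h) r″) (≤-reflexive (sym eq))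
... | s≤s ()

≥2 : ℕ → ℕ
≥2 0 = 0
≥2 1 = 0
≥2 (suc (suc _)) = 1

-- Truncated `l − 1` serves as a potential: it drops by one on passing a vertex with `l ≥ 2`, unless
-- the tree there restores it at the expense of `h ∸ 1`.
≥2-step : ∀ h l → ((h ⊔ (l ∸ 1)) ∸ 1) + ≥2 l ≤ (l ∸ 1) + (h ∸ 1)
≥2-step h 0 rewrite ⊔-identityʳ h = ≤-reflexive (+-identityʳ _)
≥2-step h 1 rewrite ⊔-identityʳ h = ≤-reflexive (+-identityʳ _)
≥2-step h (suc (suc l)) = begin
  ((h ⊔ suc l) ∸ 1) + 1    ≡⟨ cong (_+ 1) (∸-distribʳ-⊔ 1 h (suc l)) ⟩
  ((h ∸ 1) ⊔ l) + 1        ≤⟨ +-monoˡ-≤ 1 (m⊔n≤m+n (h ∸ 1) l) ⟩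
  (h ∸ 1) + l + 1          ≤⟨ lin 2 (λ g l → [] ⊢ g ⊕ l ⊕ con 1 ⊑ con 1 ⊕ l ⊕ g) (h ∸ 1) l ⟩
  suc l + (h ∸ 1)          ∎
  where open ≤-Reasoning

role-total : ∀ ρ → 1 ≡ matched? ρ + free? ρ
role-total off  = refl
role-total on   = refl
role-total free = refl

-- The maximum is the next value of `l`. Summed around the cycle the reaches therefore cancel, and
-- the minima sum to the heights.
⊔-⊓ : ∀ h l → h + l ≡ (h ⊔ (l ∸ 1)) + (l ⊓ suc h)
⊔-⊓ h zero = cong (_+ 0) (sym (⊔-identityʳ h))
⊔-⊓ h (suc l) with ≤-total h l
... | inj₁ p rewrite m≤n⇒m⊔n≡n p | m≥n⇒m⊓n≡n p = trans (+-suc h l) (trans (cong suc (+-comm h l)) (sym (+-suc l h)))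
... | inj₂ p rewrite m≥n⇒m⊔n≡m p | m≤n⇒m⊓n≡m p = refl

size≥1 : ∀ {t q z h o} → Shape t q z h o → 1 ≤ t
size≥1 bare = ≤-refl
size≥1 (star q) = s≤s z≤n
size≥1 (tall _ _ _ _ _ _ _) = s≤s z≤n

-- Kept apart from `Profile`, because the reach bounds that a profile records already depend on
-- `few-on-path`.
module Budget (L e k n m ν : ℕ) (role : ℕ → Role) (t : ℕ → ℕ) (t≥1 : ∀ v → 1 ≤ t v)
  (Σt : Σ< L t ≡ n) (Σy : Σ< L (λ v → matched? (role v)) ≡ k) (Σp : Σ< L (λ v → onPath? (role v)) ≡ m)
  (n+3≤2k : n + 3 ≤ 2 * k) (path : L + e + ν + k ≤ m + n + 1)
  (on-path : ∀ s → Σ< L (λ v → onPath? (role v) * (s ∸ t v)) + s ≤ s * s) where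

  private
    S : (ℕ → ℕ) → ℕ
    S = Σ< L
    y p f : ℕ → ℕ
    y v = matched? (role v)
    p v = onPath? (role v)
    f v = free? (role v)

  pt : ℕ → ℕ
  pt v = p v * t v

  size : S f + k ≡ L
  size = begin-equality
    S f + k         ≡⟨ cong (S f +_) (sym Σy) ⟩
    S f + S y       ≡⟨ +-comm (S f) (S y) ⟩
    S y + S f       ≡⟨ sym (Σ<-+ L y f) ⟩
    S (λ v → y v + f v) ≡⟨ sym (Σ<-cong L (λ v → role-total (role v))) ⟩
    S (λ _ → 1)     ≡⟨ Σ<-const L 1 ⟩
    L * 1           ≡⟨ *-identityʳ L ⟩
    L               ∎
    where open ≤-Reasoning

  slack : S f + e + ν + 2 ≤ m
  slack = lin 7 (λ F e ν k L m n → L ⊕ e ⊕ ν ⊕ k ⊑ m ⊕ n ⊕ con 1 ∷ F ⊕ k ⊑ L ∷ n ⊕ con 3 ⊑ 2 ⊛ k ∷ [] ⊢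
            F ⊕ e ⊕ ν ⊕ con 2 ⊑ m)
    (S f) e ν k L m n path (≤-reflexive size) n+3≤2k

  -- Each tree matched onto the path has `s` vertices up to a deficit, and `on-path` bounds the
  -- deficits by `s * s − s` in total.
  weigh : ∀ s → s * m + s ≤ S pt + s * s
  weigh s = lin 5 (λ A w d s s² → A ⊑ w ⊕ d ∷ d ⊕ s ⊑ s² ∷ [] ⊢ A ⊕ s ⊑ w ⊕ s²)
      (s * m) (S pt) (S (λ v → p v * (s ∸ t v))) s (s * s)
      (subst (λ x → s * x ≤ S pt + S (λ v → p v * (s ∸ t v))) Σp summed) (on-path s)
    where
    local : ∀ v → s * p v ≤ p v * t v + p v * (s ∸ t v)
    local v = begin
      s * p v                    ≡⟨ *-comm s (p v) ⟩
      p v * s                    ≤⟨ *-monoʳ-≤ (p v) (m≤n+m∸n s (t v)) ⟩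
      p v * (t v + (s ∸ t v))    ≡⟨ *-distribˡ-+ (p v) (t v) _ ⟩
      p v * t v + p v * (s ∸ t v) ∎
      where open ≤-Reasoning
    summed : s * S p ≤ S pt + S (λ v → p v * (s ∸ t v))
    summed = Σ-ineq 3 L (λ p d w → s ⊛ p ⊑ w ⊕ d) (p ∷ (λ v → p v * (s ∸ t v)) ∷ pt ∷ []) local

  -- The trees matched onto the path share n with all other matched vertices, each of which takes at
  -- least one vertex. The choice `s = 51` is close to the square root of the least possible `k`,
  -- which balances the gain `s * m` against the loss `s * s`.
  few-on-path : 50 * m ≤ k + 2547
  few-on-path = lin 4 (λ m w k n → 51 ⊛ m ⊕ con 51 ⊑ w ⊕ con 2601 ∷ w ⊕ k ⊑ n ⊕ m ∷ n ⊕ con 3 ⊑ 2 ⊛ k ∷ [] ⊢ 50 ⊛ m ⊑ k ⊕ con 2547)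
      m (S pt) k n (weigh 51) (subst₂ (λ a b → S pt + a ≤ b) Σy (cong₂ _+_ Σt Σp) summed) n+3≤2k
    where
    local : ∀ ρ {t} → 1 ≤ t → onPath? ρ * t + matched? ρ ≤ t + onPath? ρ
    local off  p = ≤-trans p (≤-reflexive (sym (+-identityʳ _)))
    local on  {t} p = ≤-reflexive (cong (_+ 1) (+-identityʳ t))
    local free p = z≤n
    summed : S pt + S y ≤ S t + S p
    summed = Σ-ineq 4 L (λ w y t p → w ⊕ y ⊑ t ⊕ p) (pt ∷ y ∷ t ∷ p ∷ []) (λ v → local (role v) (t≥1 v))

module Contradictions (R : Profile) (C : Census R) where
  open Profile R
  open Census C

  S : (ℕ → ℕ) → ℕ
  S = Σ< L

  shift : ∀ g → (∀ v → g (v + L) ≡ g v) → S (g ∘ suc) ≡ S g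
  shift g per = Σ<-shift L g (per 0)

  shift₂ : ∀ g → (∀ v → g (v + L) ≡ g v) → S (g ∘ (2 +_)) ≡ S g
  shift₂ g per = trans (Σ<-shift L (g ∘ suc) (per 1)) (shift g per)

  y-per : ∀ v → y (v + L) ≡ y v
  y-per v = cong matched? (role-per v)
  p-per : ∀ v → p (v + L) ≡ p v
  p-per v = cong onPath? (role-per v)
  f-per : ∀ v → f (v + L) ≡ f v
  f-per v = cong free? (role-per v)
  a-per : ∀ v → a (v + L) ≡ a v
  a-per v = cong₂ _*_ (y-per v) (cong is0 (h-per v))
  aJ-per : ∀ v → aJ (v + L) ≡ aJ v
  aJ-per v = cong₂ _*_ (cong offPath? (role-per v)) (cong is0 (h-per v))
  st-per : ∀ v → st (v + L) ≡ st v
  st-per v = cong₂ _*_ (y-per v) (cong is1 (h-per v))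
  N-per : ∀ v → N (v + L) ≡ N v
  N-per v = cong₂ _*_ (y-per v) (cong is2 (t-per v))

  open Budget L e k n m ν role t (λ v → size≥1 (shape v)) Σt Σy Σp n+3≤2k path on-path public

  bare-off : S a ≤ S aJ + m
  bare-off = subst (λ x → S a ≤ S aJ + x) Σp (Σ-ineq 3 L (λ a j p → a ⊑ j ⊕ p) (a ∷ aJ ∷ p ∷ [])
               (λ v → local (role v) (h v)))
    where
    local : ∀ ρ h → matched? ρ * is0 h ≤ offPath? ρ * is0 h + onPath? ρ
    local off  h = ≤-reflexive (sym (+-identityʳ _))
    local on 0 = ≤-refl
    local on (suc h) = z≤n
    local free h = z≤n

  -- A matched vertex is bare or its tree has a leaf, and by `leaves≤` the leaves hardly outnumber
  -- the bare matched vertices.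
  matched-bound : k ≤ 2 * S a + ν + 6
  matched-bound = lin 4 (λ k a q ν → k ⊑ a ⊕ q ∷ q ⊑ a ⊕ ν ⊕ con 6 ∷ [] ⊢ k ⊑ 2 ⊛ a ⊕ ν ⊕ con 6)
      k (S a) (S q) ν (subst (_≤ S a + S q) Σy
        (Σ-ineq 3 L (λ y a q → y ⊑ a ⊕ q) (y ∷ a ∷ q ∷ []) (λ v → local (role v) (shape v)))) leaves≤
    where
    local : ∀ ρ {t q z h o} → Shape t q z h o → matched? ρ ≤ matched? ρ * is0 h + q
    local off bare = ≤-refl
    local off (star q) = s≤s z≤n
    local off (tall q _ _ _ _ _ _) = s≤s z≤n
    local on bare = ≤-refl
    local on (star q) = s≤s z≤n
    local on (tall q _ _ _ _ _ _) = s≤s z≤n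
    local free s = z≤n

  e≢1 : e ≢ 1
  e≢1 e≡1 = contradiction numbers λ ()
    where
    sR sL : ℕ → ℕ
    sR v = sendR₁ (role v) (h v) (l v)
    sL v = sendR₁ (role v) (h v) (r v)
    reach : ∀ v → role v ≡ off → l v + r v ≡ 1
    reach v j = trans (reach≡ v j) e≡1
    -- The local inequality is taken at `suc v`, so that the left neighbour has an index.
    -- Periodicity removes the shifts in `flow′`, where the charge sent and received cancels.
    flow : S (a ∘ suc) + 2 * S sR + 2 * S (sL ∘ (2 +_)) + S (aJ ∘ suc)
         ≤ 2 * S (st ∘ suc) + 2 * S (sR ∘ suc) + 2 * S (sL ∘ suc) + 2 * S (p ∘ suc) + 4 * S (f ∘ suc)
    flow = Σ-ineq 9 L (λ a sR sL₂ aJ st sR₁ sL₁ p f → a ⊕ 2 ⊛ sR ⊕ 2 ⊛ sL₂ ⊕ aJ ⊑ 2 ⊛ st ⊕ 2 ⊛ sR₁ ⊕ 2 ⊛ sL₁ ⊕ 2 ⊛ p ⊕ 4 ⊛ f)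
      (a ∘ suc ∷ sR ∷ sL ∘ (2 +_) ∷ aJ ∘ suc ∷ st ∘ suc ∷ sR ∘ suc ∷ sL ∘ suc ∷ p ∘ suc ∷ f ∘ suc ∷ [])
      (λ v → local₁ (role (suc v)) (h (suc v)) (l (suc v)) (r (suc v)) (sR v) (sL (suc (suc v)))
        (λ i → ≤-trans (reach≤ (suc v) i) (≤-reflexive e≡1)) (reach (suc v))
        (inflow₁ (role v) (h v) (l v) (r v) _ _ _ (reach v) (l-suc v) (r-suc v))
        (inflow₁ (role (suc (suc v))) (h (suc (suc v))) (r (suc (suc v))) (l (suc (suc v))) _ _ _
          (λ j → trans (+-comm (r (suc (suc v))) _) (reach (suc (suc v)) j)) (r-suc (suc v)) (l-suc (suc v))))
    sR-per : ∀ v → sR (v + L) ≡ sR v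
    sR-per v rewrite role-per v | h-per v | l-per v = refl
    sL-per : ∀ v → sL (v + L) ≡ sL v
    sL-per v rewrite role-per v | h-per v | r-per v = refl
    flow′ : S a + 2 * S sR + 2 * S sL + S aJ ≤ 2 * S st + 2 * S sR + 2 * S sL + 2 * m + 4 * S f
    flow′ = subst₂ _≤_
      (cong₂ _+_ (cong₂ _+_ (cong (_+ 2 * S sR) (shift a a-per)) (cong (2 *_) (shift₂ sL sL-per))) (shift aJ aJ-per))
      (cong₂ _+_ (cong₂ _+_ (cong₂ _+_ (cong₂ _+_ (cong (2 *_) (shift st st-per)) (cong (2 *_) (shift sR sR-per)))
        (cong (2 *_) (shift sL sL-per))) (cong (2 *_) (trans (shift p p-per) Σp))) (cong (4 *_) (shift f f-per)))
      flow
    -- A star has two leaves, or it has one and then size 2, where `N` adds the missing unit.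
    stars : 2 * S st + S z ≤ S q + S N
    stars = Σ-ineq 4 L (λ st z q N → 2 ⊛ st ⊕ z ⊑ q ⊕ N) (st ∷ z ∷ q ∷ N ∷ []) (λ v → local (role v) (shape v))
      where
      local : ∀ ρ {t q z h o} → Shape t q z h o → 2 * (matched? ρ * is1 h) + z ≤ q + matched? ρ * is2 t
      local off bare = z≤n
      local off (star zero) = ≤-refl
      local off (star (suc q)) = s≤s (s≤s z≤n)
      local off (tall q z h o ho zq qz) = ≤-trans zq (m≤m+n _ _)
      local on bare = z≤n
      local on (star zero) = ≤-refl
      local on (star (suc q)) = s≤s (s≤s z≤n)
      local on (tall q z h o ho zq qz) = ≤-trans zq (m≤m+n _ _)
      local free bare = z≤n
      local free (star q) = z≤n
      local free (tall q z h o ho zq qz) = ≤-trans zq (m≤m+n _ _)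
    bound : 2 * S a ≤ S a + ν + 16 + 3 * m + 4 * S f
    bound = lin 12 (λ a sR sL j st m f z q N ν k →
        a ⊕ 2 ⊛ sR ⊕ 2 ⊛ sL ⊕ j ⊑ 2 ⊛ st ⊕ 2 ⊛ sR ⊕ 2 ⊛ sL ⊕ 2 ⊛ m ⊕ 4 ⊛ f ∷ 2 ⊛ st ⊕ z ⊑ q ⊕ N ∷
        q ⊑ a ⊕ ν ⊕ con 6 ∷ N ⊑ z ⊕ con 10 ∷ a ⊑ j ⊕ m ∷ [] ⊢ 2 ⊛ a ⊑ a ⊕ ν ⊕ con 16 ⊕ 3 ⊛ m ⊕ 4 ⊛ f)
      (S a) (S sR) (S sL) (S aJ) (S st) m (S f) (S z) (S q) (S N) ν k flow′ stars leaves≤ pendants≤ bare-off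
    summary : k ≤ 14 * m + 38
    summary = lin 6 (λ k a ν m f e → k ⊑ 2 ⊛ a ⊕ ν ⊕ con 6 ∷
        2 ⊛ (2 ⊛ a) ⊑ 2 ⊛ (a ⊕ ν ⊕ con 16 ⊕ 3 ⊛ m ⊕ 4 ⊛ f) ∷ 8 ⊛ (f ⊕ e ⊕ ν ⊕ con 2) ⊑ 8 ⊛ m ∷ [] ⊢ k ⊑ 14 ⊛ m ⊕ con 38)
      k (S a) ν m (S f) e matched-bound (*-monoʳ-≤ 2 bound) (*-monoʳ-≤ 8 slack)
    numbers : 1 ≤ 0
    -- Eliminating `m` bounds `36 * k`, where 36 = 50 - 14, by a constant below `36 * 2502`.
    numbers = lin 2 (λ k m → 50 ⊛ k ⊑ 50 ⊛ (14 ⊛ m ⊕ con 38) ∷ 14 ⊛ (50 ⊛ m) ⊑ 14 ⊛ (k ⊕ con 2547) ∷ 36 ⊛ con 2502 ⊑ 36 ⊛ k ∷ []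
        ⊢ con 1 ⊑ con 0)
      k m (*-monoʳ-≤ 50 summary) (*-monoʳ-≤ 14 few-on-path) (*-monoʳ-≤ 36 2502≤k)

  e≢2 : e ≢ 2
  e≢2 e≡2 = contradiction numbers λ ()
    where
    uR uL sR sL : ℕ → ℕ
    uR v = pullR (role v) (h v) (l v)
    uL v = pullR (role v) (h v) (r v)
    sL v = push (role v) (h v) (l v)
    sR v = push (role v) (h v) (r v)
    reach : ∀ v → role v ≡ off → l v + r v ≡ 2
    reach v j = trans (reach≡ v j) e≡2
    uR-per : ∀ v → uR (v + L) ≡ uR v
    uR-per v rewrite role-per v | h-per v | l-per v = refl
    uL-per : ∀ v → uL (v + L) ≡ uL v
    uL-per v rewrite role-per v | h-per v | r-per v = refl
    sR-per : ∀ v → sR (v + L) ≡ sR v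
    sR-per v rewrite role-per v | h-per v | r-per v = refl
    sL-per : ∀ v → sL (v + L) ≡ sL v
    sL-per v rewrite role-per v | h-per v | l-per v = refl
    pt-per : ∀ v → pt (v + L) ≡ pt v
    pt-per v = cong₂ _*_ (p-per v) (t-per v)
    local : ∀ v →
      9 * a (suc v) + 9 * N (suc v) + 6 + 2 * aJ (suc v) + 3 * pt (suc v) + (uR v + uL (2 + v)) + (sL (suc v) + sR (suc v))
      ≤ 9 * (q (suc v) + z (suc v)) + 3 * t (suc v) + (uR (suc v) + uL (suc v)) + (sL (2 + v) + sR v)
          + 38 * f (suc v) + 44 * p (suc v)
    local v = local₂ (role u) (l u) (r u) (uR v) (uL (suc u)) (sL (suc u)) (sR v) (shape u)
      (λ i → ≤-trans (reach≤ u i) (≤-reflexive e≡2)) (reach u)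
      (pulled (role v) (h v) (l v) (r v) _ _ _ (reach v) (l-suc v) (r-suc v))
      (pulled (role (suc u)) (h (suc u)) (r (suc u)) (l (suc u)) _ _ _
        (λ j → trans (+-comm (r (suc u)) _) (reach (suc u) j)) (r-suc u) (l-suc u))
      (λ _ h≡0 l≡1 r≡1 →
        pushed (role (suc u)) (h (suc u)) (l (suc u)) (h u) (l u) (r u) _ h≡0 l≡1 r≡1 (l-suc u) (r-suc u) ,
        pushed (role v) (h v) (r v) (h u) (r u) (l u) _ h≡0 r≡1 l≡1 (r-suc v) (l-suc v))
      where u = suc v
    flow : 9 * S (a ∘ suc) + 9 * S (N ∘ suc) + L * 6 + 2 * S (aJ ∘ suc) + 3 * S (pt ∘ suc)
             + (S uR + S (uL ∘ (2 +_))) + (S (sL ∘ suc) + S (sR ∘ suc))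
         ≤ 9 * (S (q ∘ suc) + S (z ∘ suc)) + 3 * S (t ∘ suc) + (S (uR ∘ suc) + S (uL ∘ suc))
             + (S (sL ∘ (2 +_)) + S sR) + 38 * S (f ∘ suc) + 44 * S (p ∘ suc)
    flow = Σ-ineq 17 L (λ a N j w x y s s′ q z t u u′ x′ y′ f g →
          9 ⊛ a ⊕ 9 ⊛ N ⊕ con 6 ⊕ 2 ⊛ j ⊕ 3 ⊛ w ⊕ (x ⊕ y) ⊕ (s ⊕ s′)
            ⊑ 9 ⊛ (q ⊕ z) ⊕ 3 ⊛ t ⊕ (u ⊕ u′) ⊕ (x′ ⊕ y′) ⊕ 38 ⊛ f ⊕ 44 ⊛ g)
      (a ∘ suc ∷ N ∘ suc ∷ aJ ∘ suc ∷ pt ∘ suc ∷ uR ∷ uL ∘ (2 +_) ∷ sL ∘ suc ∷ sR ∘ suc ∷ q ∘ suc ∷ z ∘ suc ∷ t ∘ suc ∷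
        uR ∘ suc ∷ uL ∘ suc ∷ sL ∘ (2 +_) ∷ sR ∷ f ∘ suc ∷ p ∘ suc ∷ [])
      local
    flow′ : 9 * S a + 9 * S N + L * 6 + 2 * S aJ + 3 * S pt + (S uR + S uL) + (S sL + S sR)
          ≤ 9 * (S q + S z) + 3 * n + (S uR + S uL) + (S sL + S sR) + 38 * S f + 44 * m
    flow′ = subst₂ _≤_
      (cong₂ _+_ (cong₂ _+_ (cong₂ _+_ (cong₂ _+_ (cong (_+ L * 6) (cong₂ _+_ (cong (9 *_) (shift a a-per)) (cong (9 *_) (shift N N-per))))
        (cong (2 *_) (shift aJ aJ-per))) (cong (3 *_) (shift pt pt-per))) (cong (S uR +_) (shift₂ uL uL-per)))
        (cong₂ _+_ (shift sL sL-per) (shift sR sR-per)))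
      (cong₂ _+_ (cong₂ _+_ (cong₂ _+_ (cong₂ _+_ (cong₂ _+_ (cong (9 *_) (cong₂ _+_ (shift q q-per) (shift z z-per)))
        (cong (3 *_) (trans (shift t t-per) Σt))) (cong₂ _+_ (shift uR uR-per) (shift uL uL-per)))
        (cong (_+ S sR) (shift₂ sL sL-per))) (cong (38 *_) (shift f f-per))) (cong (44 *_) (trans (shift p p-per) Σp)))
      flow
    -- A vertex matched onto the path costs 44 directly and up to 32 = 38 - 6 through the unmatched
    -- vertices that `slack` charges to it. The factor 26 is the least `s` for which the gain
    -- `3 * s` covers these 76.
    bound : 2 * S aJ ≤ 2039
    bound = lin 16 (λ a N L6 j w u u′ s s′ q z n f m ν k →
        9 ⊛ a ⊕ 9 ⊛ N ⊕ L6 ⊕ 2 ⊛ j ⊕ 3 ⊛ w ⊕ (u ⊕ u′) ⊕ (s ⊕ s′)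
          ⊑ 9 ⊛ (q ⊕ z) ⊕ 3 ⊛ n ⊕ (u ⊕ u′) ⊕ (s ⊕ s′) ⊕ 38 ⊛ f ⊕ 44 ⊛ m ∷
        9 ⊛ (q ⊕ z) ⊑ 9 ⊛ (a ⊕ N ⊕ ν ⊕ con 18) ∷
        6 ⊛ (f ⊕ k) ⊑ L6 ∷ 3 ⊛ (n ⊕ con 3) ⊑ 3 ⊛ (2 ⊛ k) ∷ 3 ⊛ (26 ⊛ m ⊕ con 26) ⊑ 3 ⊛ (w ⊕ con 676) ∷
        32 ⊛ (f ⊕ ν ⊕ con 2) ⊑ 32 ⊛ m ∷ [] ⊢ 2 ⊛ j ⊑ con 2039)
      (S a) (S N) (L * 6) (S aJ) (S pt) (S uR) (S uL) (S sL) (S sR) (S q) (S z) n (S f) m ν k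
      flow′ (*-monoʳ-≤ 9 leaves+) (≤-reflexive (trans (cong (6 *_) size) (*-comm 6 L))) (*-monoʳ-≤ 3 n+3≤2k)
      (*-monoʳ-≤ 3 (weigh 26)) (*-monoʳ-≤ 32 (lin 4 (λ f e ν m → f ⊕ e ⊕ ν ⊕ con 2 ⊑ m ∷ [] ⊢ f ⊕ ν ⊕ con 2 ⊑ m) (S f) e ν m slack))
    summary : k ≤ 3 * m + 2045
    summary = lin 7 (λ k a ν m f e j → k ⊑ 2 ⊛ a ⊕ ν ⊕ con 6 ∷ 2 ⊛ a ⊑ 2 ⊛ (j ⊕ m) ∷ 2 ⊛ j ⊑ con 2039 ∷
        f ⊕ e ⊕ ν ⊕ con 2 ⊑ m ∷ [] ⊢ k ⊑ 3 ⊛ m ⊕ con 2045)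
      k (S a) ν m (S f) e (S aJ) matched-bound (*-monoʳ-≤ 2 bare-off) bound slack
    numbers : 1 ≤ 0
    numbers = lin 2 (λ k m → 50 ⊛ k ⊑ 50 ⊛ (3 ⊛ m ⊕ con 2045) ∷ 3 ⊛ (50 ⊛ m) ⊑ 3 ⊛ (k ⊕ con 2547) ∷ 47 ⊛ con 2502 ⊑ 47 ⊛ k ∷ []
        ⊢ con 1 ⊑ con 0)
      k m (*-monoʳ-≤ 50 summary) (*-monoʳ-≤ 3 few-on-path) (*-monoʳ-≤ 47 2502≤k)

  e≱3 : ¬ 3 ≤ e
  e≱3 3≤e = contradiction numbers λ ()
    where
    sR sL mL mR h₁ nb : ℕ → ℕ
    sR v = sendR₃ (role v) (h v) (l v)
    sL v = sendR₃ (role v) (h v) (r v)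
    mL v = l v ⊓ suc (h v)
    mR v = r v ⊓ suc (h v)
    h₁ v = h v ∸ 1
    nb v = pos (h v)
    sR-per : ∀ v → sR (v + L) ≡ sR v
    sR-per v rewrite role-per v | h-per v | l-per v = refl
    sL-per : ∀ v → sL (v + L) ≡ sL v
    sL-per v rewrite role-per v | h-per v | r-per v = refl
    mL-per : ∀ v → mL (v + L) ≡ mL v
    mL-per v rewrite h-per v | l-per v = refl
    h₁-per : ∀ v → h₁ (v + L) ≡ h₁ v
    h₁-per v rewrite h-per v = refl
    nb-per : ∀ v → nb (v + L) ≡ nb v
    nb-per v rewrite h-per v = refl
    pt-per : ∀ v → pt (v + L) ≡ pt v
    pt-per v = cong₂ _*_ (p-per v) (t-per v)
    local : ∀ v →
      h₁ (suc v) + pt (suc v) + 8 + 2 * nb (suc v) + 2 * sR v + 2 * sL (2 + v) + 4 * h (suc v)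
      ≤ 2 * (2 * t (suc v) + (mL (suc v) + mR (suc v)) + o (suc v)) + 2 * sR (suc v) + 2 * sL (suc v) + 10 * f (suc v) + 13 * p (suc v)
    local v = local₃ (role u) e (l u) (r u) (sR v) (sL (suc u)) 3≤e (shape u) (reach≤ u) (reach≡ u)
      (inflow₃ (role v) e (h v) (l v) (r v) _ _ _ (reach≡ v) (l-suc v) (r-suc v))
      (inflow₃ (role (suc u)) e (h (suc u)) (r (suc u)) (l (suc u)) _ _ _
        (λ j → trans (+-comm (r (suc u)) _) (reach≡ (suc u) j)) (r-suc u) (l-suc u))
      where u = suc v
    flow : S (h₁ ∘ suc) + S (pt ∘ suc) + L * 8 + 2 * S (nb ∘ suc) + 2 * S sR + 2 * S (sL ∘ (2 +_)) + 4 * S (h ∘ suc)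
         ≤ 2 * (2 * S (t ∘ suc) + (S (mL ∘ suc) + S (mR ∘ suc)) + S (o ∘ suc)) + 2 * S (sR ∘ suc) + 2 * S (sL ∘ suc)
             + 10 * S (f ∘ suc) + 13 * S (p ∘ suc)
    flow = Σ-ineq 14 L (λ h₁ w nb s s′ h t x y o u u′ f p →
          h₁ ⊕ w ⊕ con 8 ⊕ 2 ⊛ nb ⊕ 2 ⊛ s ⊕ 2 ⊛ s′ ⊕ 4 ⊛ h ⊑ 2 ⊛ (2 ⊛ t ⊕ (x ⊕ y) ⊕ o) ⊕ 2 ⊛ u ⊕ 2 ⊛ u′ ⊕ 10 ⊛ f ⊕ 13 ⊛ p)
      (h₁ ∘ suc ∷ pt ∘ suc ∷ nb ∘ suc ∷ sR ∷ sL ∘ (2 +_) ∷ h ∘ suc ∷ t ∘ suc ∷ mL ∘ suc ∷ mR ∘ suc ∷ o ∘ suc ∷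
        sR ∘ suc ∷ sL ∘ suc ∷ f ∘ suc ∷ p ∘ suc ∷ [])
      local
    ΣmL : S (mL ∘ suc) ≡ S h
    ΣmL = trans (shift mL mL-per) (sym (+-cancelʳ-≡ (S l) _ _ (begin-equality
      S h + S l                  ≡⟨ sym (Σ<-+ L h l) ⟩
      S (λ v → h v + l v)        ≡⟨ Σ<-cong L (λ v → trans (⊔-⊓ (h v) (l v)) (cong (_+ mL v) (sym (l-suc v)))) ⟩
      S (λ v → l (suc v) + mL v) ≡⟨ Σ<-+ L (l ∘ suc) mL ⟩
      S (l ∘ suc) + S mL         ≡⟨ cong (_+ S mL) (shift l l-per) ⟩
      S l + S mL                 ≡⟨ +-comm (S l) _ ⟩
      S mL + S l                 ∎)))
      where open ≤-Reasoning
    ΣmR : S (mR ∘ suc) ≡ S h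
    ΣmR = sym (+-cancelʳ-≡ (S r) _ _ (begin-equality
      S h + S r                              ≡⟨ cong₂ _+_ (sym (shift h h-per)) (sym (shift r r-per)) ⟩
      S (h ∘ suc) + S (r ∘ suc)              ≡⟨ sym (Σ<-+ L (h ∘ suc) (r ∘ suc)) ⟩
      S (λ v → h (suc v) + r (suc v))        ≡⟨ Σ<-cong L (λ v → trans (⊔-⊓ (h (suc v)) (r (suc v))) (cong (_+ mR (suc v)) (sym (r-suc v)))) ⟩
      S (λ v → r v + mR (suc v))             ≡⟨ Σ<-+ L r (mR ∘ suc) ⟩
      S r + S (mR ∘ suc)                     ≡⟨ +-comm (S r) _ ⟩
      S (mR ∘ suc) + S r                     ∎))
      where open ≤-Reasoning
    flow′ : S h₁ + S pt + L * 8 + 2 * S nb + 2 * S sR + 2 * S sL + 4 * S h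
          ≤ 2 * (2 * n + (S h + S h) + S o) + 2 * S sR + 2 * S sL + 10 * S f + 13 * m
    flow′ = subst₂ _≤_
      (cong₂ _+_ (cong₂ _+_ (cong₂ _+_ (cong₂ _+_ (cong (_+ L * 8) (cong₂ _+_ (shift h₁ h₁-per) (shift pt pt-per)))
        (cong (2 *_) (shift nb nb-per))) (refl {x = 2 * S sR})) (cong (2 *_) (shift₂ sL sL-per))) (cong (4 *_) (shift h h-per)))
      (cong₂ _+_ (cong₂ _+_ (cong₂ _+_ (cong₂ _+_ (cong (2 *_) (cong₂ _+_ (cong₂ _+_ (cong (2 *_) (trans (shift t t-per) Σt))
        (cong₂ _+_ ΣmL ΣmR)) (shift o o-per))) (cong (2 *_) (shift sR sR-per))) (cong (2 *_) (shift sL sL-per)))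
        (cong (10 *_) (shift f f-per))) (cong (13 *_) (trans (shift p p-per) Σp)))
      flow
    parts : L * 1 + S q + S o ≤ n
    parts = subst (L * 1 + S q + S o ≤_) Σt (Σ-ineq 3 L (λ q o t → con 1 ⊕ q ⊕ o ⊑ t) (q ∷ o ∷ t ∷ []) (λ v → ≤-reflexive (local′ (shape v))))
      where
      local′ : ∀ {t q z h o} → Shape t q z h o → 1 + q + o ≡ t
      local′ bare = refl
      local′ (star q) = cong (2 +_) (+-identityʳ q)
      local′ (tall _ _ _ _ _ _ _) = refl
    hanging : k ≤ S a + S nb
    hanging = subst (_≤ S a + S nb) Σy (Σ-ineq 3 L (λ y a nb → y ⊑ a ⊕ nb) (y ∷ a ∷ nb ∷ []) (λ v → local′ (role v) (h v)))
      where
      local′ : ∀ ρ h → matched? ρ ≤ matched? ρ * is0 h + pos h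
      local′ off  0 = ≤-refl
      local′ off  (suc h) = ≤-refl
      local′ on   0 = ≤-refl
      local′ on   (suc h) = ≤-refl
      local′ free h = z≤n
    -- The factor 13 cancels the cost of vertices matched onto the path, and the cost 10 of the
    -- unmatched ones disappears in `size`. What is left is 146 = (169 - 13) + 8 - 18, with 8 from
    -- `leaves≥` and 18 from `n+3≤2k`.
    heights : S h₁ ≤ 146
    heights = lin 15 (λ h₁ w L8 nb s s′ h n o f m L k a q →
        h₁ ⊕ w ⊕ L8 ⊕ 2 ⊛ nb ⊕ 2 ⊛ s ⊕ 2 ⊛ s′ ⊕ 4 ⊛ h ⊑ 2 ⊛ (2 ⊛ n ⊕ (h ⊕ h) ⊕ o) ⊕ 2 ⊛ s ⊕ 2 ⊛ s′ ⊕ 10 ⊛ f ⊕ 13 ⊛ m ∷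
        10 ⊛ (f ⊕ k) ⊑ L8 ⊕ 2 ⊛ L ∷ 2 ⊛ (L ⊕ q ⊕ o) ⊑ 2 ⊛ n ∷ 2 ⊛ k ⊑ 2 ⊛ (a ⊕ nb) ∷ 2 ⊛ a ⊑ 2 ⊛ (q ⊕ con 4) ∷
        6 ⊛ (n ⊕ con 3) ⊑ 6 ⊛ (2 ⊛ k) ∷ 13 ⊛ m ⊕ con 13 ⊑ w ⊕ con 169 ∷ [] ⊢ h₁ ⊑ con 146)
      (S h₁) (S pt) (L * 8) (S nb) (S sR) (S sL) (S h) n (S o) (S f) m (L * 1) k (S a) (S q)
      flow′ (≤-reflexive (trans (cong (10 *_) size) ten)) (*-monoʳ-≤ 2 parts) (*-monoʳ-≤ 2 hanging)
      (*-monoʳ-≤ 2 leaves≥) (*-monoʳ-≤ 6 n+3≤2k) (weigh 13)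
      where
      ten : 10 * L ≡ L * 8 + 2 * (L * 1)
      ten = begin-equality
        10 * L             ≡⟨ *-distribʳ-+ L 8 2 ⟩
        8 * L + 2 * L      ≡⟨ cong₂ _+_ (*-comm 8 L) (cong (2 *_) (sym (*-identityʳ L))) ⟩
        L * 8 + 2 * (L * 1) ∎
        where open ≤-Reasoning
    farL : S (≥2 ∘ l) ≤ S h₁
    farL = lin 4 (λ l′ b l h → l′ ⊕ b ⊑ l ⊕ h ∷ l ⊑ l′ ∷ [] ⊢ b ⊑ h) (S (λ v → l (suc v) ∸ 1)) (S (≥2 ∘ l)) (S (λ v → l v ∸ 1)) (S h₁)
      (Σ-ineq 4 L (λ l′ b l h → l′ ⊕ b ⊑ l ⊕ h) ((λ v → l (suc v) ∸ 1) ∷ ≥2 ∘ l ∷ (λ v → l v ∸ 1) ∷ h₁ ∷ [])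
        (λ v → subst (λ x → (x ∸ 1) + ≥2 (l v) ≤ (l v ∸ 1) + h₁ v) (sym (l-suc v)) (≥2-step (h v) (l v))))
      (≤-reflexive (sym (shift (λ v → l v ∸ 1) (λ v → cong (_∸ 1) (l-per v)))))
    farR : S (≥2 ∘ r) ≤ S h₁
    farR = lin 6 (λ r b′ r′ h′ b h → r ⊕ b′ ⊑ r′ ⊕ h′ ∷ r′ ⊑ r ∷ b ⊑ b′ ∷ h′ ⊑ h ∷ [] ⊢ b ⊑ h)
      (S (λ v → r v ∸ 1)) (S (λ v → ≥2 (r (suc v)))) (S (λ v → r (suc v) ∸ 1)) (S (h₁ ∘ suc)) (S (≥2 ∘ r)) (S h₁)
      (Σ-ineq 4 L (λ r b r′ h → r ⊕ b ⊑ r′ ⊕ h) ((λ v → r v ∸ 1) ∷ (λ v → ≥2 (r (suc v))) ∷ (λ v → r (suc v) ∸ 1) ∷ h₁ ∘ suc ∷ [])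
        (λ v → subst (λ x → (x ∸ 1) + ≥2 (r (suc v)) ≤ (r (suc v) ∸ 1) + h₁ (suc v)) (sym (r-suc v)) (≥2-step (h (suc v)) (r (suc v)))))
      (≤-reflexive (shift (λ v → r v ∸ 1) (λ v → cong (_∸ 1) (r-per v))))
      (≤-reflexive (sym (shift (≥2 ∘ r) (λ v → cong ≥2 (r-per v)))))
      (≤-reflexive (shift h₁ h₁-per))
    -- Reaches that sum to at least 3 are not both below 2.
    far : S aJ ≤ S (≥2 ∘ l) + S (≥2 ∘ r)
    far = Σ-ineq 3 L (λ a x y → a ⊑ x ⊕ y) (aJ ∷ ≥2 ∘ l ∷ ≥2 ∘ r ∷ [])
            (λ v → local′ (role v) (h v) (l v) (r v) (λ j → ≤-trans 3≤e (≤-reflexive (sym (reach≡ v j)))))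
      where
      local′ : ∀ ρ h l r → (ρ ≡ off → 3 ≤ l + r) → offPath? ρ * is0 h ≤ ≥2 l + ≥2 r
      local′ off 0 0 (suc (suc r)) p = ≤-refl
      local′ off 0 0 0 p = contradiction (p refl) λ ()
      local′ off 0 0 1 p = contradiction (p refl) λ { (s≤s ()) }
      local′ off 0 1 0 p = contradiction (p refl) λ { (s≤s ()) }
      local′ off 0 1 1 p = contradiction (p refl) λ { (s≤s (s≤s ())) }
      local′ off 0 1 (suc (suc r)) p = ≤-refl
      local′ off 0 (suc (suc l)) r p = s≤s z≤n
      local′ off (suc h) l r p = z≤n
      local′ on h l r p = z≤n
      local′ free h l r p = z≤n
    summary : k ≤ 3 * m + 590
    summary = lin 10 (λ k a ν m f e j x y h → k ⊑ 2 ⊛ a ⊕ ν ⊕ con 6 ∷ 2 ⊛ a ⊑ 2 ⊛ (j ⊕ m) ∷ 2 ⊛ j ⊑ 2 ⊛ (x ⊕ y) ∷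
        2 ⊛ x ⊑ 2 ⊛ h ∷ 2 ⊛ y ⊑ 2 ⊛ h ∷ 4 ⊛ h ⊑ 4 ⊛ con 146 ∷ f ⊕ e ⊕ ν ⊕ con 2 ⊑ m ∷ [] ⊢ k ⊑ 3 ⊛ m ⊕ con 590)
      k (S a) ν m (S f) e (S aJ) (S (≥2 ∘ l)) (S (≥2 ∘ r)) (S h₁)
      matched-bound (*-monoʳ-≤ 2 bare-off) (*-monoʳ-≤ 2 far) (*-monoʳ-≤ 2 farL) (*-monoʳ-≤ 2 farR) (*-monoʳ-≤ 4 heights) slack
    numbers : 1 ≤ 0
    numbers = lin 2 (λ k m → 50 ⊛ k ⊑ 50 ⊛ (3 ⊛ m ⊕ con 590) ∷ 3 ⊛ (50 ⊛ m) ⊑ 3 ⊛ (k ⊕ con 2547) ∷ 47 ⊛ con 2502 ⊑ 47 ⊛ k ∷ []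
        ⊢ con 1 ⊑ con 0)
      k m (*-monoʳ-≤ 50 summary) (*-monoʳ-≤ 3 few-on-path) (*-monoʳ-≤ 47 2502≤k)

  -- Matched vertices have no reach, so a tree forces both neighbours on the cycle to be unmatched.
  -- Counting makes both implications equivalences; then no vertex is unmatched and H is a bare
  -- cycle, which contradicts `path`.
  e≢0 : e ≢ 0
  e≢0 e≡0 = contradiction (lin 5 (λ k m n L ν → L ⊕ con 0 ⊕ ν ⊕ k ⊑ m ⊕ n ⊕ con 1 ∷ n ⊑ L ∷ m ⊑ con 2 ∷ con 2502 ⊑ k ∷ [] ⊢ con 1 ⊑ con 0)
      k m n L ν (subst (λ e → L + e + ν + k ≤ m + n + 1) e≡0 path) size≤ m≤2 2502≤k) λ ()
    where
    nb : ℕ → ℕ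
    nb v = pos (h v)
    nb-per : ∀ v → nb (v + L) ≡ nb v
    nb-per v = cong pos (h-per v)
    l≡0 : ∀ v → role v ≢ free → l v ≡ 0
    l≡0 v i = n≤0⇒n≡0 (≤-trans (m≤m+n (l v) (r v)) (≤-trans (reach≤ v i) (≤-reflexive e≡0)))
    r≡0 : ∀ v → role v ≢ free → r v ≡ 0
    r≡0 v i = n≤0⇒n≡0 (≤-trans (m≤n+m (r v) (l v)) (≤-trans (reach≤ v i) (≤-reflexive e≡0)))
    low : ∀ ρ h x → (ρ ≢ free → h ⊔ x ≡ 0) → pos h ≤ free? ρ
    low free 0 x p = z≤n
    low free (suc h) x p = ≤-refl
    low off h x p with n≤0⇒n≡0 (≤-trans (m≤m⊔n h x) (≤-reflexive (p λ ())))
    ... | refl = z≤n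
    low on h x p with n≤0⇒n≡0 (≤-trans (m≤m⊔n h x) (≤-reflexive (p λ ())))
    ... | refl = z≤n
    ahead : ∀ v → nb v ≤ f (suc v)
    ahead v = low (role (suc v)) (h v) (l v ∸ 1) (λ i → trans (sym (l-suc v)) (l≡0 (suc v) i))
    behind : ∀ v → nb (suc v) ≤ f v
    behind v = low (role v) (h (suc v)) (r (suc v) ∸ 1) (λ i → trans (sym (r-suc v)) (r≡0 v i))
    m≤2+nb : m ≤ 2 + S (λ v → p v * nb v)
    m≤2+nb = lin 3 (λ m d x → m ⊑ d ⊕ x ∷ d ⊕ con 2 ⊑ con 4 ∷ [] ⊢ m ⊑ con 2 ⊕ x)
      m (S (λ v → p v * (2 ∸ t v))) (S (λ v → p v * nb v))
      (subst (_≤ S (λ v → p v * (2 ∸ t v)) + S (λ v → p v * nb v)) Σp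
        (Σ-ineq 3 L (λ p d x → p ⊑ d ⊕ x) (p ∷ (λ v → p v * (2 ∸ t v)) ∷ (λ v → p v * nb v) ∷ []) (λ v → local (p v) (shape v))))
      (on-path 2)
      where
      local : ∀ p {t q z h o} → Shape t q z h o → p ≤ p * (2 ∸ t) + p * pos h
      local p bare = ≤-trans (≤-reflexive (sym (*-identityʳ p))) (m≤m+n _ _)
      local p (star q) = ≤-trans (≤-reflexive (sym (*-identityʳ p))) (m≤n+m _ _)
      local p (tall _ _ _ _ _ _ _) = ≤-trans (≤-reflexive (sym (*-identityʳ p))) (m≤n+m _ _)
    on-nb : ∀ v → p v * nb v ≤ nb v
    on-nb v = ≤-trans (*-monoˡ-≤ (nb v) (p≤1 (role v))) (≤-reflexive (+-identityʳ _))
      where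
      p≤1 : ∀ ρ → onPath? ρ ≤ 1
      p≤1 off  = z≤n
      p≤1 on   = ≤-refl
      p≤1 free = z≤n
    f≤nb : S f ≤ S nb
    f≤nb = lin 6 (λ f e ν m x nb → f ⊕ e ⊕ ν ⊕ con 2 ⊑ m ∷ m ⊑ con 2 ⊕ x ∷ x ⊑ nb ∷ [] ⊢ f ⊑ nb)
      (S f) e ν m (S (λ v → p v * nb v)) (S nb) slack m≤2+nb (Σ<-mono L on-nb)
    -- `Σ<-tight` covers one period; the rest follows by descent in steps of `L`.
    tight : ∀ g g′ → (∀ v → g (v + L) ≡ g v) → (∀ v → g′ (v + L) ≡ g′ v) → (∀ v → g v ≤ g′ v) → S g′ ≤ S g →
            ∀ N v → v < N → g v ≡ g′ v
    tight g g′ per per′ le ge (suc N) v (s≤s v≤N) with v <? L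
    ... | yes v<L = Σ<-tight L le ge v v<L
    ... | no v≮L = begin-equality
      g v             ≡⟨ cong g (sym (m∸n+n≡m L≤v)) ⟩
      g (v ∸ L + L)   ≡⟨ per (v ∸ L) ⟩
      g (v ∸ L)       ≡⟨ tight g g′ per per′ le ge N (v ∸ L) (<-≤-trans (∸-monoʳ-< 0<L L≤v) v≤N) ⟩
      g′ (v ∸ L)      ≡⟨ sym (per′ (v ∸ L)) ⟩
      g′ (v ∸ L + L)  ≡⟨ cong g′ (m∸n+n≡m L≤v) ⟩
      g′ v            ∎
      where
      open ≤-Reasoning
      L≤v : L ≤ v
      L≤v = ≮⇒≥ v≮L
      0<L : 0 < L
      0<L = ≤-trans (s≤s z≤n) (≤-trans 2502≤k (≤-trans (m≤n+m k (S f)) (≤-reflexive size)))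
    ahead≡ : ∀ v → nb v ≡ f (suc v)
    ahead≡ v = tight nb (f ∘ suc) nb-per (λ v → f-per (suc v)) ahead (≤-trans (≤-reflexive (shift f f-per)) f≤nb) (suc v) v ≤-refl
    behind≡ : ∀ v → nb (suc v) ≡ f v
    behind≡ v = tight (nb ∘ suc) f (λ v → nb-per (suc v)) f-per behind
      (≤-trans f≤nb (≤-reflexive (sym (shift nb nb-per)))) (suc v) v ≤-refl
    -- two consecutive matched vertices force every later vertex to be matched
    Pair : ℕ → Set
    Pair v = f v ≡ 0 × f (suc v) ≡ 0
    pair? : ∀ v → Pair v ⊎ 1 ≤ f v + f (suc v)
    pair? v with f v | f (suc v)
    ... | zero  | zero  = inj₁ (refl , refl)
    ... | zero  | suc _ = inj₂ (s≤s z≤n)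
    ... | suc _ | _     = inj₂ (s≤s z≤n)
    find : ∀ N → (∃ λ v → v < N × Pair v) ⊎ N ≤ Σ< N (λ v → f v + f (suc v))
    find zero = inj₂ z≤n
    find (suc N) with pair? N | find N
    ... | inj₁ q | _ = inj₁ (N , ≤-refl , q)
    ... | inj₂ _ | inj₁ (v , v<N , q) = inj₁ (v , m≤n⇒m≤1+n v<N , q)
    ... | inj₂ a | inj₂ b = inj₂ (+-mono-≤ a b)
    start : ∃ λ v → v < L × Pair v
    start with find L
    ... | inj₁ w = w
    -- Without such a pair at least half of the cycle vertices are unmatched, which leaves at most
    -- n/2 matched ones.
    ... | inj₂ many = ⊥-elim (1+n≰n {0} (lin 5 (λ L f′ f k n → L ⊑ f ⊕ f′ ∷ f′ ⊑ f ∷ 2 ⊛ (f ⊕ k) ⊑ 2 ⊛ L ∷ n ⊕ con 3 ⊑ 2 ⊛ k ∷ L ⊑ n ∷ [] ⊢ con 1 ⊑ con 0)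
        L (S (f ∘ suc)) (S f) k n (≤-trans many (≤-reflexive (Σ<-+ L f (f ∘ suc)))) (≤-reflexive (shift f f-per))
        (*-monoʳ-≤ 2 (≤-reflexive size)) n+3≤2k L≤n))
      where
      L≤n : L ≤ n
      L≤n = ≤-trans (≤-trans (≤-reflexive (trans (sym (*-identityʳ L)) (sym (Σ<-const L 1)))) (Σ<-mono L (λ v → size≥1 (shape v)))) (≤-reflexive Σt)
    v₀ : ℕ
    v₀ = proj₁ start
    onward : ∀ j → Pair (j + v₀)
    onward zero = proj₂ (proj₂ start)
    onward (suc j) = proj₂ (onward j) ,
      trans (sym (ahead≡ (suc j + v₀))) (trans (behind≡ (j + v₀)) (proj₁ (onward j)))
    f≡0 : ∀ v → f v ≡ 0
    f≡0 v = trans (sym (f-per v)) (trans (cong f (sym (m∸n+n≡m (≤-trans (<⇒≤ (proj₁ (proj₂ start))) (m≤n+m L v)))))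
              (proj₁ (onward (v + L ∸ v₀))))
    nb≡0 : ∀ v → nb v ≡ 0
    nb≡0 v = trans (ahead≡ v) (f≡0 (suc v))
    m≤2 : m ≤ 2
    m≤2 = ≤-trans m≤2+nb (+-monoʳ-≤ 2 (≤-trans (Σ<-mono L {g = λ _ → 0} (λ v → ≤-trans (on-nb v) (≤-reflexive (nb≡0 v))))
            (≤-reflexive (trans (Σ<-const L 0) (*-zeroʳ L)))))
    size≤ : n ≤ L
    size≤ = ≤-trans (≤-reflexive (sym Σt)) (≤-trans (Σ<-mono L {g = λ _ → 1} (λ v → local (shape v) (nb≡0 v)))
              (≤-reflexive (trans (Σ<-const L 1) (*-identityʳ L))))
      where
      local : ∀ {t q z h o} → Shape t q z h o → pos h ≡ 0 → t ≤ 1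
      local bare _ = ≤-refl
      local (star q) ()
      local (tall _ _ _ _ _ _ _) ()

  absurd : ⊥
  absurd with e in eq
  ... | 0 = e≢0 eq
  ... | 1 = e≢1 eq
  ... | 2 = e≢2 eq
  ... | suc (suc (suc _)) = e≱3 (≤-trans (s≤s (s≤s (s≤s z≤n))) (≤-reflexive (sym eq)))

-- From the graphs to the census

∑-weigh : ∀ {m n} (φ : Fin m → Fin n) (f : Fin m → ℕ) (g : Fin n → ℕ) →
          (∀ i → f i ≤ 1) → (∀ i j → 1 ≤ f i → 1 ≤ f j → φ i ≡ φ j → i ≡ j) →
          sum (λ i → f i * g (φ i)) ≤ sum g
∑-weigh φ f g f≤1 inj = begin
  sum (λ i → f i * g (φ i))                         ≡⟨ ∑-cong (λ i → sym (trans (∑-cong (λ j → x*yz≈y*xz (δ (φ i) j) (f i) (g j))) (trans (∑-* (f i) (λ j → δ (φ i) j * g j)) (cong (f i *_) (∑-δ (φ i) g))))) ⟩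
  sum (λ i → sum (λ j → δ (φ i) j * (f i * g j)))   ≡⟨ ∑-comm (λ i j → δ (φ i) j * (f i * g j)) ⟩
  sum (λ j → sum (λ i → δ (φ i) j * (f i * g j)))   ≡⟨ ∑-cong (λ j → trans (∑-cong (λ i → sym (*-assoc (δ (φ i) j) (f i) (g j)))) (∑-*ʳ (g j) (λ i → δ (φ i) j * f i))) ⟩
  sum (λ j → sum (λ i → δ (φ i) j * f i) * g j)     ≤⟨ ∑-mono (λ j → ≤-trans (*-monoˡ-≤ (g j) (once j)) (≤-reflexive (*-identityˡ (g j)))) ⟩
  sum g                                             ∎
  where
  open ≤-Reasoning
  open import Algebra.Properties.CommutativeSemigroup *-commutativeSemigroup renaming (x∙yz≈y∙xz to x*yz≈y*xz) using ()
  once : ∀ j → sum (λ i → δ (φ i) j * f i) ≤ 1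
  once j = ∑-≤1 (λ i → *-mono-≤ (𝟙≤1 (does (φ i ≟F j))) (f≤1 i)) (λ i i′ p q → both i i′ (*-positive (δ (φ i) j) (f i) p) (*-positive (δ (φ i′) j) (f i′) q))
    where
    both : ∀ i i′ → 1 ≤ δ (φ i) j × 1 ≤ f i → 1 ≤ δ (φ i′) j × 1 ≤ f i′ → i ≡ i′
    both i i′ (d , p) (d′ , p′) = inj i i′ p p′ (trans (δ-elim {i = φ i} d) (sym (δ-elim {i = φ i′} d′)))

-- Twice the sum of `s − 1`, `s − 2`, ... is at most `s * s − s`; the subtraction is moved to the
-- left.
triangle : ∀ N s → 2 * Σ< N (λ l → s ∸ suc l) + s ≤ s * s
triangle zero zero = z≤n
triangle zero (suc s) = m≤m+n (suc s) (s * suc s)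
triangle (suc N) zero = ≤-reflexive (trans (+-identityʳ _) (trans (cong (2 *_) (trans (Σ<-const (suc N) 0) (*-zeroʳ (suc N)))) refl))
triangle (suc N) (suc s) = begin
  2 * Σ< (suc N) (λ l → s ∸ l) + suc s                ≡⟨ cong (λ x → 2 * x + suc s) (Σ<-front N (λ l → s ∸ l)) ⟩
  2 * (s + Σ< N (λ l → s ∸ suc l)) + suc s            ≤⟨ lin 3 (λ s r q → 2 ⊛ r ⊕ s ⊑ q ∷ [] ⊢ 2 ⊛ (s ⊕ r) ⊕ (con 1 ⊕ s) ⊑ con 1 ⊕ s ⊕ (s ⊕ q)) s (Σ< N (λ l → s ∸ suc l)) (s * s) (triangle N s) ⟩
  suc s + (s + s * s)                                 ≡⟨ cong (suc s +_) (sym (*-suc s s)) ⟩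
  suc s * suc s                                       ∎
  where open ≤-Reasoning

-- The window moves by one vertex. The term that leaves it belongs, in both applications, to the
-- tree that enters as `f 0`, seen once round the cycle; hence the last hypothesis.
maxTo-step : ∀ n (f g : ℕ → ℕ) → (∀ j → j < n → f (suc j) ≡ g j ∸ 1) → g n ∸ 1 ≤ f 0 →
             maxTo (suc n) f ≡ f 0 ⊔ (maxTo (suc n) g ∸ 1)
maxTo-step n f g e last = ≤-antisym (maxTo-lub (suc n) f _ up) (⊔-lub (maxTo-≥ (suc n) f 0 (s≤s z≤n)) (down (maxTo-arg n g)))
  where
  up : ∀ j → j < suc n → f j ≤ f 0 ⊔ (maxTo (suc n) g ∸ 1)
  up zero    _ = m≤m⊔n (f 0) _
  up (suc j) (s≤s p) = ≤-trans (≤-reflexive (e j p)) (≤-trans (∸-monoˡ-≤ 1 (maxTo-≥ (suc n) g j (m≤n⇒m≤1+n p))) (m≤n⊔m (f 0) _))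
  down : (∃ λ j → j < suc n × maxTo (suc n) g ≡ g j) → maxTo (suc n) g ∸ 1 ≤ maxTo (suc n) f
  down (j , s≤s j≤n , eq) = ≤-trans (≤-reflexive (cong (_∸ 1) eq)) (go (j ≟ n))
    where
    go : Dec (j ≡ n) → g j ∸ 1 ≤ maxTo (suc n) f
    go (yes refl) = ≤-trans last (maxTo-≥ (suc n) f 0 (s≤s z≤n))
    go (no j≢n) = ≤-trans (≤-reflexive (sym (e j (≤∧≢⇒< j≤n j≢n)))) (maxTo-≥ (suc n) f (suc j) (s≤s (≤∧≢⇒< j≤n j≢n)))

∸-sum-≤ : ∀ h a h′ b e → h ≤ e + a → h′ ≤ e + b → h + h′ ≤ e + a + b → (h ∸ a) + (h′ ∸ b) ≤ e
∸-sum-≤ h a h′ b e p p′ q = go (≤-total a h) (≤-total b h′)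
  where
  lone : ∀ x c → x ≤ e + c → x ∸ c ≤ e
  lone x c le = ≤-trans (∸-monoˡ-≤ c le) (≤-reflexive (m+n∸n≡m e c))
  go : a ≤ h ⊎ h ≤ a → b ≤ h′ ⊎ h′ ≤ b → (h ∸ a) + (h′ ∸ b) ≤ e
  go (inj₂ h≤a) _ = ≤-trans (≤-reflexive (cong (_+ (h′ ∸ b)) (m≤n⇒m∸n≡0 h≤a))) (lone h′ b p′)
  go (inj₁ _) (inj₂ h≤b) = ≤-trans (≤-reflexive (trans (cong ((h ∸ a) +_) (m≤n⇒m∸n≡0 h≤b)) (+-identityʳ _))) (lone h a p)
  go (inj₁ a≤h) (inj₁ b≤h) = +-cancelʳ-≤ (a + b) _ _ (begin
    (h ∸ a) + (h′ ∸ b) + (a + b)      ≡⟨ interchange (h ∸ a) (h′ ∸ b) a b ⟩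
    (h ∸ a + a) + (h′ ∸ b + b)        ≡⟨ cong₂ _+_ (m∸n+n≡m a≤h) (m∸n+n≡m b≤h) ⟩
    h + h′                            ≤⟨ q ⟩
    e + a + b                         ≡⟨ +-assoc e a b ⟩
    e + (a + b)                       ∎)
    where
    open ≤-Reasoning

module Family {m} (G H : Graph (suc m)) (connG : Connected G) (fewG : degrees G ≤ 2 * m)
              (connH : Connected H) {k₀} (C : Cycle H k₀) (fewH : degrees H ≤ 2 * suc m) (big : 4 ≤ m)
              {k} (xs ys : Fin k → Fin (suc m)) (xs-inj : ∀ {i j} → xs i ≡ xs j → i ≡ j)
              (ys-inj : ∀ {i j} → ys i ≡ ys j → i ≡ j) (Ms : ∀ i → Match H G (ys i) (xs i))
              (on-ring : ∀ i → ∃ λ t → proj₁ C t ≡ ys i) (dg : ∀ i → deg H (ys i) ≡ suc (deg G (xs i)))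
              (n+3≤2k : suc m + 3 ≤ 2 * k) (2502≤k : 2502 ≤ k) where

  open Compare G H connG fewG connH C fewH
  open PathCounts.Marked G connG fewG big xs xs-inj

  spot : Fin k → Fin L
  spot i = proj₁ (on-ring i)

  c-spot : ∀ i → c (spot i) ≡ ys i
  c-spot i = proj₂ (on-ring i)

  spot-inj : ∀ {i j} → spot i ≡ spot j → i ≡ j
  spot-inj {i} {j} e = ys-inj (trans (sym (c-spot i)) (trans (cong c e) (c-spot j)))

  side : ∀ {w} → Dec (T.OnPath w) → Role
  side (yes _) = on
  side (no _)  = off

  sideOf : Fin k → Role
  sideOf i = side (T.onPath (xs i))

  roleOf : ∀ {t} → Dec (∃ λ i → spot i ≡ t) → Role
  roleOf (yes (i , _)) = sideOf i
  roleOf (no _)        = free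

  roleF : Fin L → Role
  roleF t = roleOf (any? (λ i → spot i ≟F t))

  role-sum : (g : Role → ℕ) → g free ≡ 0 → (w : Fin L → ℕ) →
             sum (λ t → g (roleF t) * w t) ≡ sum (λ i → g (sideOf i) * w (spot i))
  role-sum g g0 w = trans (∑-cong (λ t → each t (any? (λ i → spot i ≟F t))))
    (trans (∑-comm (λ t i → δ (spot i) t * F i))
      (∑-cong (λ i → trans (∑-*ʳ (F i) (δ (spot i))) (trans (cong (_* F i) (∑-δ₁ (spot i))) (*-identityˡ (F i))))))
    where
    F : Fin k → ℕ
    F i = g (sideOf i) * w (spot i)
    same : ∀ i j → δ (spot j) (spot i) ≡ δ i j
    same i j = δ-case {i = i} {j} (λ x → δ (spot j) (spot i) ≡ x) (λ { refl → δ-refl (spot i) }) (λ ne → δ-≢ (λ e → ne (sym (spot-inj e))))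
    each : ∀ t (d : Dec (∃ λ i → spot i ≡ t)) → g (roleOf d) * w t ≡ sum (λ i → δ (spot i) t * F i)
    each t (yes (i , refl)) = sym (trans (∑-cong (λ j → cong (_* F j) (same i j))) (∑-δ i F))
    each t (no miss) = trans (cong (_* w t) g0) (sym (∑-zero (λ i → cong (_* F i) (δ-≢ (λ e → miss (i , e))))))

  role-hit : ∀ t → roleF t ≢ free → ∃ λ i → spot i ≡ t × roleF t ≡ sideOf i
  role-hit t = go (any? (λ i → spot i ≟F t))
    where
    go : (d : Dec (∃ λ i → spot i ≡ t)) → roleOf d ≢ free → ∃ λ i → spot i ≡ t × roleOf d ≡ sideOf i
    go (yes (i , e)) _ = i , e , refl
    go (no _) ne = contradiction refl ne

  side-matched : ∀ {w} (d : Dec (T.OnPath w)) → matched? (side d) ≡ 1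
  side-matched (yes _) = refl
  side-matched (no _) = refl

  side-on : ∀ {w} (d : Dec (T.OnPath w)) → onPath? (side d) ≡ ⟪ d ⟫
  side-on (yes _) = refl
  side-on (no _) = refl

  side-off : ∀ {w} (d : Dec (T.OnPath w)) → side d ≡ off → ¬ T.OnPath w
  side-off (no n) _ = n

  matched-sum : ∀ (w : Fin L → ℕ) → Σ< L (λ v → matched? (roleF (idx v)) * w (idx v)) ≡ sum (w ∘ spot)
  matched-sum w = trans (Σ<-idx (λ t → matched? (roleF t) * w t)) (trans (role-sum matched? refl w)
    (∑-cong (λ i → trans (cong (_* w (spot i)) (side-matched (T.onPath (xs i)))) (*-identityˡ (w (spot i))))))

  path-sum : ∀ (w : Fin L → ℕ) → Σ< L (λ v → onPath? (roleF (idx v)) * w (idx v)) ≡ sum (λ i → PathCounts.onP G connG fewG big (xs i) * w (spot i))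
  path-sum w = trans (Σ<-idx (λ t → onPath? (roleF t) * w t)) (trans (role-sum onPath? refl w)
    (∑-cong (λ i → cong (_* w (spot i)) (side-on (T.onPath (xs i))))))

  onP : Fin (suc m) → ℕ
  onP = PathCounts.onP G connG fewG big

  Σt : Σ< L tN ≡ suc m
  Σt = trans (Σ<-idx size) ∑-size

  Σy : Σ< L (λ v → matched? (roleF (idx v))) ≡ k
  Σy = trans (Σ<-cong L (λ v → sym (*-identityʳ (matched? (roleF (idx v)))))) (trans (matched-sum (λ _ → 1)) (∑-1 k))

  Σp : Σ< L (λ v → onPath? (roleF (idx v))) ≡ onCount
  Σp = trans (Σ<-cong L (λ v → sym (*-identityʳ (onPath? (roleF (idx v)))))) (trans (path-sum (λ _ → 1)) (∑-cong (λ i → *-identityʳ (onP (xs i)))))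

  i₀ : Fin k
  i₀ = first 2502≤k
    where
    first : ∀ {k} → 2502 ≤ k → Fin k
    first (s≤s _) = zero

  module At (i : Fin k) = Card (Ms i) (toℕ (spot i)) (trans (cong c (idx-toℕ (spot i))) (c-spot i))

  long : L ≤ T.diam + 2
  long = At.long i₀

  e : ℕ
  e = T.diam + 2 ∸ L

  e+L : e + L ≡ T.diam + 2
  e+L = m∸n+n≡m long

  path : L + e + ν + k ≤ onCount + suc m + 1
  path = lin 7 (λ L e ν k D c n → e ⊕ L ⊑ D ⊕ con 2 ∷ D ⊕ con 1 ⊕ ν ⊕ k ⊑ c ⊕ n ∷ [] ⊢ L ⊕ e ⊕ ν ⊕ k ⊑ c ⊕ n ⊕ con 1)
    L e ν k T.diam onCount (suc m) (≤-reflexive e+L) (path-balance)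

  -- By `cut` the size of the tree exceeds the distance of `xs i` from one end of the path. Vertices
  -- on the path have different distances from either end, so each value occurs at most once on each
  -- side.
  on-path : ∀ s → Σ< L (λ v → onPath? (roleF (idx v)) * (s ∸ tN v)) + s ≤ s * s
  on-path s = begin
    Σ< L (λ v → onPath? (roleF (idx v)) * (s ∸ tN v)) + s          ≡⟨ cong (_+ s) (path-sum (λ t → s ∸ size t)) ⟩
    sum (λ i → onP (xs i) * (s ∸ size (spot i))) + s               ≤⟨ +-monoˡ-≤ s (∑-mono halves) ⟩
    sum (λ i → onP (xs i) * g (lv i) + onP (xs i) * g (lv′ i)) + s ≡⟨ cong (_+ s) (∑-+ (λ i → onP (xs i) * g (lv i)) (λ i → onP (xs i) * g (lv′ i))) ⟩
    sum (λ i → onP (xs i) * g (lv i)) + sum (λ i → onP (xs i) * g (lv′ i)) + s ≤⟨ +-monoˡ-≤ s (+-mono-≤ (∑-weigh lv (onP ∘ xs) g (λ _ → 𝟙≤1 _) (λ i j p q → lv-inj (on-elim p) (on-elim q) ∘ cong toℕ)) (∑-weigh lv′ (onP ∘ xs) g (λ _ → 𝟙≤1 _) (λ i j p q → lv′-inj (on-elim p) (on-elim q) ∘ cong toℕ))) ⟩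
    sum g + sum g + s                                              ≡⟨ cong (λ x → sum g + x + s) (sym (+-identityʳ (sum g))) ⟩
    2 * sum g + s                                                  ≡⟨ cong (λ x → 2 * x + s) (sym (Σ<-Fin (suc T.diam) (λ l → s ∸ suc l))) ⟩
    2 * Σ< (suc T.diam) (λ l → s ∸ suc l) + s                      ≤⟨ triangle (suc T.diam) s ⟩
    s * s                                                          ∎
    where
    open ≤-Reasoning
    g : Fin (suc T.diam) → ℕ
    g l = s ∸ suc (toℕ l)
    lv≤ : ∀ i → T.level (xs i) < suc T.diam
    lv≤ i = s≤s (T.diam-max T.end₁ (xs i))
    lv′≤ : ∀ i → T.diam ∸ T.level (xs i) < suc T.diam
    lv′≤ i = s≤s (m∸n≤m T.diam (T.level (xs i)))
    lv lv′ : Fin k → Fin (suc T.diam)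
    lv i = fromℕ< (lv≤ i)
    lv′ i = fromℕ< (lv′≤ i)
    on-elim : ∀ {i} → 1 ≤ onP (xs i) → T.OnPath (xs i)
    on-elim {i} p = ⟪⟫-elim (T.onPath (xs i)) p
    level-inj : ∀ {i j} → T.OnPath (xs i) → T.OnPath (xs j) → T.level (xs i) ≡ T.level (xs j) → i ≡ j
    level-inj p q e = xs-inj (trans (sym (T.node-level p)) (trans (cong T.node e) (T.node-level q)))
    lv-inj : ∀ {i j} → T.OnPath (xs i) → T.OnPath (xs j) → toℕ (lv i) ≡ toℕ (lv j) → i ≡ j
    lv-inj {i} {j} p q e = level-inj p q (trans (sym (toℕ-fromℕ< (lv≤ i))) (trans e (toℕ-fromℕ< (lv≤ j))))
    lv′-inj : ∀ {i j} → T.OnPath (xs i) → T.OnPath (xs j) → toℕ (lv′ i) ≡ toℕ (lv′ j) → i ≡ j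
    lv′-inj {i} {j} p q e = level-inj p q (∸-cancelˡ-≡ (s≤s⁻¹ (lv≤ i)) (s≤s⁻¹ (lv≤ j)) (trans (sym (toℕ-fromℕ< (lv′≤ i))) (trans e (toℕ-fromℕ< (lv′≤ j)))))
    size-at : ∀ i → tN (toℕ (spot i)) ≡ size (spot i)
    size-at i = cong size (idx-toℕ (spot i))
    bound₁ : ∀ i → suc (T.level (xs i)) ≤ tN (toℕ (spot i)) → s ∸ size (spot i) ≤ g (lv i)
    bound₁ i p = ∸-monoʳ-≤ s (≤-trans (≤-reflexive (cong suc (toℕ-fromℕ< (lv≤ i)))) (≤-trans p (≤-reflexive (size-at i))))
    bound₂ : ∀ i → suc (T.diam ∸ T.level (xs i)) ≤ tN (toℕ (spot i)) → s ∸ size (spot i) ≤ g (lv′ i)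
    bound₂ i p = ∸-monoʳ-≤ s (≤-trans (≤-reflexive (cong suc (toℕ-fromℕ< (lv′≤ i)))) (≤-trans p (≤-reflexive (size-at i))))
    halves : ∀ i → onP (xs i) * (s ∸ size (spot i)) ≤ onP (xs i) * g (lv i) + onP (xs i) * g (lv′ i)
    halves i = ⟪⟫-case (T.onPath (xs i)) (λ x → x * (s ∸ size (spot i)) ≤ x * g (lv i) + x * g (lv′ i)) (λ p → pick (At.cut i p)) (λ _ → z≤n)
      where
      pick : suc (T.level (xs i)) ≤ tN (toℕ (spot i)) ⊎ suc (T.diam ∸ T.level (xs i)) ≤ tN (toℕ (spot i)) →
             1 * (s ∸ size (spot i)) ≤ 1 * g (lv i) + 1 * g (lv′ i)
      pick (inj₁ p) = ≤-trans (*-monoʳ-≤ 1 (bound₁ i p)) (m≤m+n _ _)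
      pick (inj₂ p) = ≤-trans (*-monoʳ-≤ 1 (bound₂ i p)) (m≤n+m _ (1 * g (lv i)))

  open Budget L e k (suc m) onCount ν (roleF ∘ idx) tN (λ v → size≥1 (shape (idx v))) Σt Σy Σp n+3≤2k path on-path public
    using () renaming (size to size-L; slack to slack-L; few-on-path to few-on-path-L)

  holes : ℕ
  holes = Σ< L (λ v → free? (roleF (idx v)))

  on-bound : 50 * onCount ≤ k + 2547
  on-bound = few-on-path-L

  module Spot {i v} (iv : spot i ≡ idx v) = Card (Ms i) v (trans (cong c (sym iv)) (c-spot i))

  module Reach {i v} (iv : spot i ≡ idx v) where
    open Spot iv using (pair)

    -- Compare with the tree at the far end of the opened cycle, or with the one at position 1 if
    -- `p` is that end.
    reach₁ : ∀ p → 1 ≤ p → p ≤ L′ → hN (v + p) ≤ e + pred p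
    reach₁ p 1≤p p≤L′ = go (p ≟ L′)
      where
      go : Dec (p ≡ L′) → hN (v + p) ≤ e + pred p
      go (no p≢) = +-cancelʳ-≤ L _ _ (lin 7 (λ h h′ p q e D k → h ⊕ h′ ⊕ (con 2 ⊕ k) ⊑ D ⊕ p ∷ D ⊕ con 2 ⊑ e ⊕ (con 3 ⊕ k) ∷ p ⊑ q ⊕ con 1 ∷ [] ⊢ h ⊕ (con 3 ⊕ k) ⊑ e ⊕ q ⊕ (con 3 ⊕ k))
        (hN (v + p)) (hN (v + L′)) p (pred p) e T.diam k₀ (pair p L′ 1≤p (≤∧≢⇒< p≤L′ p≢) ≤-refl) (≤-reflexive (sym e+L)) (≤-trans (≤-reflexive (sym (suc-pred p {{>-nonZero 1≤p}}))) (≤-reflexive (+-comm 1 (pred p)))))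
      go (yes refl) = +-cancelʳ-≤ L _ _ (lin 5 (λ h h′ e D k → h′ ⊕ h ⊕ (con 2 ⊕ k) ⊑ D ⊕ con 1 ∷ D ⊕ con 2 ⊑ e ⊕ (con 3 ⊕ k) ∷ [] ⊢ h ⊕ (con 3 ⊕ k) ⊑ e ⊕ (con 1 ⊕ k) ⊕ (con 3 ⊕ k))
        (hN (v + L′)) (hN (v + 1)) e T.diam k₀ (pair 1 L′ ≤-refl (s≤s (s≤s z≤n)) ≤-refl) (≤-reflexive (sym e+L)))

    reach₂ : ∀ p → 1 ≤ p → p ≤ L′ → hN (v + p) ≤ e + (L′ ∸ p)
    reach₂ p 1≤p p≤L′ = go (p ≟ 1)
      where
      gap : L′ ≤ L′ ∸ p + p
      gap = ≤-reflexive (sym (m∸n+n≡m p≤L′))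
      go : Dec (p ≡ 1) → hN (v + p) ≤ e + (L′ ∸ p)
      go (no p≢) = lin 7 (λ h h′ p g e D k → h′ ⊕ h ⊕ p ⊑ D ⊕ con 1 ∷ D ⊕ con 2 ⊑ e ⊕ (con 3 ⊕ k) ∷ con 2 ⊕ k ⊑ g ⊕ p ∷ [] ⊢ h ⊑ e ⊕ g)
        (hN (v + p)) (hN (v + 1)) p (L′ ∸ p) e T.diam k₀ (pair 1 p ≤-refl (≤∧≢⇒< 1≤p (p≢ ∘ sym)) (s≤s p≤L′)) (≤-reflexive (sym e+L)) gap
      go (yes refl) = lin 5 (λ h h′ e D k → h ⊕ h′ ⊕ (con 2 ⊕ k) ⊑ D ⊕ con 1 ∷ D ⊕ con 2 ⊑ e ⊕ (con 3 ⊕ k) ∷ [] ⊢ h ⊑ e ⊕ (con 1 ⊕ k))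
        (hN (v + 1)) (hN (v + L′)) e T.diam k₀ (pair 1 L′ ≤-refl (s≤s (s≤s z≤n)) ≤-refl) (≤-reflexive (sym e+L))

  k≤L : k ≤ L
  k≤L = ≤-trans (m≤n+m k holes) (≤-reflexive size-L)

  -- The `holes + 1` positions before `w` are distinct and cannot all be free.
  matched-before : ∀ w → ∃ λ i → ∃ λ j → j ≤ holes × spot i ≡ idx (w + (L′ ∸ j))
  matched-before w = go (any? (λ i → any? (λ (j : Fin (suc holes)) → spot i ≟F idx (w + (L′ ∸ toℕ j)))))
    where
    Hit : Set
    Hit = ∃ λ i → ∃ λ (j : Fin (suc holes)) → spot i ≡ idx (w + (L′ ∸ toℕ j))
    go : Dec Hit → ∃ λ i → ∃ λ j → j ≤ holes × spot i ≡ idx (w + (L′ ∸ j))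
    go (yes (i , j , e)) = i , toℕ j , s≤s⁻¹ (toℕ<n j) , e
    go (no miss) = contradiction (≤-trans (≤-trans (≤-reflexive (sym (∑-1 (suc holes))))
        (∑-inj back (λ _ → 1) (free? ∘ roleF) (λ _ → ≤-refl) (λ i j _ _ e → back-inj e) (λ j _ → ≤-reflexive (sym (empty j)))))
        (≤-reflexive (sym (Σ<-idx (free? ∘ roleF))))) 1+n≰n
      where
      back : Fin (suc holes) → Fin L
      back j = idx (w + (L′ ∸ toℕ j))
      j≤ : ∀ (j : Fin (suc holes)) → toℕ j ≤ L′
      j≤ j = ≤-trans (s≤s⁻¹ (toℕ<n j)) (s≤s⁻¹ (≤-trans (≤-trans (≤-reflexive (+-comm 1 holes)) (+-monoʳ-≤ holes (≤-trans (s≤s z≤n) 2502≤k))) (≤-reflexive size-L)))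
      back-inj : ∀ {i j} → back i ≡ back j → i ≡ j
      back-inj {i} {j} e = toℕ-injective (∸-cancelˡ-≡ (j≤ i) (j≤ j) (idx-inj (s≤s (m∸n≤m L′ (toℕ i))) (s≤s (m∸n≤m L′ (toℕ j))) (idx-cancel w e)))
      empty : ∀ j → free? (roleF (back j)) ≡ 1
      empty j = is-free (roleF (back j)) refl
        where
        hit : roleF (back j) ≢ free → ⊥
        hit ne with role-hit (back j) ne
        ... | i , e , _ = miss (i , j , e)
        is-free : ∀ ρ → roleF (back j) ≡ ρ → free? ρ ≡ 1
        is-free free _ = refl
        is-free off q = ⊥-elim (hit (λ z → contradiction (trans (sym q) z) λ ()))
        is-free on  q = ⊥-elim (hit (λ z → contradiction (trans (sym q) z) λ ()))

  -- Seen from a matched vertex shortly before `w`, the height is at most `e + holes`, which the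
  -- budget makes small against `L`.
  low : ∀ w → 2 * hN w + 2 ≤ L
  low w = go (matched-before w)
    where
    go : (∃ λ i → ∃ λ j → j ≤ holes × spot i ≡ idx (w + (L′ ∸ j))) → 2 * hN w + 2 ≤ L
    go (i , j , j≤ , iv) = *-cancelˡ-≤ 50 (lin 7 (λ h e S N m k L →
          2 ⊛ (50 ⊛ h) ⊑ 2 ⊛ (50 ⊛ (e ⊕ S)) ∷ 2 ⊛ (50 ⊛ (S ⊕ e ⊕ N ⊕ con 2)) ⊑ 2 ⊛ (50 ⊛ m) ∷ 2 ⊛ (50 ⊛ m) ⊑ 2 ⊛ (k ⊕ con 2547) ∷ 50 ⊛ k ⊑ 50 ⊛ L ∷ 48 ⊛ con 2502 ⊑ 48 ⊛ k ∷ [] ⊢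
          50 ⊛ (2 ⊛ h ⊕ con 2) ⊑ 50 ⊛ L)
        (hN w) e holes ν onCount k L (*-monoʳ-≤ 2 (*-monoʳ-≤ 50 upper))
        (*-monoʳ-≤ 2 (*-monoʳ-≤ 50 slack-L)) (*-monoʳ-≤ 2 on-bound) (*-monoʳ-≤ 50 k≤L) (*-monoʳ-≤ 48 2502≤k))
      where
      j<L′ : suc j ≤ L′
      j<L′ = s≤s⁻¹ (≤-trans (s≤s (s≤s j≤)) (≤-trans (≤-trans (≤-reflexive (+-comm 2 holes)) (+-monoʳ-≤ holes (≤-trans (s≤s (s≤s z≤n)) 2502≤k))) (≤-reflexive size-L)))
      back : w + (L′ ∸ j) + suc j ≡ w + L
      back = trans (+-assoc w (L′ ∸ j) (suc j)) (cong (w +_) (trans (+-suc (L′ ∸ j) j) (cong suc (m∸n+n≡m (≤-trans (n≤1+n j) j<L′)))))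
      upper : hN w ≤ e + holes
      upper = ≤-trans (≤-trans (≤-reflexive (cong height (sym (trans (cong idx back) (idx-per w))))) (Reach.reach₁ iv (suc j) (s≤s z≤n) j<L′)) (+-monoʳ-≤ e j≤)

  low′ : ∀ w → hN w ≤ L′
  low′ w = lin 2 (λ h k → 2 ⊛ h ⊕ con 2 ⊑ con 3 ⊕ k ∷ [] ⊢ h ⊑ con 2 ⊕ k) (hN w) k₀ (low w)

  reach≤ : ∀ {i v} → spot i ≡ idx v → reachL v + reachR v ≤ e
  reach≤ {i} {v} iv = go (maxTo-arg L′ (λ j → hN (v + (L′ ∸ j)) ∸ j)) (maxTo-arg L′ (λ j → hN (v + suc j) ∸ j))
    where
    open Reach iv
    hv : hN (v + 0) ∸ L′ ≡ 0
    hv = m≤n⇒m∸n≡0 (low′ (v + 0))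
    hv′ : hN (v + L) ∸ L′ ≡ 0
    hv′ = m≤n⇒m∸n≡0 (low′ (v + L))
    lone : ∀ x c → x ≤ e + c → x ∸ c ≤ e
    lone x c le = ≤-trans (∸-monoˡ-≤ c le) (≤-reflexive (m+n∸n≡m e c))
    both : ∀ j j′ → j < L′ → j′ < L′ → (hN (v + (L′ ∸ j)) ∸ j) + (hN (v + suc j′) ∸ j′) ≤ e
    both j j′ p p′ = ∸-sum-≤ (hN (v + (L′ ∸ j))) j (hN (v + suc j′)) j′ e left right joint
      where
      1≤q : 1 ≤ L′ ∸ j
      1≤q = m<n⇒0<n∸m p
      q≤ : L′ ∸ j ≤ L′
      q≤ = m∸n≤m L′ j
      gap : L′ ∸ j + j ≡ L′
      gap = m∸n+n≡m (<⇒≤ p)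
      left : hN (v + (L′ ∸ j)) ≤ e + j
      left = ≤-trans (reach₂ (L′ ∸ j) 1≤q q≤) (≤-reflexive (cong (e +_) (m∸[m∸n]≡n (<⇒≤ p))))
      right : hN (v + suc j′) ≤ e + j′
      right = reach₁ (suc j′) (s≤s z≤n) p′
      joint : hN (v + (L′ ∸ j)) + hN (v + suc j′) ≤ e + j + j′
      joint = order (<-cmp (L′ ∸ j) (suc j′))
        where
        order : Tri (L′ ∸ j < suc j′) (L′ ∸ j ≡ suc j′) (suc j′ < L′ ∸ j) → hN (v + (L′ ∸ j)) + hN (v + suc j′) ≤ e + j + j′
        order (tri< a _ _) = lin 8 (λ h h′ q j j′ e D k → h ⊕ h′ ⊕ (con 1 ⊕ j′) ⊑ D ⊕ q ∷ q ⊕ con 1 ⊑ con 1 ⊕ j′ ∷ con 1 ⊕ q ⊑ con 1 ⊕ j′ ∷ D ⊕ con 2 ⊑ e ⊕ (con 3 ⊕ k) ∷ con 2 ⊕ k ⊑ q ⊕ j ∷ [] ⊢ h ⊕ h′ ⊑ e ⊕ j ⊕ j′)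
          (hN (v + (L′ ∸ j))) (hN (v + suc j′)) (L′ ∸ j) j j′ e T.diam k₀ (Spot.pair iv (L′ ∸ j) (suc j′) 1≤q a (s≤s p′)) (≤-trans (≤-reflexive (+-comm (L′ ∸ j) 1)) a) a (≤-reflexive (sym e+L)) (≤-reflexive (sym gap))
        order (tri> _ _ a) = lin 8 (λ h h′ q j j′ e D k → h′ ⊕ h ⊕ q ⊑ D ⊕ (con 1 ⊕ j′) ∷ D ⊕ con 2 ⊑ e ⊕ (con 3 ⊕ k) ∷ con 2 ⊕ k ⊑ q ⊕ j ∷ [] ⊢ h ⊕ h′ ⊑ e ⊕ j ⊕ j′)
          (hN (v + (L′ ∸ j))) (hN (v + suc j′)) (L′ ∸ j) j j′ e T.diam k₀ (Spot.pair iv (suc j′) (L′ ∸ j) (s≤s z≤n) a (s≤s q≤)) (≤-reflexive (sym e+L)) (≤-reflexive (sym gap))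
        -- Both reaches come from the same tree, about which `pair` says nothing; here `low` takes
        -- its place.
        order (tri≈ _ a _) = lin 6 (λ h j j′ e D k → 2 ⊛ h ⊕ con 2 ⊑ con 3 ⊕ k ∷ con 3 ⊕ k ⊑ D ⊕ con 2 ∷ D ⊕ con 2 ⊑ e ⊕ (con 3 ⊕ k) ∷ con 2 ⊕ k ⊑ (con 1 ⊕ j′) ⊕ j ∷ [] ⊢ h ⊕ h ⊑ e ⊕ j ⊕ j′)
          (hN (v + (L′ ∸ j))) j j′ e T.diam k₀ (low (v + (L′ ∸ j))) long (≤-reflexive (sym e+L)) (≤-trans (≤-reflexive (sym gap)) (≤-reflexive (cong (_+ j) a)))
          |> subst (λ z → hN (v + (L′ ∸ j)) + hN (v + z) ≤ e + j + j′) a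
          where
          infixl 1 _|>_
          _|>_ : ∀ {A B : Set} → A → (A → B) → B
          x |> f = f x
    go : (∃ λ j → j < L × reachL v ≡ hN (v + (L′ ∸ j)) ∸ j) → (∃ λ j → j < L × reachR v ≡ hN (v + suc j) ∸ j) → reachL v + reachR v ≤ e
    go (j , s≤s j≤ , eL) (j′ , s≤s j′≤ , eR) = ≤-trans (≤-reflexive (cong₂ _+_ eL eR)) (split (j ≟ L′) (j′ ≟ L′))
      where
      split : Dec (j ≡ L′) → Dec (j′ ≡ L′) → (hN (v + (L′ ∸ j)) ∸ j) + (hN (v + suc j′) ∸ j′) ≤ e
      split (no a) (no b) = both j j′ (≤∧≢⇒< j≤ a) (≤∧≢⇒< j′≤ b)
      -- The index `L′` reads the tree at `v` itself, which is too low to contribute; only a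
      -- one-sided bound remains to be shown.
      split (no a) (yes refl) = ≤-trans (≤-reflexive (trans (cong (hN (v + (L′ ∸ j)) ∸ j +_) hv′) (+-identityʳ _)))
        (lone _ j (≤-trans (reach₂ (L′ ∸ j) (m<n⇒0<n∸m (≤∧≢⇒< j≤ a)) (m∸n≤m L′ j)) (≤-reflexive (cong (e +_) (m∸[m∸n]≡n j≤)))))
      split (yes refl) b = ≤-trans (≤-reflexive (cong (_+ (hN (v + suc j′) ∸ j′)) (trans (cong (λ z → hN (v + z) ∸ L′) (n∸n≡0 L′)) hv))) (right b)
        where
        right : Dec (j′ ≡ L′) → hN (v + suc j′) ∸ j′ ≤ e
        right (yes refl) = ≤-trans (≤-reflexive hv′) z≤n
        right (no b) = lone _ j′ (reach₁ (suc j′) (s≤s z≤n) (≤∧≢⇒< j′≤ b))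

-- Leaf counts of matched vertices, and the census

module Impossible {m} (G H : Graph (suc m)) (connG : Connected G) (fewG : degrees G ≤ 2 * m)
              (connH : Connected H) {k₀} (C : Cycle H k₀) (fewH : degrees H ≤ 2 * suc m) (big : 4 ≤ m)
              {k} (xs ys : Fin k → Fin (suc m)) (xs-inj : ∀ {i j} → xs i ≡ xs j → i ≡ j)
              (ys-inj : ∀ {i j} → ys i ≡ ys j → i ≡ j) (Ms : ∀ i → Match H G (ys i) (xs i))
              (on-ring : ∀ i → ∃ λ t → proj₁ C t ≡ ys i) (dg : ∀ i → deg H (ys i) ≡ suc (deg G (xs i)))
              (n+3≤2k : suc m + 3 ≤ 2 * k) (2502≤k : 2502 ≤ k) where

  open Compare G H connG fewG connH C fewH
  open PathCounts.Marked G connG fewG big xs xs-inj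
  open TreeCounts G connG big using (pendants-at≤1)
  open Family G H connG fewG connH C fewH big xs ys xs-inj ys-inj Ms on-ring dg n+3≤2k 2502≤k

  deg-x : ∀ i → deg G (xs i) ≡ 1 + kids (c (spot i))
  deg-x i = suc-injective (trans (sym (dg i)) (trans (cong (deg H) (sym (c-spot i))) (deg-ring (spot i))))

  leaf-x : ∀ i → leaf G (xs i) ≡ is0 (height (spot i))
  leaf-x i = trans (cong is1 (deg-x i)) (trans (shift (kids (c (spot i)))) (kids-bare (spot i)))
    where
    shift : ∀ d → is1 (1 + d) ≡ is0 d
    shift zero    = refl
    shift (suc d) = refl

  is2-≡ : ∀ {d} → 1 ≤ is2 d → d ≡ 2
  is2-≡ {2} _ = refl

  root-≢ : ∀ {j u} → Child (c j) u → u ≢ c j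
  root-≢ {j} k e = contradiction (trans (sym (child-dep k)) (trans (cong dep e) (dep-c j))) λ ()

  -- The only other vertex of the tree is a leaf at `y` and becomes isolated in the card. As G is
  -- connected, its image is a leaf at `x`, and `x` has degree 2, one less than `y`.
  size-2⇒ : ∀ i → size (spot i) ≡ 2 → 1 ≤ pendants-at G (xs i)
  size-2⇒ i s = go (height j) refl
    where
    j : Fin L
    j = spot i
    open Match (Ms i)
    go : ∀ h → height j ≡ h → 1 ≤ pendants-at G (xs i)
    go zero e = contradiction (trans (sym s) (proj₁ (shape-bare j e))) λ ()
    go (suc h) e = ≤-trans (≤-reflexive (sym is-pendant)) (term≤∑ (λ w → pendant G w (xs i)) (to u))
      where
      u : V
      u = proj₁ (some-kid j e)
      ku : Child (c j) u
      ku = proj₂ (some-kid j e)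
      ku′ : Child (ys i) u
      ku′ = subst (λ z → Child z u) (c-spot i) ku
      inside : ∀ {w} → rt w ≡ j → 1 ≤ δ (rt w) j
      inside {w} r = ≤-reflexive (sym (trans (cong (λ z → δ z j) r) (δ-refl j)))
      rt-u : rt u ≡ j
      rt-u = trans (rt-child ku) (rt-c j)
      leaf-u : kids u ≡ 0
      leaf-u = n≤0⇒n≡0 (≮⇒≥ (λ lt → third (∑-pos (ch u) lt)))
        where
        third : (∃ λ w → 1 ≤ ch u w) → ⊥
        third (w , p) = contradiction (≤-trans (∑-three (λ z → δ (rt z) j) (root-≢ ku ∘ sym) deep (λ q → apart q) (inside (rt-c j)) (inside rt-u) (inside (trans (rt-child k′) rt-u))) (≤-reflexive s)) 1+n≰n
          where
          k′ : Child u w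
          k′ = ch-elim p
          apart : u ≢ w
          apart q = 1+n≢n (sym (trans (cong dep q) (child-dep k′)))
          deep : c j ≢ w
          deep q = contradiction (trans (sym (child-dep k′)) (trans (cong dep (sym q)) (dep-c j))) λ ()
      u≢y : u ≢ ys i
      u≢y q = root-≢ ku (trans q (sym (c-spot i)))
      deg-u : deg H u ≡ 1
      deg-u = trans (deg-off u (≤-trans (s≤s z≤n) (≤-reflexive (sym (child-dep ku))))) (cong suc leaf-u)
      same : A G (to u) (xs i) ≡ deg G (to u)
      same = suc-injective (trans (cong (_+ A G (to u) (xs i)) (sym deg-u)) (trans (MatchCounts.deg-match (Ms i) u u≢y)
        (trans (cong (deg G (to u) +_) (A-edge H (edge-sym H (child-edge ku′)))) (+-comm _ 1))))
      deg-v : deg G (to u) ≡ 1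
      deg-v = ≤-antisym (≤-trans (≤-reflexive (sym same)) (𝟙≤1 _)) (deg≥1 G connG big (to u))
      kids-1 : kids (c j) ≡ 1
      kids-1 = ≤-antisym (s≤s⁻¹ (≤-trans (kids-size j) (≤-reflexive s))) (kid ku)
      is-pendant : pendant G (to u) (xs i) ≡ 1
      is-pendant = cong₂ _*_ (trans same deg-v) (cong₂ (λ a b → is1 a * is2 b) deg-v (trans (deg-x i) (cong suc kids-1)))

  size-2⇐ : ∀ i → 1 ≤ pendants-at G (xs i) → size (spot i) ≡ 2
  size-2⇐ i p = go (∑-pos (λ w → pendant G w (xs i)) p)
    where
    j : Fin L
    j = spot i
    open Match (Ms i)
    go : (∃ λ u → 1 ≤ pendant G u (xs i)) → size (spot i) ≡ 2
    go (u , q) = lone-kid j (subst (λ z → Child z u′) (sym (c-spot i)) (below (kind e′))) (≤-reflexive kids-1) (leaf-kids u′ leaf-u′)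
      where
      adjacent : 1 ≤ A G u (xs i)
      adjacent = proj₁ (*-positive (A G u (xs i)) _ q)
      leaf-u : deg G u ≡ 1
      leaf-u = leaf-elim G (proj₁ (*-positive (leaf G u) _ (proj₂ (*-positive (A G u (xs i)) _ q))))
      kids-1 : kids (c j) ≡ 1
      kids-1 = suc-injective (trans (sym (deg-x i)) (is2-≡ (proj₂ (*-positive (leaf G u) _ (proj₂ (*-positive (A G u (xs i)) _ q))))))
      u′ : V
      u′ = from u
      u≢x : u ≢ xs i
      u≢x = edge-irrefl G (edge-A G adjacent)
      u′≢y : u′ ≢ ys i
      u′≢y r = u≢x (trans (sym (to-from u)) (trans (cong to r) to-x))
      same : deg H u′ ≡ A H u′ (ys i)
      same = suc-injective (trans (+-comm 1 (deg H u′)) (trans (cong (deg H u′ +_) (sym (trans (cong (λ z → A G z (xs i)) (to-from u)) (A-edge G (edge-A G adjacent)))))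
        (trans (MatchCounts.deg-match (Ms i) u′ u′≢y) (cong (_+ A H u′ (ys i)) (trans (cong (deg G) (to-from u)) leaf-u)))))
      e′ : Edge H u′ (ys i)
      e′ = edge-A H (≤-trans (deg≥1 H connH big u′) (≤-reflexive same))
      leaf-u′ : 1 ≤ leaf H u′
      leaf-u′ = ≤-reflexive (sym (leaf-intro H (trans same (A-edge H e′))))
      dep-y : dep (ys i) ≡ 0
      dep-y = trans (cong dep (sym (c-spot i))) (dep-c j)
      below : Kind u′ (ys i) → Child (ys i) u′
      below (along d _ _) = contradiction (≤-trans (leaf-dep u′ leaf-u′) (≤-reflexive d)) λ ()
      below (down k) = contradiction (trans (sym (child-dep k)) dep-y) λ ()
      below (upw k) = k

  pendants-x : ∀ i → is2 (size (spot i)) ≡ pendants-at G (xs i)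
  pendants-x i = ≤-antisym (go (1 ≤? is2 (size (spot i)))) (back (1 ≤? pendants-at G (xs i)))
    where
    go : Dec (1 ≤ is2 (size (spot i))) → is2 (size (spot i)) ≤ pendants-at G (xs i)
    go (yes p) = ≤-trans (is2≤1 _) (size-2⇒ i (is2-≡ p))
    go (no p) = ≤-trans (≤-reflexive (n<1⇒n≡0 (≰⇒> p))) z≤n
    back : Dec (1 ≤ pendants-at G (xs i)) → pendants-at G (xs i) ≤ is2 (size (spot i))
    back (yes p) = ≤-trans (pendants-at≤1 (xs i)) (≤-reflexive (sym (cong is2 (size-2⇐ i p))))
    back (no p) = ≤-trans (≤-reflexive (n<1⇒n≡0 (≰⇒> p))) z≤n

  -- Otherwise the trees at matched vertices would have at least `2 * k` vertices. At such a spot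
  -- the degrees are 1 in G and 2 in H, so comparing the graphs there costs only 4 = 1 + 1 + 2
  -- leaves and 10 = 1 + 3 + 6 pendant paths.
  bare-spot : ∃ λ i → height (spot i) ≡ 0
  bare-spot = go (any? (λ i → height (spot i) ≟ 0))
    where
    go : Dec (∃ λ i → height (spot i) ≡ 0) → ∃ λ i → height (spot i) ≡ 0
    go (yes q) = q
    go (no miss) = contradiction (lin 2 (λ n k → 2 ⊛ k ⊑ n ∷ n ⊕ con 3 ⊑ 2 ⊛ k ∷ [] ⊢ con 3 ⊑ con 0) (suc m) k
        (≤-trans (≤-reflexive (trans (*-comm 2 k) (sym (∑-const k 2)))) (≤-trans (∑-mono two) parts≤)) n+3≤2k) λ ()
      where
      high : ∀ j → height j ≢ 0 → 2 ≤ size j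
      high j ne = pick (height j) refl
        where
        pick : ∀ h → height j ≡ h → 2 ≤ size j
        pick zero e = contradiction e ne
        pick (suc h) e = ≤-trans (s≤s (kid (proj₂ (some-kid j e)))) (kids-size j)
      two : ∀ i → 2 ≤ size (spot i)
      two i = high (spot i) (λ e → miss (i , e))
      parts≤ : sum (size ∘ spot) ≤ suc m
      parts≤ = ≤-trans (≤-reflexive (sym (∑-cong (λ i → *-identityˡ (size (spot i))))))
        (≤-trans (∑-weigh spot (λ _ → 1) size (λ _ → ≤-refl) (λ i j _ _ q → spot-inj q)) (≤-reflexive ∑-size))

  i₁ : Fin k
  i₁ = proj₁ bare-spot

  leaf-1 : deg G (xs i₁) ≡ 1
  leaf-1 = leaf-elim G (≤-reflexive (sym (trans (leaf-x i₁) (cong is0 (proj₂ bare-spot)))))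

  deg-y : deg H (ys i₁) ≡ 2
  deg-y = trans (dg i₁) (cong suc leaf-1)

  leaves-G≤ : leaves G ≤ leaves H + 4
  leaves-G≤ = ≤-trans (MatchCounts.leaves-≤ (match-sym (Ms i₁))) (≤-reflexive (cong₂ (λ a b → leaves H + (1 + a + b)) leaf-1 deg-y))
  leaves-H≤ : leaves H ≤ leaves G + 4
  leaves-H≤ = ≤-trans (MatchCounts.leaves-≤ (Ms i₁)) (≤-reflexive (cong₂ (λ a b → leaves G + (1 + a + b)) deg-y leaf-1))
  pendants-G≤ : pendants G ≤ pendants H + 10
  pendants-G≤ = ≤-trans (PendantCounts.pendants-≤ (match-sym (Ms i₁))) (≤-reflexive (cong₂ (λ a b → pendants H + (1 + 3 * a + 3 * b)) leaf-1 deg-y))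
  pendants-H≤ : pendants H ≤ pendants G + 10
  pendants-H≤ = ≤-trans (PendantCounts.pendants-≤ (Ms i₁)) (≤-reflexive (cong₂ (λ a b → pendants G + (1 + 3 * a + 3 * b)) deg-y leaf-1))

  Σq : Σ< L (leafs ∘ idx) ≡ leaves H
  Σq = trans (Σ<-idx leafs) (∑-parts (leaf H))
  Σz : Σ< L (pends ∘ idx) ≡ pendants H
  Σz = trans (Σ<-idx pends) (∑-parts (λ u → sum (pendant H u)))
  Σa : Σ< L (λ v → matched? (roleF (idx v)) * is0 (hN v)) ≡ sum (leaf G ∘ xs)
  Σa = trans (matched-sum (is0 ∘ height)) (∑-cong (λ i → sym (leaf-x i)))
  ΣN : Σ< L (λ v → matched? (roleF (idx v)) * is2 (tN v)) ≡ sum (pendants-at G ∘ xs)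
  ΣN = trans (matched-sum (is2 ∘ size)) (∑-cong pendants-x)

  l-suc : ∀ v → reachL (suc v) ≡ hN v ⊔ (reachL v ∸ 1)
  l-suc v = trans (maxTo-step L′ (λ j → hN (suc v + (L′ ∸ j)) ∸ j) (λ j → hN (v + (L′ ∸ j)) ∸ j) inner-step last)
      (cong (_⊔ (reachL v ∸ 1)) front)
    where
    front : hN (suc v + L′) ≡ hN v
    front = trans (cong hN (sym (+-suc v L′))) (cong height (idx-per v))
    inner-step : ∀ j → j < L′ → hN (suc v + (L′ ∸ suc j)) ∸ suc j ≡ hN (v + (L′ ∸ j)) ∸ j ∸ 1
    inner-step j p = trans (cong (λ z → hN z ∸ suc j) (trans (sym (+-suc v _)) (cong (v +_) (sym (+-∸-assoc 1 p)))))
      (trans (cong (hN (v + (L′ ∸ j)) ∸_) (+-comm 1 j)) (sym (∸-+-assoc (hN (v + (L′ ∸ j))) j 1)))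
    last : hN (v + (L′ ∸ L′)) ∸ L′ ∸ 1 ≤ hN (suc v + L′)
    last = ≤-trans (m∸n≤m _ 1) (≤-trans (m∸n≤m _ L′) (≤-reflexive (trans (cong hN (trans (cong (v +_) (n∸n≡0 L′)) (+-identityʳ v))) (sym front))))

  r-suc : ∀ v → reachR v ≡ hN (suc v) ⊔ (reachR (suc v) ∸ 1)
  r-suc v = trans (maxTo-step L′ (λ j → hN (v + suc j) ∸ j) (λ j → hN (suc v + suc j) ∸ j) inner-step last)
      (cong (_⊔ (reachR (suc v) ∸ 1)) (cong hN (+-comm v 1)))
    where
    inner-step : ∀ j → j < L′ → hN (v + suc (suc j)) ∸ suc j ≡ hN (suc v + suc j) ∸ j ∸ 1
    inner-step j p = trans (cong (λ z → hN z ∸ suc j) (+-suc v (suc j)))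
      (trans (cong (hN (suc v + suc j) ∸_) (+-comm 1 j)) (sym (∸-+-assoc (hN (suc v + suc j)) j 1)))
    last : hN (suc v + L) ∸ L′ ∸ 1 ≤ hN (v + 1)
    last = ≤-trans (m∸n≤m _ 1) (≤-trans (m∸n≤m _ L′) (≤-reflexive (trans (cong height (idx-per (suc v))) (cong hN (+-comm 1 v)))))

  swap-per : ∀ v x → idx (v + L + x) ≡ idx (v + x)
  swap-per v x = trans (cong idx (trans (+-assoc v L x) (trans (cong (v +_) (+-comm L x)) (sym (+-assoc v x L))))) (idx-per (v + x))

  -- The other trees have at least `L − 1` vertices, while n is less than `2 * L`.
  small : ∀ v → tN v ≤ T.diam + 1
  small v = lin 6 (λ t r n k L D → t ⊕ r ⊑ n ∷ L ⊑ r ⊕ con 1 ∷ n ⊕ con 3 ⊑ 2 ⊛ k ∷ 2 ⊛ k ⊑ 2 ⊛ L ∷ L ⊑ D ⊕ con 2 ∷ L ⊑ L ∷ [] ⊢ t ⊑ D ⊕ con 1)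
    (tN v) (sum (λ t → rest t)) (suc m) k L T.diam
    (≤-reflexive (trans (cong (_+ sum rest) (sym (∑-δ (idx v) size))) (trans (sym (∑-+ (λ t → δ (idx v) t * size t) rest)) (trans (∑-cong each) ∑-size))))
    (≤-trans (≤-reflexive (sym (∑-1 L))) (≤-trans (∑-mono one) (≤-reflexive (trans (∑-+ rest (δ (idx v))) (cong (sum rest +_) (∑-δ₁ (idx v)))))))
    n+3≤2k (*-monoʳ-≤ 2 k≤L) long ≤-refl
    where
    rest : Fin L → ℕ
    rest t = (1 ∸ δ (idx v) t) * size t
    each : ∀ t → δ (idx v) t * size t + rest t ≡ size t
    each t = δ-case {i = idx v} {t} (λ x → x * size t + (1 ∸ x) * size t ≡ size t) (λ _ → trans (+-identityʳ _) (*-identityˡ (size t))) (λ _ → *-identityˡ (size t))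
    one : ∀ t → 1 ≤ rest t + δ (idx v) t
    one t = δ-case {i = idx v} {t} (λ x → 1 ≤ (1 ∸ x) * size t + x) (λ _ → ≤-refl) (λ _ → ≤-trans (size≥1 (shape t)) (≤-reflexive (sym (trans (+-identityʳ _) (*-identityˡ (size t))))))

  profile : Profile
  profile = record
    { L = L ; e = e ; role = roleF ∘ idx
    ; t = tN ; q = leafs ∘ idx ; z = pends ∘ idx ; h = hN ; o = offs ∘ idx ; l = reachL ; r = reachR
    ; shape = shape ∘ idx ; l-suc = l-suc ; r-suc = r-suc
    ; reach≤ = λ v ne → reach≤ (proj₁ (proj₂ (role-hit (idx v) ne)))
    ; reach≡ = reach-off
    ; role-per = λ v → cong roleF (idx-per v)
    ; t-per = λ v → cong size (idx-per v)
    ; q-per = λ v → cong leafs (idx-per v)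
    ; z-per = λ v → cong pends (idx-per v)
    ; h-per = λ v → cong height (idx-per v)
    ; o-per = λ v → cong offs (idx-per v)
    ; l-per = λ v → maxTo-cong L (λ j → cong (λ t → height t ∸ j) (swap-per v (L′ ∸ j)))
    ; r-per = λ v → maxTo-cong L (λ j → cong (λ t → height t ∸ j) (swap-per v (suc j)))
    }
    where
    reach-off : ∀ v → roleF (idx v) ≡ off → reachL v + reachR v ≡ e
    reach-off v ro = go (role-hit (idx v) (λ f → contradiction (trans (sym ro) f) λ ()))
      where
      go : (∃ λ i → spot i ≡ idx v × roleF (idx v) ≡ sideOf i) → reachL v + reachR v ≡ e
      go (i , iv , s) = ≤-antisym (reach≤ iv) (+-cancelʳ-≤ L _ _ (≤-trans (≤-reflexive e+L)
        (Spot.covered iv (side-off (T.onPath (xs i)) (trans (sym s) ro)) (small v))))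

  census : Census profile
  census = record
    { k = k ; n = suc m ; m = onCount ; ν = ν ; Σt = Σt ; Σy = Σy ; Σp = Σp ; n+3≤2k = n+3≤2k ; 2502≤k = 2502≤k
    ; path = path ; on-path = on-path
    ; leaves≥ = subst₂ (λ a q → a ≤ q + 4) (sym Σa) (sym Σq) (≤-trans leaves-lower leaves-G≤)
    ; leaves≤ = subst₂ (λ a q → q ≤ a + ν + 6) (sym Σa) (sym Σq)
        (lin 4 (λ h g x v → h ⊑ g ⊕ con 4 ∷ g ⊑ x ⊕ v ⊕ con 2 ∷ [] ⊢ h ⊑ x ⊕ v ⊕ con 6)
          (leaves H) (leaves G) (sum (leaf G ∘ xs)) ν leaves-H≤ leaves-bound)
    -- Here 18 = 4 + 10 + 4: the comparison of H with G and the marks on the path.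
    ; leaves+ = subst₂ (λ q z → q + z ≤ Σ< L (λ v → matched? (roleF (idx v)) * is0 (hN v)) + Σ< L (λ v → matched? (roleF (idx v)) * is2 (tN v)) + ν + 18) (sym Σq) (sym Σz)
        (subst₂ (λ a N → leaves H + pendants H ≤ a + N + ν + 18) (sym Σa) (sym ΣN)
          (lin 7 (λ h g p q x y v → h ⊑ g ⊕ con 4 ∷ p ⊑ q ⊕ con 10 ∷ g ⊕ q ⊑ x ⊕ y ⊕ v ⊕ con 4 ∷ [] ⊢ h ⊕ p ⊑ x ⊕ y ⊕ v ⊕ con 18)
            (leaves H) (leaves G) (pendants H) (pendants G) (sum (leaf G ∘ xs)) (sum (pendants-at G ∘ xs)) ν leaves-H≤ pendants-H≤ marks-bound))
    ; pendants≤ = subst₂ (λ N z → N ≤ z + 10) (sym ΣN) (sym Σz) (≤-trans pendants-lower pendants-G≤)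
    }

  impossible : ⊥
  impossible = Contradictions.absurd profile census

-- Why H has as many edges as vertices

connected-degrees : ∀ {m} (X : Graph (suc m)) → Connected X → 2 * m ≤ degrees X
connected-degrees {m} X conn = ≤-trans (*-monoʳ-≤ 2 (s≤s⁻¹ (≤-reflexive (trans (sym outer≡) (+-comm outer 1)))))
    (≤-trans (m≤n+m (2 * outer) (sum {suc m} (λ _ → sum {suc m} (λ _ → 0))))
      (LayeringProps.Sparse.enough lay (λ _ _ → 0) (λ _ _ → z≤n) (λ _ _ ())))
  where
  root : Fin (suc m) → Bool
  root u = does (zero {m} ≟F u)
  lay : Layering X root
  lay = layering X root conn (zero , dec-true (zero {m} ≟F zero) refl)
  open Layering lay using (dep)
  outer : ℕ
  outer = sum (λ u → pos (dep u))
  outer≡ : outer + 1 ≡ suc m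
  outer≡ = trans (cong (outer +_) (sym (∑-δ₁ {suc m} zero))) (LayeringProps.∑-outer lay)

module NoCycle {m} (G H : Graph (suc m)) (connG : Connected G) (acG : Acyclic G) (connH : Connected H) (big : 4 ≤ m)
               {k} (xs ys : Fin k → Fin (suc m)) (xs-inj : ∀ {i j} → xs i ≡ xs j → i ≡ j)
               (ys-inj : ∀ {i j} → ys i ≡ ys j → i ≡ j) (iso : ∀ i → card G (xs i) ≅ card H (ys i))
               (n+3≤2k : suc m + 3 ≤ 2 * k) (2502≤k : 2502 ≤ k) where

  degreesG : degrees G ≡ 2 * m
  degreesG = ≤-antisym (acyclic-degrees G acG) (connected-degrees G connG)

  -- Equal cards have equally many edges, so the degrees of `ys i` and `xs i` differ by a constant,
  -- the difference of the numbers of edges of H and G.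
  balance : ∀ i → degrees H + 2 * deg G (xs i) ≡ 2 * m + 2 * deg H (ys i)
  balance i = begin-equality
    degrees H + 2 * deg G (xs i)                                       ≡⟨ cong (_+ 2 * deg G (xs i)) (degrees-card H (ys i)) ⟩
    degrees (card H (ys i)) + 2 * deg H (ys i) + 2 * deg G (xs i)      ≡⟨ cong (λ d → d + 2 * deg H (ys i) + 2 * deg G (xs i)) (sym (degrees-iso {X = card G (xs i)} {card H (ys i)} (iso i))) ⟩
    degrees (card G (xs i)) + 2 * deg H (ys i) + 2 * deg G (xs i)      ≡⟨ xy∙z≈xz∙y (degrees (card G (xs i))) _ _ ⟩
    degrees (card G (xs i)) + 2 * deg G (xs i) + 2 * deg H (ys i)      ≡⟨ cong (_+ 2 * deg H (ys i)) (trans (sym (degrees-card G (xs i))) degreesG) ⟩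
    2 * m + 2 * deg H (ys i)                                           ∎
    where
    open ≤-Reasoning

  acyclic-card : ∀ i → Acyclic (card H (ys i))
  acyclic-card i = acyclic-iso {X = card G (xs i)} {card H (ys i)} (iso i) (λ l C → acG l (cycle-card G (xs i) C))

  module _ {k₀} (C : Cycle H k₀) where

    i₀ : Fin k
    i₀ = first 2502≤k
      where
      first : ∀ {k} → 2502 ≤ k → Fin k
      first (s≤s _) = zero

    gap : ℕ
    gap = deg H (ys i₀) ∸ deg G (xs i₀)

    gap≥1 : suc (deg G (xs i₀)) ≤ deg H (ys i₀)
    gap≥1 = *-cancelˡ-≤ 2 (lin 4 (λ D m g h → D ⊕ 2 ⊛ g ⊑ 2 ⊛ m ⊕ 2 ⊛ h ∷ 2 ⊛ (con 1 ⊕ m) ⊑ D ∷ [] ⊢ 2 ⊛ (con 1 ⊕ g) ⊑ 2 ⊛ h)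
      (degrees H) m (deg G (xs i₀)) (deg H (ys i₀)) (≤-reflexive (balance i₀)) (Ring.degrees≥ H connH C))

    gap≡ : deg G (xs i₀) + gap ≡ deg H (ys i₀)
    gap≡ = m+[n∸m]≡n (≤-trans (n≤1+n _) gap≥1)

    degreesH : degrees H ≡ 2 * m + 2 * gap
    degreesH = +-cancelʳ-≡ (2 * deg G (xs i₀)) _ _ (trans (balance i₀) (trans (cong (λ h → 2 * m + 2 * h) (sym gap≡))
      (≤-antisym (lin 3 (λ m g d → [] ⊢ 2 ⊛ m ⊕ 2 ⊛ (g ⊕ d) ⊑ 2 ⊛ m ⊕ 2 ⊛ d ⊕ 2 ⊛ g) m (deg G (xs i₀)) gap)
                 (lin 3 (λ m g d → [] ⊢ 2 ⊛ m ⊕ 2 ⊛ d ⊕ 2 ⊛ g ⊑ 2 ⊛ m ⊕ 2 ⊛ (g ⊕ d)) m (deg G (xs i₀)) gap))))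

    gaps : ∀ i → deg H (ys i) ≡ deg G (xs i) + gap
    gaps i = *-cancelˡ-≡ (deg H (ys i)) (deg G (xs i) + gap) 2 (+-cancelˡ-≡ (2 * m) _ _ (trans (sym (balance i)) (trans (cong (_+ 2 * deg G (xs i)) degreesH)
      (≤-antisym (lin 3 (λ m g d → [] ⊢ 2 ⊛ m ⊕ 2 ⊛ d ⊕ 2 ⊛ g ⊑ 2 ⊛ m ⊕ 2 ⊛ (g ⊕ d)) m (deg G (xs i)) gap)
                 (lin 3 (λ m g d → [] ⊢ 2 ⊛ m ⊕ 2 ⊛ (g ⊕ d) ⊑ 2 ⊛ m ⊕ 2 ⊛ d ⊕ 2 ⊛ g) m (deg G (xs i)) gap)))))

    surplus : k * gap + suc m ≤ degrees H
    surplus = begin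
      k * gap + suc m                                     ≡⟨ cong₂ _+_ (sym (∑-const k gap)) (sym (∑-1 (suc m))) ⟩
      sum {k} (λ _ → gap) + sum {suc m} (λ _ → 1)         ≤⟨ +-monoˡ-≤ (sum {suc m} (λ _ → 1)) (∑-mono each) ⟩
      sum (λ i → 1 * (deg H (ys i) ∸ 1)) + sum {suc m} (λ _ → 1)
        ≤⟨ +-monoˡ-≤ (sum {suc m} (λ _ → 1)) (∑-weigh ys (λ _ → 1) (λ u → deg H u ∸ 1) (λ _ → ≤-refl) (λ i j _ _ e → ys-inj e)) ⟩
      sum (λ u → deg H u ∸ 1) + sum {suc m} (λ _ → 1)     ≡⟨ sym (∑-+ (λ u → deg H u ∸ 1) (λ _ → 1)) ⟩
      sum (λ u → deg H u ∸ 1 + 1)                         ≡⟨ ∑-cong (λ u → m∸n+n≡m (deg≥1 H connH big u)) ⟩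
      degrees H                                           ∎
      where
      open ≤-Reasoning
      each : ∀ i → gap ≤ 1 * (deg H (ys i) ∸ 1)
      each i = ≤-trans (≤-trans (≤-reflexive (sym (m+n∸m≡n (deg G (xs i)) gap))) (∸-mono (≤-reflexive (sym (gaps i))) (deg≥1 G connG big (xs i)))) (≤-reflexive (sym (*-identityˡ _)))

    -- Every matched vertex of H has degree at least `gap + 1`. With more than half of the vertices
    -- matched, a gap of 2 or more would push the degree sum above `2 * m + 2 * gap`.
    gap≤1 : gap ≤ 1
    gap≤1 = ≮⇒≥ λ lt → large (gap ∸ 2) (m+[n∸m]≡n lt)
      where
      large : ∀ d → 2 + d ≡ gap → ⊥
      large d p = contradiction (lin 5 (λ D m d k kd → D ⊑ 2 ⊛ m ⊕ 2 ⊛ (con 2 ⊕ d) ∷ kd ⊕ (con 1 ⊕ m) ⊑ D ∷ k ⊕ k ⊕ (d ⊕ d) ⊑ kd ∷ con 1 ⊕ m ⊕ con 3 ⊑ 2 ⊛ k ∷ [] ⊢ con 1 ⊑ con 0)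
          (degrees H) m d k (k * (2 + d)) (≤-reflexive (trans degreesH (cong (λ g → 2 * m + 2 * g) (sym p))))
          (≤-trans (≤-reflexive (cong (λ g → k * g + suc m) p)) surplus) split n+3≤2k) λ ()
        where
        split : k + k + (d + d) ≤ k * (2 + d)
        split = begin
          k + k + (d + d)      ≡⟨ cong₂ _+_ (sym (trans (*-comm k 2) (cong (k +_) (+-identityʳ k)))) (sym (cong (d +_) (+-identityʳ d))) ⟩
          k * 2 + 2 * d        ≤⟨ +-monoʳ-≤ (k * 2) (*-monoˡ-≤ d (≤-trans (s≤s (s≤s z≤n)) 2502≤k)) ⟩
          k * 2 + k * d        ≡⟨ sym (*-distribˡ-+ k 2 d) ⟩
          k * (2 + d)          ∎
          where open ≤-Reasoning

    no-cycle : ⊥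
    no-cycle = Impossible.impossible G H connG (≤-reflexive degreesG) connH C fewH big xs ys xs-inj ys-inj
        (λ i → match-sym (card-match {X = G} {H} (iso i))) (λ i → cycle-hits H (ys i) (acyclic-card i) C) one n+3≤2k 2502≤k
      where
      gap-1 : gap ≡ 1
      gap-1 = ≤-antisym gap≤1 (+-cancelˡ-≤ (deg G (xs i₀)) _ _ (≤-trans (≤-reflexive (+-comm _ 1)) (≤-trans gap≥1 (≤-reflexive (sym gap≡)))))
      fewH : degrees H ≤ 2 * suc m
      fewH = ≤-reflexive (trans degreesH (trans (cong (λ g → 2 * m + 2 * g) gap-1) (trans (+-comm (2 * m) 2) (sym (*-suc 2 m)))))
      one : ∀ i → deg H (ys i) ≡ suc (deg G (xs i))
      one i = trans (gaps i) (trans (cong (deg G (xs i) +_) gap-1) (+-comm _ 1))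

-- Connectedness

Closed : ∀ {n} → Graph n → (Fin n → Bool) → Set
Closed X S = ∀ {u w} → Edge X u w → S u ≡ S w

count : ∀ {n} → (Fin n → Bool) → ℕ
count S = sum (λ u → 𝟙 (S u))

count-not : ∀ {n} (S : Fin n → Bool) → count S + count (not ∘ S) ≡ n
count-not {n} S = trans (sym (∑-+ (λ u → 𝟙 (S u)) (λ u → 𝟙 (not (S u))))) (trans (∑-cong (λ u → one (S u))) (∑-1 n))
  where
  one : ∀ b → 𝟙 b + 𝟙 (not b) ≡ 1
  one true  = refl
  one false = refl

𝟙-true : ∀ {b} → 1 ≤ 𝟙 b → b ≡ true
𝟙-true {true} _ = refl

true≢false : ∀ {b} → b ≡ true → b ≡ false → ⊥
true≢false refl ()

-- Adding vertices one at a time, at most n times, reaches the whole component.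
component : ∀ {n} (X : Graph n) u → ∃ λ (S : Fin n → Bool) → S u ≡ true × (∀ w → S w ≡ true → Walk X u w) × Closed X S
component {n} X u = grow n (λ w → does (u ≟F w)) (m≤n+m n _) (dec-true (u ≟F u) refl) start
  where
  start : ∀ w → does (u ≟F w) ≡ true → Walk X u w
  start w p with u ≟F w
  ... | yes refl = here
  extend : ∀ {v w z} → Walk X v w → Edge X w z → Walk X v z
  extend here e = step e here
  extend (step f p) e = step f (extend p e)
  is-false : ∀ {b} → b ≢ true → b ≡ false
  is-false {true} p = contradiction refl p
  is-false {false} p = refl
  Result : Set
  Result = ∃ λ (S : Fin n → Bool) → S u ≡ true × (∀ w → S w ≡ true → Walk X u w) × Closed X S
  grow : ∀ fuel (T : Fin n → Bool) → n ≤ count T + fuel → T u ≡ true → (∀ w → T w ≡ true → Walk X u w) → Result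
  grow fuel T le Tu reach = go (any? (λ w → any? (λ z → (T w B.≟ true) ×-dec (edge? X w z ×-dec (T z B.≟ false)))))
    where
    Leak : Set
    Leak = ∃ λ w → ∃ λ z → T w ≡ true × Edge X w z × T z ≡ false
    go : Dec Leak → Result
    go (no tight) = T , Tu , reach , closed
      where
      flow : ∀ {w z} → Edge X w z → T w ≡ true → T z ≡ true
      flow {w} {z} e p = pick (T z) refl
        where
        pick : ∀ b → T z ≡ b → T z ≡ true
        pick true  q = q
        pick false q = contradiction (w , z , p , e , q) tight
      closed : Closed X T
      closed {w} {z} e = pick (T w) refl
        where
        pick : ∀ b → T w ≡ b → T w ≡ T z
        pick true  p = trans p (sym (flow e p))
        pick false p = trans p (sym (is-false (λ q → true≢false (flow (edge-sym X e) q) p)))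
    go (yes (w , z , Tw , e , Tz)) = refuel fuel le
      where
      T′ : Fin n → Bool
      T′ v = does (z ≟F v) ∨ T v
      bigger : count T′ ≡ 1 + count T
      bigger = trans (∑-cong each) (trans (∑-+ (δ z) (λ v → 𝟙 (T v))) (cong (_+ count T) (∑-δ₁ z)))
        where
        each : ∀ v → 𝟙 (T′ v) ≡ δ z v + 𝟙 (T v)
        each v with z ≟F v
        ... | yes refl = sym (cong (λ b → 1 + 𝟙 b) Tz)
        ... | no _ = refl
      reach′ : ∀ v → T′ v ≡ true → Walk X u v
      reach′ v p with z ≟F v
      ... | yes refl = extend (reach w Tw) e
      ... | no _ = reach v p
      Tu′ : T′ u ≡ true
      Tu′ with z ≟F u
      ... | yes _ = refl
      ... | no _ = Tu
      count≤ : count T′ ≤ n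
      count≤ = ≤-trans (∑-mono (λ v → 𝟙≤1 (T′ v))) (≤-reflexive (∑-1 n))
      refuel : ∀ fuel → n ≤ count T + fuel → Result
      refuel zero le = contradiction (≤-trans (≤-reflexive (sym bigger)) (≤-trans count≤ (≤-trans le (≤-reflexive (+-identityʳ _))))) 1+n≰n
      refuel (suc fuel) le = grow fuel T′ (≤-trans le (≤-reflexive (trans (+-suc (count T) fuel) (cong (_+ fuel) (sym bigger))))) Tu′ reach′

-- A union of components of G − x having b vertices.
record Part {n} (G : Graph n) (b : ℕ) (x : Fin n) : Set where
  field
    R : Fin n → Bool
    R-x : R x ≡ false
    closed : ∀ {u w} → u ≢ x → w ≢ x → Edge G u w → R u ≡ R w
    count≡ : count R ≡ b

module Parts {n} (G : Graph n) (conn : Connected G) where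

  -- A set P whose edges leave it only towards x is attached to x, hence together with x
  -- on one side of every partition of G − x′ when it avoids x′.
  attached : ∀ {x x′} (P : Fin n → Set) → (∀ {u w} → P u → Edge G u w → w ≡ x ⊎ P w) → x ≢ x′ → (∀ {u} → P u → u ≢ x′) →
             (Z : Fin n → Bool) → (∀ {u w} → u ≢ x′ → w ≢ x′ → Edge G u w → Z u ≡ Z w) → ∀ {u} → P u → Z u ≡ Z x
  attached {x} {x′} P out x≢ avoid Z closed {u} Pu = go (conn u x) Pu
    where
    go : ∀ {u} → Walk G u x → P u → Z u ≡ Z x
    go here _ = refl
    go (step e p) Pu = next (out Pu e)
      where
      next : _ ⊎ _ → _
      next (inj₁ refl) = closed (avoid Pu) x≢ e
      next (inj₂ Pw) = trans (closed (avoid Pu) (avoid Pw) e) (go p Pw)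

  module _ {b x x′} (p : Part G b x) (p′ : Part G b x′) (x≢ : x ≢ x′) where
    private
      module p = Part p
      module p′ = Part p′

    apart : p.R x′ ≡ false → p′.R x ≡ false → ∀ u → p.R u ≡ true → p′.R u ≡ false
    apart q q′ u r = trans (attached (λ u → p.R u ≡ true) out x≢ (λ { s refl → true≢false s q }) p′.R p′.closed r) q′
      where
      out : ∀ {u w} → p.R u ≡ true → Edge G u w → w ≡ x ⊎ p.R w ≡ true
      out {u} {w} s e = pick (w ≟F x)
        where
        pick : Dec (w ≡ x) → w ≡ x ⊎ p.R w ≡ true
        pick (yes t) = inj₁ t
        pick (no t) = inj₂ (trans (sym (p.closed (λ { refl → true≢false s p.R-x }) t e)) s)

    -- The vertices outside the first part are attached to `x` in G - x′, hence all on one side of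
    -- the second partition. If they were outside the second part as well, that part would lie
    -- within the first one without `x′`, which has too few vertices.
    cover : p.R x′ ≡ true → ∀ u → p.R u ≡ false → p′.R u ≡ true
    cover q u r = trans (same u r) (pick (p′.R x) refl)
      where
      out : ∀ {u w} → p.R u ≡ false × u ≢ x → Edge G u w → w ≡ x ⊎ (p.R w ≡ false × w ≢ x)
      out {u} {w} (s , u≢) e = go (w ≟F x)
        where
        go : Dec (w ≡ x) → w ≡ x ⊎ (p.R w ≡ false × w ≢ x)
        go (yes t) = inj₁ t
        go (no t) = inj₂ (trans (sym (p.closed u≢ t e)) s , t)
      same : ∀ u → p.R u ≡ false → p′.R u ≡ p′.R x
      same u r = go (u ≟F x)
        where
        go : Dec (u ≡ x) → p′.R u ≡ p′.R x
        go (yes t) = cong p′.R t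
        go (no t) = attached (λ u → p.R u ≡ false × u ≢ x) out x≢ (λ { (s , _) refl → true≢false q s }) p′.R p′.closed (r , t)
      pick : ∀ c → p′.R x ≡ c → p′.R x ≡ true
      pick true  s = s
      pick false s = contradiction (≤-trans (≤-reflexive (cong suc (sym p′.count≡))) (≤-trans (≤-reflexive (trans (cong (_+ count p′.R) (sym (∑-δ₁ x′))) (sym (∑-+ (δ x′) (λ u → 𝟙 (p′.R u)))))) (≤-trans (∑-mono le) (≤-reflexive p.count≡)))) 1+n≰n
        where
        le : ∀ u → δ x′ u + 𝟙 (p′.R u) ≤ 𝟙 (p.R u)
        le u = δ-case {i = x′} {u} (λ d → d + 𝟙 (p′.R u) ≤ 𝟙 (p.R u))
          (λ { refl → ≤-reflexive (trans (cong (λ c → 1 + 𝟙 c) p′.R-x) (cong 𝟙 (sym q))) }) (λ _ → sub (p.R u) refl)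
          where
          sub : ∀ c → p.R u ≡ c → 𝟙 (p′.R u) ≤ 𝟙 (p.R u)
          sub true  t = ≤-trans (𝟙≤1 _) (≤-reflexive (cong 𝟙 (sym t)))
          sub false t = ≤-trans (≤-reflexive (cong 𝟙 (trans (same u t) s))) z≤n

    cover-≤ : p.R x′ ≡ true → n ≤ 2 * b
    cover-≤ q = ≤-trans (≤-reflexive (sym (∑-1 n))) (≤-trans (∑-mono each)
      (≤-reflexive (trans (∑-+ (λ u → 𝟙 (p.R u)) (λ u → 𝟙 (p′.R u))) (cong₂ _+_ p.count≡ (trans p′.count≡ (sym (+-identityʳ b)))))))
      where
      each : ∀ u → 1 ≤ 𝟙 (p.R u) + 𝟙 (p′.R u)
      each u = pick (p.R u) refl
        where
        pick : ∀ c → p.R u ≡ c → 1 ≤ 𝟙 (p.R u) + 𝟙 (p′.R u)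
        pick true  t = ≤-trans (≤-reflexive (cong 𝟙 (sym t))) (m≤m+n _ _)
        pick false t = ≤-trans (≤-reflexive (cong 𝟙 (sym (cover q u t)))) (m≤n+m _ (𝟙 (p.R u)))

    apart-≤ : p.R x′ ≡ false → p′.R x ≡ false → 2 * b + 1 ≤ n
    apart-≤ q q′ = begin
      2 * b + 1                                                        ≡⟨ cong₂ _+_ (cong₂ _+_ (sym p.count≡) (trans (+-identityʳ b) (sym p′.count≡))) (sym (∑-δ₁ x)) ⟩
      count p.R + count p′.R + sum (δ x)                               ≡⟨ cong (_+ sum (δ x)) (sym (∑-+ (λ u → 𝟙 (p.R u)) (λ u → 𝟙 (p′.R u)))) ⟩
      sum (λ u → 𝟙 (p.R u) + 𝟙 (p′.R u)) + sum (δ x)                   ≡⟨ sym (∑-+ (λ u → 𝟙 (p.R u) + 𝟙 (p′.R u)) (δ x)) ⟩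
      sum (λ u → 𝟙 (p.R u) + 𝟙 (p′.R u) + δ x u)                       ≤⟨ ∑-mono each ⟩
      sum {n} (λ _ → 1)                                                ≡⟨ ∑-1 n ⟩
      n                                                                ∎
      where
      open ≤-Reasoning
      each : ∀ u → 𝟙 (p.R u) + 𝟙 (p′.R u) + δ x u ≤ 1
      each u = δ-case {i = x} {u} (λ d → 𝟙 (p.R u) + 𝟙 (p′.R u) + d ≤ 1)
        (λ { refl → ≤-reflexive (cong₂ (λ a c → 𝟙 a + 𝟙 c + 1) p.R-x q′) }) (λ _ → ≤-trans (≤-reflexive (+-identityʳ _)) (pick (p.R u) refl))
        where
        pick : ∀ c → p.R u ≡ c → 𝟙 (p.R u) + 𝟙 (p′.R u) ≤ 1
        pick true  t = ≤-reflexive (cong₂ (λ a c → 𝟙 a + 𝟙 c) t (apart q q′ u t))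
        pick false t = ≤-trans (≤-reflexive (cong (λ a → 𝟙 a + 𝟙 (p′.R u)) t)) (𝟙≤1 _)

  halves : ∀ {b x x′} (p : Part G b x) (p′ : Part G b x′) → x ≢ x′ → n ≡ 2 * b → ∀ u → 1 ≡ 𝟙 (Part.R p u) + 𝟙 (Part.R p′ u)
  halves {b} {x} {x′} p p′ x≢ n≡ = ∑-tight ge (≤-reflexive (trans (∑-+ (λ u → 𝟙 (p.R u)) (λ u → 𝟙 (p′.R u)))
      (trans (cong₂ _+_ p.count≡ (trans p′.count≡ (sym (+-identityʳ b)))) (trans (sym n≡) (sym (∑-1 n))))))
    where
    module p = Part p
    module p′ = Part p′
    either : ∀ {a c} → (a ≡ false → c ≡ true) → 1 ≤ 𝟙 a + 𝟙 c
    either {true} _ = s≤s z≤n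
    either {false} f = ≤-reflexive (cong 𝟙 (sym (f refl)))
    ge : ∀ u → 1 ≤ 𝟙 (p.R u) + 𝟙 (p′.R u)
    ge u = pick (p.R x′) (p′.R x) refl refl
      where
      pick : ∀ a c → p.R x′ ≡ a → p′.R x ≡ c → 1 ≤ 𝟙 (p.R u) + 𝟙 (p′.R u)
      pick true  _     q _ = either (cover p p′ x≢ q u)
      pick false true  _ q = ≤-trans (either (cover p′ p (x≢ ∘ sym) q u)) (≤-reflexive (+-comm (𝟙 (p′.R u)) _))
      pick false false q r = contradiction (≤-trans (≤-reflexive (+-comm 1 (2 * b))) (≤-trans (apart-≤ p p′ x≢ q r) (≤-reflexive n≡))) 1+n≰n

part : ∀ {n} {G H : Graph n} {x y} → Match G H x y → (S : Fin n → Bool) → Closed H S → S y ≡ false → Part G (count S) x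
part M S closed Sy = record
  { R = S ∘ to ; R-x = trans (cong S to-x) Sy
  ; closed = λ u≢ w≢ e → closed (edge-to u≢ w≢ e)
  ; count≡ = ∑-to (λ u → 𝟙 (S u)) }
  where open Match M

module Split {n} (G H : Graph n) (conn : Connected G)
             {k} (xs ys : Fin k → Fin n) (xs-inj : ∀ {i j} → xs i ≡ xs j → i ≡ j)
             (ys-inj : ∀ {i j} → ys i ≡ ys j → i ≡ j) (Ms : ∀ i → Match G H (xs i) (ys i))
             (n+3≤2k : n + 3 ≤ 2 * k) (3≤k : 3 ≤ k) where
  open Parts G conn

  -- When `S` is half of the vertices, `S` or its complement avoids `ys i`, so every card yields a
  -- part. Of three sets no two of which agree on a vertex, a third cannot exist: at one vertex the
  -- three memberships would pairwise sum to 1.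
  no-half : ∀ S → Closed H S → n ≡ 2 * count S → ⊥
  no-half S closed n≡ = odd (three 3≤k)
    where
    whole : count (not ∘ S) ≡ count S
    whole = +-cancelˡ-≡ (count S) _ _ (trans (count-not S) (trans n≡ (cong (count S +_) (+-identityʳ _))))
    piece : ∀ i → Part G (count S) (xs i)
    piece i = pick (S (ys i)) refl
      where
      pick : ∀ c → S (ys i) ≡ c → Part G (count S) (xs i)
      pick false s = part (Ms i) S closed s
      pick true  s = subst (λ b → Part G b (xs i)) whole (part (Ms i) (not ∘ S) (λ e → cong not (closed e)) (cong not s))
    three : ∀ {k} → 3 ≤ k → ∃ λ (a : Fin k) → ∃ λ b → ∃ λ c → a ≢ b × a ≢ c × b ≢ c
    three (s≤s (s≤s (s≤s _))) = zero , suc zero , suc (suc zero) , (λ ()) , (λ ()) , λ ()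
    odd : (∃ λ (a : Fin k) → ∃ λ b → ∃ λ c → a ≢ b × a ≢ c × b ≢ c) → ⊥
    odd (a , b , c , ab , ac , bc) = uneven (𝟙 (Part.R (piece a) (xs a))) (𝟙 (Part.R (piece b) (xs a))) (𝟙 (Part.R (piece c) (xs a)))
        (halves (piece a) (piece b) (ab ∘ xs-inj) n≡ (xs a)) (halves (piece a) (piece c) (ac ∘ xs-inj) n≡ (xs a)) (halves (piece b) (piece c) (bc ∘ xs-inj) n≡ (xs a))
      where
      uneven : ∀ p q r → 1 ≡ p + q → 1 ≡ p + r → 1 ≡ q + r → ⊥
      uneven zero q r refl refl ()
      uneven (suc zero) zero zero p q ()
      uneven (suc zero) (suc q) r () _ _
      uneven (suc zero) zero (suc r) _ () _
      uneven (suc (suc p)) q r () _ _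

  -- At most `b` of the `ys i` lie in `S`. Each of the others gives a block of `1 + b` vertices of
  -- G, its part together with `xs i`, and the blocks are disjoint.
  no-small : ∀ S → Closed H S → 1 ≤ count S → 2 * count S < n → ⊥
  no-small S closed 1≤b 2b<n = numbers outside refl
    where
    b : ℕ
    b = count S
    out : Fin k → ℕ
    out i = 𝟙 (not (S (ys i)))
    outside : ℕ
    outside = sum out
    out-S : ∀ {i} → 1 ≤ out i → S (ys i) ≡ false
    out-S {i} p = neg (𝟙-true p)
      where
      neg : ∀ {c} → not c ≡ true → c ≡ false
      neg {false} _ = refl
    R : Fin k → Fin n → Bool
    R i u = S (Match.to (Ms i) u)
    g : Fin k → Fin n → ℕ
    g i u = out i * (δ (xs i) u + 𝟙 (R i u))
    piece : ∀ {i} → 1 ≤ out i → Part G b (xs i)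
    piece {i} p = part (Ms i) S closed (out-S p)
    unhit : ∀ {i j} → 1 ≤ out i → 1 ≤ out j → xs i ≢ xs j → R i (xs j) ≡ false
    unhit {i} {j} p q ne = pick (R i (xs j)) refl
      where
      pick : ∀ c → R i (xs j) ≡ c → R i (xs j) ≡ false
      pick false s = s
      pick true  s = contradiction (cover-≤ (piece p) (piece q) ne s) (<⇒≱ 2b<n)
    ind : ∀ {i u} → 1 ≤ g i u → 1 ≤ out i × (xs i ≡ u ⊎ R i u ≡ true)
    ind {i} {u} p = proj₁ ab , case-of (proj₂ ab)
      where
      ab : 1 ≤ out i × 1 ≤ δ (xs i) u + 𝟙 (R i u)
      ab = *-positive (out i) _ p
      case-of : 1 ≤ δ (xs i) u + 𝟙 (R i u) → xs i ≡ u ⊎ R i u ≡ true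
      case-of = δ-case {i = xs i} {u} (λ d → 1 ≤ d + 𝟙 (R i u) → xs i ≡ u ⊎ R i u ≡ true) (λ e _ → inj₁ e) (λ _ q → inj₂ (𝟙-true q))
    g≤1 : ∀ i u → g i u ≤ 1
    g≤1 i u = pick (S (ys i)) refl
      where
      pick : ∀ c → S (ys i) ≡ c → g i u ≤ 1
      pick true  s = ≤-trans (≤-reflexive (cong (λ c → 𝟙 (not c) * (δ (xs i) u + 𝟙 (R i u))) s)) z≤n
      pick false s = ≤-trans (≤-reflexive (trans (cong (λ c → 𝟙 (not c) * (δ (xs i) u + 𝟙 (R i u))) s) (*-identityˡ _)))
        (δ-case {i = xs i} {u} (λ d → d + 𝟙 (R i u) ≤ 1) (λ { refl → ≤-reflexive (cong (λ c → 1 + 𝟙 c) (Part.R-x (part (Ms i) S closed s))) }) (λ _ → 𝟙≤1 _))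
    once : ∀ u → sum (λ i → g i u) ≤ 1
    once u = ∑-≤1 (λ i → g≤1 i u) (λ i j p q → same i j (ind {i} p) (ind {j} q))
      where
      same : ∀ i j → 1 ≤ out i × (xs i ≡ u ⊎ R i u ≡ true) → 1 ≤ out j × (xs j ≡ u ⊎ R j u ≡ true) → i ≡ j
      same i j (p , p′) (q , q′) = pick (xs i ≟F xs j)
        where
        clash : xs i ≢ xs j → (xs i ≡ u ⊎ R i u ≡ true) → (xs j ≡ u ⊎ R j u ≡ true) → ⊥
        clash ne (inj₁ refl) (inj₁ e)    = ne (sym e)
        clash ne (inj₁ refl) (inj₂ r)    = true≢false r (unhit {j} {i} q p (ne ∘ sym))
        clash ne (inj₂ r)    (inj₁ refl) = true≢false r (unhit {i} {j} p q ne)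
        clash ne (inj₂ r)    (inj₂ r′)   = true≢false r′ (apart (piece p) (piece q) ne (unhit {i} {j} p q ne) (unhit {j} {i} q p (ne ∘ sym)) u r)
        pick : Dec (xs i ≡ xs j) → i ≡ j
        pick (yes e) = xs-inj e
        pick (no ne) = ⊥-elim (clash ne p′ q′)
    packed : outside * (1 + b) ≤ n
    packed = begin
      outside * (1 + b)                     ≡⟨ sym (∑-*ʳ (1 + b) out) ⟩
      sum (λ i → out i * (1 + b))           ≡⟨ ∑-cong (λ i → sym (trans (∑-* (out i) (λ u → δ (xs i) u + 𝟙 (R i u))) (cong (out i *_) (trans (∑-+ (δ (xs i)) (λ u → 𝟙 (R i u))) (cong₂ _+_ (∑-δ₁ (xs i)) (Match.∑-to (Ms i) (λ u → 𝟙 (S u)))))))) ⟩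
      sum (λ i → sum (g i))                 ≡⟨ ∑-comm g ⟩
      sum (λ u → sum (λ i → g i u))         ≤⟨ ∑-mono once ⟩
      sum {n} (λ _ → 1)                     ≡⟨ ∑-1 n ⟩
      n                                     ∎
      where open ≤-Reasoning
    inside : k ≤ outside + b
    inside = ≤-trans (≤-reflexive (trans (sym (count-not (S ∘ ys))) (+-comm (count (S ∘ ys)) _))) (+-monoʳ-≤ outside
      (∑-inj ys (λ i → 𝟙 (S (ys i))) (λ u → 𝟙 (S u)) (λ i → 𝟙≤1 _) (λ i j _ _ e → ys-inj e) (λ i p → p)))
    numbers : ∀ o → outside ≡ o → ⊥
    numbers 0 e = contradiction (lin 3 (λ k b n → k ⊑ b ∷ k ⊑ b ∷ con 1 ⊕ 2 ⊛ b ⊑ n ∷ n ⊕ con 3 ⊑ 2 ⊛ k ∷ [] ⊢ con 1 ⊑ con 0) k b n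
      (subst (λ o → k ≤ o + b) e inside) (subst (λ o → k ≤ o + b) e inside) 2b<n n+3≤2k) λ ()
    numbers 1 e = contradiction (lin 3 (λ k b n → k ⊑ con 1 ⊕ b ∷ k ⊑ con 1 ⊕ b ∷ con 1 ⊕ 2 ⊛ b ⊑ n ∷ n ⊕ con 3 ⊑ 2 ⊛ k ∷ [] ⊢ con 1 ⊑ con 0) k b n
      (subst (λ o → k ≤ o + b) e inside) (subst (λ o → k ≤ o + b) e inside) 2b<n n+3≤2k) λ ()
    -- Two blocks are counted in full and each of the remaining `o` blocks with only two vertices,
    -- which already exceeds n.
    numbers (suc (suc o)) e = contradiction (lin 5 (λ k b n o ob → k ⊑ con 2 ⊕ o ⊕ b ∷ k ⊑ con 2 ⊕ o ⊕ b ∷ (con 1 ⊕ b) ⊕ ((con 1 ⊕ b) ⊕ ob) ⊑ n ∷ o ⊕ o ⊑ ob ∷ n ⊕ con 3 ⊑ 2 ⊛ k ∷ [] ⊢ con 1 ⊑ con 0)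
      k b n o (o * (1 + b)) (subst (λ o → k ≤ o + b) e inside) (subst (λ o → k ≤ o + b) e inside) (subst (λ o → o * (1 + b) ≤ n) e packed)
      (≤-trans (≤-reflexive (trans (cong (o +_) (sym (+-identityʳ o))) (*-comm 2 o))) (*-monoʳ-≤ o (s≤s 1≤b))) n+3≤2k) λ ()

  no-split : ∀ S → Closed H S → 1 ≤ count S → 2 * count S ≤ n → ⊥
  no-split S closed 1≤ le = pick (2 * count S ≟ n)
    where
    pick : Dec (2 * count S ≡ n) → ⊥
    pick (yes e) = no-half S closed (sym e)
    pick (no ne) = no-small S closed 1≤ (≤∧≢⇒< le ne)

  connected : Connected H
  connected u v = build (component H u)
    where
    build : (∃ λ (S : Fin n → Bool) → S u ≡ true × (∀ w → S w ≡ true → Walk H u w) × Closed H S) → Walk H u v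
    build (S , Su , reach , closed) = pick (S v) refl
      where
      here≥1 : ∀ (T : Fin n → Bool) w → T w ≡ true → 1 ≤ count T
      here≥1 T w p = ≤-trans (≤-reflexive (cong 𝟙 (sym p))) (term≤∑ (λ u → 𝟙 (T u)) w)
      smaller : 2 * count S ≤ n ⊎ 2 * count (not ∘ S) ≤ n
      smaller = compare′ (≤-total (count S) (count (not ∘ S)))
        where
        compare′ : count S ≤ count (not ∘ S) ⊎ count (not ∘ S) ≤ count S → 2 * count S ≤ n ⊎ 2 * count (not ∘ S) ≤ n
        compare′ (inj₁ p) = inj₁ (lin 3 (λ a b n → a ⊑ b ∷ a ⊕ b ⊑ n ∷ [] ⊢ 2 ⊛ a ⊑ n) (count S) (count (not ∘ S)) n p (≤-reflexive (count-not S)))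
        compare′ (inj₂ p) = inj₂ (lin 3 (λ a b n → b ⊑ a ∷ a ⊕ b ⊑ n ∷ [] ⊢ 2 ⊛ b ⊑ n) (count S) (count (not ∘ S)) n p (≤-reflexive (count-not S)))
      pick : ∀ c → S v ≡ c → Walk H u v
      pick true  s = reach v s
      pick false s = ⊥-elim (side-of smaller)
        where
        side-of : 2 * count S ≤ n ⊎ 2 * count (not ∘ S) ≤ n → ⊥
        side-of (inj₁ p) = no-split S closed (here≥1 S u Su) p
        side-of (inj₂ p) = no-split (not ∘ S) (λ e → cong not (closed e)) (here≥1 (not ∘ S) v (cong not s)) p

theorem1 : ∀ (m : ℕ) → 5000 ≤ suc m →
    (G H : Graph (suc m)) →
    IsTree G →
    AtLeastCommonCards ((suc m / 2) + 2) G H →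
    IsTree H
theorem1 m large G H (connG , acG) (xs , ys , xs-inj , ys-inj , iso) =
    connH , λ _ C → NoCycle.no-cycle G H connG acG connH 4≤m xs ys xs-inj ys-inj iso n+3≤2k 2502≤k C
  where
  k : ℕ
  k = suc m / 2 + 2
  n+3≤2k : suc m + 3 ≤ 2 * k
  n+3≤2k = lin 4 (λ n h r d → n ⊑ r ⊕ d ∷ r ⊑ con 1 ∷ d ⊑ 2 ⊛ h ∷ [] ⊢ n ⊕ con 3 ⊑ 2 ⊛ (h ⊕ con 2))
    (suc m) (suc m / 2) (suc m % 2) (suc m / 2 * 2)
    (≤-reflexive (m≡m%n+[m/n]*n (suc m) 2)) (s≤s⁻¹ (m%n<n (suc m) 2)) (≤-reflexive (*-comm (suc m / 2) 2))
  2502≤k : 2502 ≤ k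
  2502≤k = *-cancelˡ-< 2 2501 k (≤-trans (≤-trans (≤ᵇ⇒≤ 5003 5003 _) (+-monoˡ-≤ 3 large)) n+3≤2k)
  4≤m : 4 ≤ m
  4≤m = s≤s⁻¹ (≤-trans (≤ᵇ⇒≤ 5 5000 _) large)
  connH : Connected H
  connH = Split.connected G H connG xs ys xs-inj ys-inj (λ i → card-match {X = G} {H} (iso i)) n+3≤2k
    (≤-trans (≤ᵇ⇒≤ 3 2502 _) 2502≤k)
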